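{- Let $\mathcal{C}$ be an $[n,k,d]_{q^m/q}$ code. If $\mathcal{C}$ is rank-nondegenerate, then $$\mathbb{E}^{\mathrm{rk}}[q^{n-\mathcal{C}^*}]=\frac{ -q^n+q^{mk}+q^{m(k-1)}(q^n-1)}{q^{mk}-1},$$ $$\mathrm{Var}^{\mathrm{rk}}[q^{n-\mathcal{C}^*}]\ \ge\ \frac{ -q^{2n}+f_q(n,m,k,0,2)}{q^{mk}-1}-\mathbb{E}^{\mathrm{rk}}[q^{n-\mathcal{C}^*}]^2,$$ where the latter lower bound is attained with equality if and only if $\mathcal{C}$ is rank-2-nondegenerate.
   Context: Let $q$ be a prime power and $n,m,k$ positive integers. For $v\in\mathbb{F}_{q^m}^n$ and an ordered basis $\Gamma=(\gamma_1,\dots,\gamma_m)$ of $\mathbb{F}_{q^m}$ over $\mathbb{F}_q$, let $\Gamma(v)\in\mathbb{F}_q^{n\times m}$ be the matrix with $v_i=\sum_{j}\Gamma(v)_{ij}\gamma_j$. The rank support $\sigma^{\mathrm{rk}}(v)\subseteq\mathbb{F}_q^n$ is the column space of $\Gamma(v)$ (independent of $\Gamma$), and $\mathrm{rk}(v)=\dim_{\mathbb{F}_q}\sigma^{\mathrm{rk}}(v)$. An $[n,k,d]_{q^m/q}$ code is a $k$-dimensional $\mathbb{F}_{q^m}$-subspace $\mathcal{C}\subseteq\mathbb{F}_{q^m}^n$ whose minimum rank distance $d^{\mathrm{rk}}(\mathcal{C})=\min\{\mathrm{rk}(v): v\in\mathcal{C}, v\ne0\}$ equals $d$; the zero code in $\mathbb{F}_{q^m}^n$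 has minimum distance $n+1$ by convention. The code is rank-nondegenerate if $\sum_{v\in\mathcal{C}}\sigma^{\mathrm{rk}}(v)=\mathbb{F}_q^n$. With $\mathcal{C}^\perp=\{v\in\mathbb{F}_{q^m}^n: u v^\top=0 \ \forall u\in\mathcal{C}\}$, the code $\mathcal{C}$ is rank-2-nondegenerate if $d^{\mathrm{rk}}(\mathcal{C}^\perp)\ge 3$. $\mathcal{C}^*$ denotes the random variable $\mathrm{rk}(v)$, where $v$ is a uniformly random nonzero codeword of $\mathcal{C}$; $\mathbb{E}^{\mathrm{rk}}$ and $\mathrm{Var}^{\mathrm{rk}}$ denote mean and variance of (a function of) $\mathcal{C}^*$. Thus $\mathbb{E}^{\mathrm{rk}}[q^{n-\mathcal{C}^*}]=\frac{1}{q^{mk}-1}\sum_{v\in\mathcal{C}\setminus\{0\}}q^{n-\mathrm{rk}(v)}$. Finally, $$f_q(n,m,k,j,r)=\sum_{\nu=j}^r q^{m(k-\nu)}\binom{n-j}{\nu-j}_q\binom{r}{\nu}_q\prod_{\ell=0}^{\nu-1}(q^\nu-q^\ell),$$ where $\binom{a}{b}_q$ is the Gaussian binomial coefficient (the number of $b$-dimensional subspaces of an $a$-dimensional $\mathbb{F}_q$-space).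
   Formalization: The equality criterion is stated for n ≥ 2 only: for n = 1 the code is all of F_{q^m}, equality holds with both sides 0, but the zero dual code has minimum distance n+1 = 2 < 3 by the stated convention, so the "if and only if" fails. -}

module Defs where

open import Level using (0ℓ)
open import Algebra.Bundles using (CommutativeRing)
open import Algebra.Morphism.Structures using (module RingMorphisms)
open import Algebra.Structures using (IsCommutativeRing)
open import Data.Fin.Base using (Fin)
import Data.Fin.Properties as Fin
open import Data.Integer.Base using (ℤ; +_; -[1+_])
import Data.Integer.Base as ℤ
import Data.Integer.Properties as ℤ
open import Data.List.Base using
  (List; []; _∷_; length; map; filter; foldr; upTo; allFin; deduplicate;
   cartesianProductWith)
open import Data.List.Extrema.Nat using (min)
open import Data.List.Membership.Propositional using (_∈_; lose; find)
open import Data.List.Membership.Propositional.Properties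
  using (∈-allFin; ∈-map⁺; ∈-cartesianProductWith⁺)
import Data.List.Relation.Unary.All as All
import Data.List.Relation.Unary.Any as Any
open import Data.List.Relation.Unary.Any using (here)
open import Data.Nat.Base using (ℕ; zero; suc; NonZero; _≤_)
import Data.Nat.Base as ℕ
import Data.Nat.Properties as ℕ
open import Data.Nat.Primality using (Prime; prime⇒nonTrivial)
open import Data.Product.Base using (∃; Σ-syntax; _×_; _,_; proj₁; proj₂)
open import Data.Rational.Base using (ℚ; 0ℚ; 1ℚ)
import Data.Rational.Base as ℚ
import Data.Rational.Properties as ℚ
import Data.Rational.Unnormalised.Base as ℚᵘ
open import Data.Vec.Base as Vec using (Vec; []; _∷_)
import Data.Vec.Properties as Vec
open import Function.Base using (_∘_)
open import Function.Bundles using (_↔_; module Inverse)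
import Function.Properties.Inverse as Inverse
open import Relation.Binary.Definitions using (DecidableEquality)
open import Relation.Binary.PropositionalEquality
  using (_≡_; _≢_; refl; sym; trans; cong; cong₂; subst; module ≡-Reasoning)
open import Relation.Nullary.Negation using (¬_; contradiction)
open import Relation.Nullary.Decidable using (Dec; yes; no; ¬?; _×-dec_; _→-dec_; map′; via-injection)
open import Relation.Unary using (Pred; Decidable; _≐_)

record PrimePower (q : ℕ) : Set where
  field
    p e     : ℕ
    prime   : Prime p
    e≢0     : NonZero e
    q≡p^e   : q ≡ p ℕ.^ e

1<primePower : ∀ {q} → PrimePower q → 1 ℕ.< q
1<primePower {q} P = subst (1 ℕ.<_) (sym q≡p^e)
  (ℕ.<-≤-trans (ℕ.nonTrivial⇒n>1 p {{prime⇒nonTrivial prime}}) p≤p^e)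
  where
  open PrimePower P
  instance
    _ = e≢0
    _ = ℕ.nonTrivial⇒nonZero p {{prime⇒nonTrivial prime}}
  p≤p^e : p ≤ p ℕ.^ e
  p≤p^e = ℕ.≤-trans (ℕ.≤-reflexive (sym (ℕ.^-identityʳ p)))
            (ℕ.^-monoʳ-≤ p (ℕ.>-nonZero⁻¹ e))

primePower⇒nonZero : ∀ {q} → PrimePower q → NonZero q
primePower⇒nonZero P = ℕ.>-nonZero (ℕ.<-trans (ℕ.s≤s ℕ.z≤n) (1<primePower P))

infixr 8 _^ᶻ_
_^ᶻ_ : (q : ℕ) → ℤ → {{PrimePower q}} → ℚ
q ^ᶻ (+ e)          = (+ (q ℕ.^ e)) ℚ./ 1
(q ^ᶻ -[1+ e ]) {{P}} = ((+ 1) ℚ./ (q ℕ.^ suc e)) {{ℕ.m^n≢0 q (suc e) {{primePower⇒nonZero P}}}}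

tuples : ∀ {A : Set} → List A → (n : ℕ) → List (Vec A n)
tuples xs zero    = [] ∷ []
tuples xs (suc n) = cartesianProductWith _∷_ xs (tuples xs n)

module _ {A : Set} {xs : List A} (complete : ∀ x → x ∈ xs) where

  ∈-tuples : ∀ {n} (v : Vec A n) → v ∈ tuples xs n
  ∈-tuples []      = here refl
  ∈-tuples (x ∷ v) = ∈-cartesianProductWith⁺ _∷_ (complete x) (∈-tuples v)

  exists? : ∀ {P : Pred A 0ℓ} → Decidable P → Dec (∃ P)
  exists? P? = map′ (λ p → let x , _ , px = find p in x , px)
                    (λ (x , px) → lose (complete x) px)
                    (Any.any? P? xs)

  forall? : ∀ {P : Pred A 0ℓ} → Decidable P → Dec (∀ x → P x)
  forall? P? = map′ (λ ps x → All.lookup ps (complete x))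
                    (λ ps → All.tabulate (λ {x} _ → ps x))
                    (All.all? P? xs)

record FiniteField (order : ℕ) : Set₁ where
  infixl 7 _*_
  infixl 6 _+_
  infix  8 -_
  infix  4 _≟_
  field
    Carrier           : Set
    _+_ _*_           : Carrier → Carrier → Carrier
    -_                : Carrier → Carrier
    0# 1#             : Carrier
    isCommutativeRing : IsCommutativeRing _≡_ _+_ _*_ -_ 0# 1#
    0≢1               : 0# ≢ 1#
    inverse           : ∀ x → x ≢ 0# → ∃ λ y → x * y ≡ 1#
    enumeration       : Fin order ↔ Carrier

  commutativeRing : CommutativeRing 0ℓ 0ℓ
  commutativeRing = record { isCommutativeRing = isCommutativeRing }

  open CommutativeRing commutativeRing public
    using ( rawRing; ring; +-assoc; +-comm; +-identityˡ; +-identityʳ; -‿inverseˡ; -‿inverseʳ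
          ; *-assoc; *-comm; *-identityˡ; distribˡ; distribʳ; zeroˡ; zeroʳ)

  _≟_ : DecidableEquality Carrier
  _≟_ = via-injection (Inverse.↔⇒↣ (Inverse.↔-sym enumeration)) Fin._≟_

  elements : List Carrier
  elements = map (Inverse.to enumeration) (allFin order)

  ∈-elements : ∀ x → x ∈ elements
  ∈-elements x = subst (_∈ elements) (Inverse.strictlyInverseˡ enumeration x)
    (∈-map⁺ (Inverse.to enumeration) (∈-allFin (Inverse.from enumeration x)))

record FieldExtension {q r} (K : FiniteField q) (L : FiniteField r) : Set where
  private
    module K = FiniteField K
    module L = FiniteField L
  open RingMorphisms K.rawRing L.rawRing using (IsRingHomomorphism)
  field
    ι                  : K.Carrier → L.Carrier
    isRingHomomorphism : IsRingHomomorphism ι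

module LinearAlgebra {order : ℕ} (F : FiniteField order) where

  open FiniteField F

  infixl 6 _⊕_
  infixr 7 _·_
  infix  7 _∙_

  0ᵥ : ∀ {n} → Vec Carrier n
  0ᵥ = Vec.replicate _ 0#

  _⊕_ : ∀ {n} → Vec Carrier n → Vec Carrier n → Vec Carrier n
  _⊕_ = Vec.zipWith _+_

  _·_ : ∀ {n} → Carrier → Vec Carrier n → Vec Carrier n
  a · v = Vec.map (a *_) v

  _∙_ : ∀ {n} → Vec Carrier n → Vec Carrier n → Carrier
  u ∙ v = Vec.foldr′ _+_ 0# (Vec.zipWith _*_ u v)

  lincomb : ∀ {n r} → Vec Carrier r → Vec (Vec Carrier n) r → Vec Carrier n
  lincomb cs ws = Vec.foldr′ _⊕_ 0ᵥ (Vec.zipWith _·_ cs ws)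

  Span : ∀ {n r} → Vec (Vec Carrier n) r → Pred (Vec Carrier n) 0ℓ
  Span ws v = ∃ λ cs → lincomb cs ws ≡ v

  LinearlyIndependent : ∀ {n r} → Vec (Vec Carrier n) r → Set
  LinearlyIndependent ws = ∀ cs → lincomb cs ws ≡ 0ᵥ → cs ≡ 0ᵥ

  IsBasis : ∀ {n r} → Pred (Vec Carrier n) 0ℓ → Vec (Vec Carrier n) r → Set
  IsBasis U bs = U ≐ Span bs × LinearlyIndependent bs

  HasDimension : ∀ {n} → Pred (Vec Carrier n) 0ℓ → ℕ → Set
  HasDimension {n} U r = Σ[ bs ∈ Vec (Vec Carrier n) r ] IsBasis U bs

  -- Fⁿ is finite, so asking for decidable membership excludes no subspace.
  record Subspace (n : ℕ) : Set₁ where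
    field
      Member   : Pred (Vec Carrier n) 0ℓ
      member?  : Decidable Member
      0-closed : Member 0ᵥ
      ⊕-closed : ∀ {u v} → Member u → Member v → Member (u ⊕ v)
      ·-closed : ∀ a {v} → Member v → Member (a · v)

  infix 4 _≟ᵥ_
  _≟ᵥ_ : ∀ {n} → DecidableEquality (Vec Carrier n)
  _≟ᵥ_ = Vec.≡-dec _≟_

  vectors : ∀ n → List (Vec Carrier n)
  vectors = tuples elements

  ∈-vectors : ∀ {n} (v : Vec Carrier n) → v ∈ vectors n
  ∈-vectors = ∈-tuples ∈-elements

  span? : ∀ {n r} (ws : Vec (Vec Carrier n) r) → Decidable (Span ws)
  span? ws v = exists? ∈-vectors (λ cs → lincomb cs ws ≟ᵥ v)

  linearlyIndependent? : ∀ {n r} →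
    Decidable (LinearlyIndependent {n} {r})
  linearlyIndependent? ws = map′ (λ f cs → f cs) (λ f cs → f cs)
    (forall? ∈-vectors (λ cs → (lincomb cs ws ≟ᵥ 0ᵥ) →-dec (cs ≟ᵥ 0ᵥ)))

  _≐ₛ?_ : ∀ {n r s} (us : Vec (Vec Carrier n) r) (ws : Vec (Vec Carrier n) s) →
          Dec (Span us ≐ Span ws)
  us ≐ₛ? ws = map′
    (λ f → (λ {x} → proj₁ (f x)) , (λ {x} → proj₂ (f x)))
    (λ (f , g) x → f , g)
    (forall? ∈-vectors (λ x → (span? us x →-dec span? ws x) ×-dec (span? ws x →-dec span? us x)))

  -- The number of b-dimensional subspaces of Fᵃ, counted as the linearly
  -- independent b-tuples up to equality of their spans.
  gaussianBinomial : ℕ → ℕ → ℕ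
  gaussianBinomial a b =
    length (deduplicate _≐ₛ?_ (filter linearlyIndependent? (tuples (vectors a) b)))

  ⊕-assoc : ∀ {n} (u v w : Vec Carrier n) → (u ⊕ v) ⊕ w ≡ u ⊕ (v ⊕ w)
  ⊕-assoc = Vec.zipWith-assoc +-assoc

  ⊕-comm : ∀ {n} (u v : Vec Carrier n) → u ⊕ v ≡ v ⊕ u
  ⊕-comm = Vec.zipWith-comm +-comm

  ⊕-identityˡ : ∀ {n} (v : Vec Carrier n) → 0ᵥ ⊕ v ≡ v
  ⊕-identityˡ = Vec.zipWith-identityˡ +-identityˡ

  ⊕-medial : ∀ {n} (a b c d : Vec Carrier n) → (a ⊕ b) ⊕ (c ⊕ d) ≡ (a ⊕ c) ⊕ (b ⊕ d)
  ⊕-medial a b c d = begin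
    (a ⊕ b) ⊕ (c ⊕ d)  ≡⟨ ⊕-assoc a b _ ⟩
    a ⊕ (b ⊕ (c ⊕ d))  ≡⟨ cong (a ⊕_) (⊕-assoc b c d) ⟨
    a ⊕ ((b ⊕ c) ⊕ d)  ≡⟨ cong (λ x → a ⊕ (x ⊕ d)) (⊕-comm b c) ⟩
    a ⊕ ((c ⊕ b) ⊕ d)  ≡⟨ cong (a ⊕_) (⊕-assoc c b d) ⟩
    a ⊕ (c ⊕ (b ⊕ d))  ≡⟨ ⊕-assoc a c _ ⟨
    (a ⊕ c) ⊕ (b ⊕ d)  ∎
    where open ≡-Reasoning

  ·-distribˡ : ∀ {n} a (u v : Vec Carrier n) → a · (u ⊕ v) ≡ a · u ⊕ a · v
  ·-distribˡ a []      []      = refl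
  ·-distribˡ a (x ∷ u) (y ∷ v) = cong₂ _∷_ (distribˡ a x y) (·-distribˡ a u v)

  ·-distribʳ : ∀ {n} a b (v : Vec Carrier n) → (a + b) · v ≡ a · v ⊕ b · v
  ·-distribʳ a b []      = refl
  ·-distribʳ a b (x ∷ v) = cong₂ _∷_ (distribʳ x a b) (·-distribʳ a b v)

  ·-assoc : ∀ {n} a b (v : Vec Carrier n) → (a * b) · v ≡ a · b · v
  ·-assoc a b []      = refl
  ·-assoc a b (x ∷ v) = cong₂ _∷_ (*-assoc a b x) (·-assoc a b v)

  1· : ∀ {n} (v : Vec Carrier n) → 1# · v ≡ v
  1· []      = refl
  1· (x ∷ v) = cong₂ _∷_ (*-identityˡ x) (1· v)

  0· : ∀ {n} (v : Vec Carrier n) → 0# · v ≡ 0ᵥ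
  0· []      = refl
  0· (x ∷ v) = cong₂ _∷_ (zeroˡ x) (0· v)

  ·0 : ∀ n a → a · 0ᵥ {n} ≡ 0ᵥ
  ·0 zero    a = refl
  ·0 (suc n) a = cong₂ _∷_ (zeroʳ a) (·0 n a)

  ⊕-inverse : ∀ {n} (v : Vec Carrier n) → (- 1#) · v ⊕ v ≡ 0ᵥ
  ⊕-inverse v = begin
    (- 1#) · v ⊕ v        ≡⟨ cong ((- 1#) · v ⊕_) (1· v) ⟨
    (- 1#) · v ⊕ 1# · v   ≡⟨ ·-distribʳ (- 1#) 1# v ⟨
    (- 1# + 1#) · v       ≡⟨ cong (_· v) (-‿inverseˡ 1#) ⟩
    0# · v                ≡⟨ 0· v ⟩
    0ᵥ                    ∎
    where open ≡-Reasoning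

  lincomb-⊕ : ∀ {n r} (cs ds : Vec Carrier r) (ws : Vec (Vec Carrier n) r) →
              lincomb (cs ⊕ ds) ws ≡ lincomb cs ws ⊕ lincomb ds ws
  lincomb-⊕ []       []       []       = sym (⊕-identityˡ 0ᵥ)
  lincomb-⊕ (c ∷ cs) (d ∷ ds) (w ∷ ws) =
    trans (cong₂ _⊕_ (·-distribʳ c d w) (lincomb-⊕ cs ds ws)) (⊕-medial _ _ _ _)

  lincomb-· : ∀ {n r} a (cs : Vec Carrier r) (ws : Vec (Vec Carrier n) r) →
              lincomb (a · cs) ws ≡ a · lincomb cs ws
  lincomb-· {n} a []       []       = sym (·0 n a)
  lincomb-· a (c ∷ cs) (w ∷ ws) =
    trans (cong₂ _⊕_ (·-assoc a c w) (lincomb-· a cs ws)) (sym (·-distribˡ a _ _))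

  lincomb-0 : ∀ {n r} (ws : Vec (Vec Carrier n) r) → lincomb 0ᵥ ws ≡ 0ᵥ
  lincomb-0 []       = refl
  lincomb-0 (w ∷ ws) = trans (cong₂ _⊕_ (0· w) (lincomb-0 ws)) (⊕-identityˡ 0ᵥ)

  span-⊕ : ∀ {n r} {ws : Vec (Vec Carrier n) r} {u v} →
           Span ws u → Span ws v → Span ws (u ⊕ v)
  span-⊕ {ws = ws} (cs , p) (ds , q) = cs ⊕ ds , trans (lincomb-⊕ cs ds ws) (cong₂ _⊕_ p q)

  span-· : ∀ {n r} {ws : Vec (Vec Carrier n) r} a {v} → Span ws v → Span ws (a · v)
  span-· {ws = ws} a (cs , p) = a · cs , trans (lincomb-· a cs ws) (cong (a ·_) p)

  span-∷ : ∀ {n r} {w : Vec Carrier n} {ws : Vec (Vec Carrier n) r} {v} →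
           Span ws v → Span (w ∷ ws) v
  span-∷ {w = w} (cs , p) = 0# ∷ cs , trans (cong₂ _⊕_ (0· w) p) (⊕-identityˡ _)

  span-head : ∀ {n r} {w : Vec Carrier n} {ws : Vec (Vec Carrier n) r} → Span (w ∷ ws) w
  span-head {w = w} {ws} = 1# ∷ 0ᵥ , (begin
    1# · w ⊕ lincomb 0ᵥ ws  ≡⟨ cong₂ _⊕_ (1· w) (lincomb-0 ws) ⟩
    w ⊕ 0ᵥ                  ≡⟨ ⊕-comm w 0ᵥ ⟩
    0ᵥ ⊕ w                  ≡⟨ ⊕-identityˡ w ⟩
    w                       ∎)
    where open ≡-Reasoning

  ⊕-cancel : ∀ {n} {u v : Vec Carrier n} → u ⊕ v ≡ 0ᵥ → u ≡ (- 1#) · v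
  ⊕-cancel {u = u} {v} p = begin
    u                        ≡⟨ ⊕-identityˡ u ⟨
    0ᵥ ⊕ u                   ≡⟨ cong (_⊕ u) (⊕-inverse v) ⟨
    ((- 1#) · v ⊕ v) ⊕ u     ≡⟨ ⊕-assoc _ v u ⟩
    (- 1#) · v ⊕ (v ⊕ u)     ≡⟨ cong ((- 1#) · v ⊕_) (trans (⊕-comm v u) p) ⟩
    (- 1#) · v ⊕ 0ᵥ          ≡⟨ ⊕-comm _ 0ᵥ ⟩
    0ᵥ ⊕ (- 1#) · v          ≡⟨ ⊕-identityˡ _ ⟩
    (- 1#) · v               ∎
    where open ≡-Reasoning

  extend-independent : ∀ {n r} {w : Vec Carrier n} {bs : Vec (Vec Carrier n) r} →
    LinearlyIndependent bs → ¬ Span bs w → LinearlyIndependent (w ∷ bs)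
  extend-independent {w = w} {bs} ind w∉ (c ∷ cs) p with c ≟ 0#
  ... | yes refl = cong (0# ∷_)
    (ind cs (trans (sym (trans (cong (_⊕ lincomb cs bs) (0· w)) (⊕-identityˡ _))) p))
  ... | no c≢0 = contradiction
    (subst (Span bs) c⁻¹cw≡w (span-· c⁻¹ (subst (Span bs) (sym (⊕-cancel p))
      (span-· {ws = bs} (- 1#) (cs , refl)))))
    w∉
    where
    c⁻¹ = proj₁ (inverse c c≢0)
    c⁻¹cw≡w : c⁻¹ · c · w ≡ w
    c⁻¹cw≡w = begin
      c⁻¹ · c · w    ≡⟨ ·-assoc c⁻¹ c w ⟨
      (c⁻¹ * c) · w  ≡⟨ cong (_· w) (trans (*-comm c⁻¹ c) (proj₂ (inverse c c≢0))) ⟩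
      1# · w         ≡⟨ 1· w ⟩
      w              ∎
      where open ≡-Reasoning

  span-hasDimension : ∀ {n t} (ws : Vec (Vec Carrier n) t) → ∃ (HasDimension (Span ws))
  span-hasDimension [] = 0 , [] , ((λ p → p) , (λ p → p)) , λ { [] _ → refl }
  span-hasDimension {n} (w ∷ ws) with span-hasDimension ws
  ... | r , bs , (ws⊆bs , bs⊆ws) , ind with span? bs w
  ...   | yes w∈bs = r , bs ,
            ( (λ { (c ∷ cs , refl) → span-⊕ {ws = bs} (span-· {ws = bs} c w∈bs) (ws⊆bs (cs , refl)) })
            , (λ p → span-∷ (bs⊆ws p)) ) , ind
  ...   | no  w∉bs = suc r , w ∷ bs ,
            ( (λ { (c ∷ cs , refl) → span-⊕ {ws = w ∷ bs} (span-· {ws = w ∷ bs} c (span-head {ws = bs}))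
                                            (span-∷ (ws⊆bs (cs , refl))) })
            , (λ { (c ∷ cs , refl) → span-⊕ {ws = w ∷ ws} (span-· {ws = w ∷ ws} c (span-head {ws = ws}))
                                            (span-∷ (bs⊆ws (cs , refl))) }) )
            , extend-independent ind w∉bs

  -- The length of a basis of the span, chosen by discarding from the right each
  -- vector that depends on the ones after it.
  spanDimension : ∀ {n t} → Vec (Vec Carrier n) t → ℕ
  spanDimension ws = proj₁ (span-hasDimension ws)

  ∙-distribˡ : ∀ {n} (u v w : Vec Carrier n) → u ∙ (v ⊕ w) ≡ u ∙ v + u ∙ w
  ∙-distribˡ []      []      []      = sym (+-identityˡ 0#)
  ∙-distribˡ (x ∷ u) (y ∷ v) (z ∷ w) =
    trans (cong₂ _+_ (distribˡ x y z) (∙-distribˡ u v w)) (begin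
    (x * y + x * z) + (u ∙ v + u ∙ w)  ≡⟨ +-assoc _ _ _ ⟩
    x * y + (x * z + (u ∙ v + u ∙ w))  ≡⟨ cong (λ s → x * y + s) (+-assoc _ _ _) ⟨
    x * y + ((x * z + u ∙ v) + u ∙ w)  ≡⟨ cong (λ s → x * y + (s + u ∙ w)) (+-comm _ _) ⟩
    x * y + ((u ∙ v + x * z) + u ∙ w)  ≡⟨ cong (λ s → x * y + s) (+-assoc _ _ _) ⟩
    x * y + (u ∙ v + (x * z + u ∙ w))  ≡⟨ +-assoc _ _ _ ⟨
    (x * y + u ∙ v) + (x * z + u ∙ w)  ∎)
    where open ≡-Reasoning

  ∙-·ʳ : ∀ {n} (u : Vec Carrier n) a v → u ∙ (a · v) ≡ a * (u ∙ v)
  ∙-·ʳ []      a []      = sym (zeroʳ a)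
  ∙-·ʳ (x ∷ u) a (y ∷ v) = trans (cong₂ _+_ swap (∙-·ʳ u a v)) (sym (distribˡ a _ _))
    where
    swap : x * (a * y) ≡ a * (x * y)
    swap = trans (sym (*-assoc x a y)) (trans (cong (_* y) (*-comm x a)) (*-assoc a x y))

  ∙-zeroʳ : ∀ {n} (u : Vec Carrier n) → u ∙ 0ᵥ ≡ 0#
  ∙-zeroʳ []      = refl
  ∙-zeroʳ (x ∷ u) = trans (cong₂ _+_ (zeroʳ x) (∙-zeroʳ u)) (+-identityˡ 0#)

  dual : ∀ {n} → Subspace n → Subspace n
  dual C = record
    { Member   = λ v → ∀ u → Member u → u ∙ v ≡ 0#
    ; member?  = λ v → forall? ∈-vectors (λ u → member? u →-dec (u ∙ v ≟ 0#))
    ; 0-closed = λ u _ → ∙-zeroʳ u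
    ; ⊕-closed = λ {v} {w} p q u u∈ →
        trans (∙-distribˡ u v w) (trans (cong₂ _+_ (p u u∈) (q u u∈)) (+-identityˡ 0#))
    ; ·-closed = λ a {v} p u u∈ → trans (∙-·ʳ u a v) (trans (cong (a *_) (p u u∈)) (zeroʳ a))
    }
    where open Subspace C

∑ ∏ : List ℚ → ℚ
∑ = foldr ℚ._+_ 0ℚ
∏ = foldr ℚ._*_ 1ℚ

average : List ℚ → ℚ
average []       = 0ℚ
average (x ∷ xs) = ∑ (x ∷ xs) ℚ.* ((+ 1) ℚ./ length (x ∷ xs))

minimumOr : ℕ → List ℕ → ℕ
minimumOr a []       = a
minimumOr a (x ∷ xs) = min x xs

fromℕ : ℕ → ℚ
fromℕ a = (+ a) ℚ./ 1

fTerm : ∀ {q} {{_ : PrimePower q}} → FiniteField q → (n m k j r ν : ℕ) → ℚ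
fTerm {q} K n m k j r ν =
        q ^ᶻ (+ m ℤ.* (+ k ℤ.- + ν))
    ℚ.* fromℕ (gaussianBinomial (n ℕ.∸ j) (ν ℕ.∸ j))
    ℚ.* fromℕ (gaussianBinomial r ν)
    ℚ.* ∏ (map (λ ℓ → q ^ᶻ (+ ν) ℚ.- q ^ᶻ (+ ℓ)) (upTo ν))
  where open LinearAlgebra K using (gaussianBinomial)

-- Meant for j ≤ n; the sum over ν runs from j to r.
f : ∀ {q} {{_ : PrimePower q}} → FiniteField q → (n m k j r : ℕ) → ℚ
f K n m k j r = ∑ (map (fTerm K n m k j r) (map (j ℕ.+_) (upTo (suc r ℕ.∸ j))))

q^mk-1≢0 : ∀ q m k {{_ : PrimePower q}} {{_ : NonZero m}} {{_ : NonZero k}} →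
           ℚ.NonZero (q ^ᶻ (+ (m ℕ.* k)) ℚ.- 1ℚ)
q^mk-1≢0 q m k {{P}} = ℚ.≢-nonZero {p = fromℕ (q ℕ.^ (m ℕ.* k)) ℚ.- 1ℚ} λ eq → ℕ.<⇒≢ 1<q^mk (sym (numerator≡ (begin
    fromℕ (q ℕ.^ (m ℕ.* k))                       ≡⟨ ℚ.+-identityʳ _ ⟨
    fromℕ (q ℕ.^ (m ℕ.* k)) ℚ.+ 0ℚ                ≡⟨⟩
    fromℕ (q ℕ.^ (m ℕ.* k)) ℚ.+ (ℚ.- 1ℚ ℚ.+ 1ℚ)   ≡⟨ ℚ.+-assoc (fromℕ (q ℕ.^ (m ℕ.* k))) (ℚ.- 1ℚ) 1ℚ ⟨
    fromℕ (q ℕ.^ (m ℕ.* k)) ℚ.- 1ℚ ℚ.+ 1ℚ         ≡⟨ cong (ℚ._+ 1ℚ) eq ⟩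
    1ℚ                                            ∎)))
  where
  open ≡-Reasoning
  instance
    _ = ℕ.m*n≢0 m k
    _ = primePower⇒nonZero P
  1<q^mk : 1 ℕ.< q ℕ.^ (m ℕ.* k)
  1<q^mk = ℕ.<-≤-trans (1<primePower P)
    (ℕ.≤-trans (ℕ.≤-reflexive (sym (ℕ.^-identityʳ q)))
               (ℕ.^-monoʳ-≤ q (ℕ.>-nonZero⁻¹ (m ℕ.* k))))
  numerator≡ : ∀ {a} → fromℕ a ≡ 1ℚ → a ≡ 1
  numerator≡ {a} eq with ℚ./-injective-≃ (ℚᵘ.mkℚᵘ (+ a) 0) (ℚᵘ.mkℚᵘ (+ 1) 0) eq
  ... | ℚᵘ.*≡* e = ℤ.+-injective (trans (sym (ℤ.*-identityʳ (+ a))) e)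

record OrderedBasis {q r} {K : FiniteField q} {L : FiniteField r} (E : FieldExtension K L) (m : ℕ) : Set where
  private
    module K = FiniteField K
    module L = FiniteField L
  open LinearAlgebra K using () renaming (0ᵥ to 0ᴷ)
  open LinearAlgebra L using (_∙_)
  open FieldExtension E
  field
    γ           : Vec L.Carrier m
    spanning    : ∀ x → ∃ λ cs → Vec.map ι cs ∙ γ ≡ x
    independent : ∀ cs → Vec.map ι cs ∙ γ ≡ L.0# → cs ≡ 0ᴷ

  coordinates : L.Carrier → Vec K.Carrier m
  coordinates x = proj₁ (spanning x)

module RankMetric
  {q m : ℕ} {{_ : PrimePower q}} {K : FiniteField q} {L : FiniteField (q ℕ.^ m)} {E : FieldExtension K L}
  (Γ : OrderedBasis E m)
  where

  private
    module K  = FiniteField K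
    module L  = FiniteField L
    module K# = LinearAlgebra K
    module L# = LinearAlgebra L
  open OrderedBasis Γ

  Γ-matrix : ∀ {n} → Vec L.Carrier n → Vec (Vec K.Carrier m) n
  Γ-matrix = Vec.map coordinates

  columns : ∀ {n} → Vec L.Carrier n → Vec (Vec K.Carrier n) m
  columns v = Vec.transpose (Γ-matrix v)

  rankSupport : ∀ {n} → Vec L.Carrier n → Pred (Vec K.Carrier n) 0ℓ
  rankSupport v = K#.Span (columns v)

  rk : ∀ {n} → Vec L.Carrier n → ℕ
  rk v = K#.spanDimension (columns v)

  module _ {n : ℕ} (C : L#.Subspace n) where

    open L#.Subspace C

    nonzeroCodewords : List (Vec L.Carrier n)
    nonzeroCodewords = filter (λ v → member? v ×-dec ¬? (v L#.≟ᵥ L#.0ᵥ)) (L#.vectors n)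

    -- The zero code in Lⁿ has minimum distance n + 1 by convention.
    minimumDistance : ℕ
    minimumDistance = minimumOr (suc n) (map rk nonzeroCodewords)

    IsCode : ℕ → ℕ → Set
    IsCode k d = L#.HasDimension Member k × minimumDistance ≡ d

    -- The sum of the subspaces rankSupport v over v in C: all finite sums of
    -- their elements.
    data SumOfSupports : Pred (Vec K.Carrier n) 0ℓ where
      zero : SumOfSupports K#.0ᵥ
      add  : ∀ {v x y} → Member v → rankSupport v x → SumOfSupports y → SumOfSupports (x K#.⊕ y)

    RankNondegenerate : Set
    RankNondegenerate = ∀ x → SumOfSupports x

    -- 𝔼 C g and Var C g are the mean and variance of g(rk v) for v uniform among
    -- the nonzero codewords.
    𝔼 : (ℕ → ℚ) → ℚ
    𝔼 g = average (map (g ∘ rk) nonzeroCodewords)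

    Var : (ℕ → ℚ) → ℚ
    Var g = 𝔼 (λ r → (g r ℚ.- 𝔼 g) ℚ.* (g r ℚ.- 𝔼 g))

  Rank2Nondegenerate : ∀ {n} → L#.Subspace n → Set
  Rank2Nondegenerate C = 3 ≤ minimumDistance (L#.dual C)

{-# OPTIONS --safe #-}
-- Writing N(v) for the number of x ∈ Kⁿ with x · v = 0, one has N(v) = q^(n − rk v), as
-- x · v = 0 says that x is orthogonal to the rank support of v. Hence the first two moments
-- of q^(n − rk v) over the code count pairs (x , v), respectively triples (x , y , v), and
-- can be computed by fixing x, y and counting the codewords orthogonal to them.
-- Nondegeneracy says that v ↦ x · v is a nonzero functional on C for every x ≠ 0, which
-- gives the mean. For K-independent x, y the functionals of x and y may still be
-- L-dependent on C; such a bad pair raises the count from q^(m(k−2)) to q^(m(k−1)), so the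
-- variance exceeds the bound by a positive multiple of the number of bad pairs. A bad pair
-- is the same as a nonzero combination a x + b y ∈ C^⊥, i.e. a nonzero dual word of rank ≤ 2.
module Submission where

open import Level using (0ℓ)
open import Defs
open import Algebra.Bundles using (CommutativeRing)
open import Algebra.Morphism.Structures using (module RingMorphisms)
import Algebra.Properties.Ring as RingProperties
import Algebra.Solver.Ring.NaturalCoefficients.Default as SemiringSolver
open import Data.Bool.Base using (if_then_else_)
open import Data.List.Base as List
  using (List; []; _∷_; _++_; length; map; filter; deduplicate; cartesianProductWith; allFin)
open import Data.List.Extrema.Nat using (min≤⊤; min≤xs; v≤min⁺)
open import Data.List.Membership.Propositional using (_∈_)
open import Data.List.Membership.Propositional.Properties
  using (∈-filter⁺; ∈-filter⁻; ∈-map⁺; ∈-map⁻; ∈-deduplicate⁻)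
open import Data.List.Membership.Propositional.Properties.WithK using (unique∧set⇒bag)
import Data.List.Properties as List
open import Data.List.Relation.Binary.BagAndSetEquality using (∼bag⇒↭)
open import Data.List.Relation.Binary.Permutation.Propositional.Properties using (↭-length)
import Data.List.Relation.Unary.All as All
open import Data.List.Relation.Unary.AllPairs using ([]; _∷_)
open import Data.List.Relation.Unary.Any using (here; there)
open import Data.List.Relation.Unary.Unique.Propositional using (Unique)
import Data.List.Relation.Unary.Unique.Propositional.Properties as Unique
open import Data.Nat.Base as ℕ using (ℕ; zero; suc; NonZero; _^_; z≤n; s≤s)
open import Data.Nat.ListAction using (sum)
open import Data.Nat.ListAction.Properties using (sum-++)
import Data.Nat.Properties as ℕ
open import Data.Nat.Tactic.RingSolver using (solve-∀)
open import Data.Product.Base using (∃; _×_; _,_; proj₁; proj₂)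
open import Data.Sum.Base using (_⊎_; inj₁; inj₂)
open import Data.Unit.Base using (⊤; tt)
open import Data.Vec.Base as Vec using (Vec; []; _∷_)
import Data.Vec.Properties as Vec
open import Function.Base using (_∘_; id)
open import Function.Bundles using (_⇔_; mk⇔; module Inverse; module Equivalence)
open import Function.Construct.Composition using (_⇔-∘_)
import Relation.Binary.Definitions as B
open import Relation.Binary.PropositionalEquality
  using (_≡_; _≢_; refl; sym; trans; cong; cong₂; subst; module ≡-Reasoning)
open import Relation.Nullary.Decidable
  using (Dec; yes; no; does; ¬?; _×-dec_; _→-dec_; dec-true; dec-false; decidable-stable; dec⇒maybe)
open import Relation.Nullary.Negation using (¬_; contradiction)
open import Relation.Unary using (Pred; Decidable; _≐_; _⊆_)

-- The bound is a count of pairs by the dimension of their span. In the term of index ν of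
-- f_q(n,m,k,0,2) the first binomial chooses a ν-dimensional subspace of Kⁿ, the second one times
-- the product is the number of ordered pairs (x , y) spanning it, and q^(m(k-ν)) is the number of
-- codewords orthogonal to such a pair if its functionals on C are as independent as x and y are.
-- Nondegeneracy secures this for ν ≤ 1, so equality can fail only through pairs with span of
-- dimension 2, and each failure has the same size. The obstacle is divisibility: for k = 1 and ν =
-- 2 the power is not a natural number, and in fact every independent pair is then bad. The counts
-- in ℕ are therefore identities multiplied by q^m or q^(2m), and the factor is cancelled only in ℚ.
-- The Gaussian binomials pose another obstacle, being defined by listing tuples up to equality of
-- spans; their values are recovered from numbers of independent tuples, again in product form.

module FiniteSums where

  open import Data.Nat.Base using (_+_; _*_; _≤_)
  open import Data.Nat.Properties
    using (*-zeroʳ; *-comm; *-distribˡ-+; +-assoc; *-identityˡ; *-identityʳ; m+n≡0⇒m≡0; m+n≡0⇒n≡0; m≤n⇒m≤1+n)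

  -- Sums, indicators and cardinalities of finite lists

  sumOver : {A : Set} → List A → (A → ℕ) → ℕ
  sumOver xs f = sum (map f xs)

  syntax sumOver xs (λ x → e) = ∑[ x ∈ xs ] e

  𝟙 : {P : Set} → Dec P → ℕ
  𝟙 P? = if does P? then 1 else 0

  𝟙-true : {P : Set} (P? : Dec P) → P → 𝟙 P? ≡ 1
  𝟙-true P? p = cong (if_then 1 else 0) (dec-true P? p)

  𝟙-false : {P : Set} (P? : Dec P) → ¬ P → 𝟙 P? ≡ 0
  𝟙-false P? ¬p = cong (if_then 1 else 0) (dec-false P? ¬p)

  𝟙-cong : {P Q : Set} (P? : Dec P) (Q? : Dec Q) → (P → Q) → (Q → P) → 𝟙 P? ≡ 𝟙 Q?
  𝟙-cong (yes p) Q? f g = sym (𝟙-true Q? (f p))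
  𝟙-cong (no ¬p) Q? f g = sym (𝟙-false Q? (¬p ∘ g))

  𝟙≡0⇒¬ : {P : Set} (P? : Dec P) → 𝟙 P? ≡ 0 → ¬ P
  𝟙≡0⇒¬ P? eq p = contradiction (trans (sym (𝟙-true P? p)) eq) λ ()

  count : {A : Set} {P : Pred A 0ℓ} → Decidable P → List A → ℕ
  count P? xs = length (filter P? xs)

  module _ {A : Set} where

    sumOver-cong-∈ : ∀ (xs : List A) {f g : A → ℕ} → (∀ {x} → x ∈ xs → f x ≡ g x) → sumOver xs f ≡ sumOver xs g
    sumOver-cong-∈ []       eq = refl
    sumOver-cong-∈ (x ∷ xs) eq = cong₂ _+_ (eq (here refl)) (sumOver-cong-∈ xs (eq ∘ there))

    sumOver-cong : ∀ (xs : List A) {f g : A → ℕ} → (∀ x → f x ≡ g x) → sumOver xs f ≡ sumOver xs g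
    sumOver-cong xs eq = sumOver-cong-∈ xs λ {x} _ → eq x

    sumOver-+ : ∀ (xs : List A) (f g : A → ℕ) → sumOver xs (λ x → f x + g x) ≡ sumOver xs f + sumOver xs g
    sumOver-+ []       f g = refl
    sumOver-+ (x ∷ xs) f g = trans (cong (f x + g x +_) (sumOver-+ xs f g)) (exchange (f x) (g x) _ _)
      where
      exchange : ∀ a b c d → a + b + (c + d) ≡ a + c + (b + d)
      exchange = solve-∀

    sumOver-*ˡ : ∀ (xs : List A) a (f : A → ℕ) → sumOver xs (λ x → a * f x) ≡ a * sumOver xs f
    sumOver-*ˡ []       a f = sym (*-zeroʳ a)
    sumOver-*ˡ (x ∷ xs) a f = trans (cong (a * f x +_) (sumOver-*ˡ xs a f)) (sym (*-distribˡ-+ a _ _))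

    sumOver-*ʳ : ∀ (xs : List A) (f : A → ℕ) a → sumOver xs (λ x → f x * a) ≡ sumOver xs f * a
    sumOver-*ʳ xs f a = trans (sumOver-cong xs λ x → *-comm (f x) a)
                              (trans (sumOver-*ˡ xs a f) (*-comm a _))

    sumOver-const : ∀ (xs : List A) a → sumOver xs (λ _ → a) ≡ length xs * a
    sumOver-const []       a = refl
    sumOver-const (x ∷ xs) a = cong (a +_) (sumOver-const xs a)

    sumOver≡0 : ∀ {xs : List A} {f : A → ℕ} {x} → x ∈ xs → sumOver xs f ≡ 0 → f x ≡ 0
    sumOver≡0 {_ ∷ _} {f} (here refl) eq = m+n≡0⇒m≡0 _ eq
    sumOver≡0 {y ∷ _} {f} (there x∈)  eq = sumOver≡0 x∈ (m+n≡0⇒n≡0 (f y) eq)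

    count≡sum : ∀ {P : Pred A 0ℓ} (P? : Decidable P) xs → count P? xs ≡ ∑[ x ∈ xs ] 𝟙 (P? x)
    count≡sum P? []       = refl
    count≡sum P? (x ∷ xs) with P? x
    ... | yes _ = cong suc (count≡sum P? xs)
    ... | no  _ = count≡sum P? xs

    sumOver-filter : ∀ {P : Pred A 0ℓ} (P? : Decidable P) xs (f : A → ℕ) →
                     sumOver (filter P? xs) f ≡ ∑[ x ∈ xs ] (𝟙 (P? x) * f x)
    sumOver-filter P? []       f = refl
    sumOver-filter P? (x ∷ xs) f with P? x
    ... | yes _ = cong₂ _+_ (sym (*-identityˡ _)) (sumOver-filter P? xs f)
    ... | no  _ = sumOver-filter P? xs f

    sumOver-split : ∀ {P : Pred A 0ℓ} (P? : Decidable P) xs (f : A → ℕ) →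
                    sumOver xs f ≡ sumOver (filter P? xs) f + sumOver (filter (¬? ∘ P?) xs) f
    sumOver-split P? []       f = refl
    sumOver-split P? (x ∷ xs) f with P? x
    ... | yes _ = trans (cong (f x +_) (sumOver-split P? xs f)) (sym (+-assoc (f x) _ _))
    ... | no  _ = trans (cong (f x +_) (sumOver-split P? xs f)) (shift (f x) (sumOver (filter P? xs) f) _)
      where
      shift : ∀ a b c → a + (b + c) ≡ b + (a + c)
      shift = solve-∀

    sumOver-split-const : ∀ {P : Pred A 0ℓ} (P? : Decidable P) xs (f : A → ℕ) {a b} →
      (∀ x → P x → f x ≡ a) → (∀ x → ¬ P x → f x ≡ b) →
      sumOver xs f ≡ count P? xs * a + count (¬? ∘ P?) xs * b
    sumOver-split-const P? xs f {a} {b} eqᵃ eqᵇ = trans (sumOver-split P? xs f) (cong₂ _+_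
      (trans (sumOver-cong-∈ (filter P? xs) λ x∈ → eqᵃ _ (proj₂ (∈-filter⁻ P? {xs = xs} x∈)))
             (sumOver-const (filter P? xs) a))
      (trans (sumOver-cong-∈ (filter (¬? ∘ P?) xs) λ x∈ → eqᵇ _ (proj₂ (∈-filter⁻ (¬? ∘ P?) {xs = xs} x∈)))
             (sumOver-const (filter (¬? ∘ P?) xs) b)))

    count-complement : ∀ {P : Pred A 0ℓ} (P? : Decidable P) xs → length xs ≡ count P? xs + count (¬? ∘ P?) xs
    count-complement P? xs = begin
      length xs                                   ≡⟨ *-identityʳ _ ⟨
      length xs * 1                               ≡⟨ sumOver-const xs 1 ⟨
      ∑[ x ∈ xs ] 1                               ≡⟨ sumOver-split-const P? xs (λ _ → 1) (λ _ _ → refl) (λ _ _ → refl) ⟩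
      count P? xs * 1 + count (¬? ∘ P?) xs * 1    ≡⟨ cong₂ _+_ (*-identityʳ (count P? xs)) (*-identityʳ (count (¬? ∘ P?) xs)) ⟩
      count P? xs + count (¬? ∘ P?) xs            ∎
      where open ≡-Reasoning

    count-cong : ∀ {P Q : Pred A 0ℓ} (P? : Decidable P) (Q? : Decidable Q) xs →
                 (∀ x → P x → Q x) → (∀ x → Q x → P x) → count P? xs ≡ count Q? xs
    count-cong P? Q? xs f g = trans (count≡sum P? xs)
      (trans (sumOver-cong xs λ x → 𝟙-cong (P? x) (Q? x) (f x) (g x)) (sym (count≡sum Q? xs)))

    count-mono : ∀ {P Q : Pred A 0ℓ} (P? : Decidable P) (Q? : Decidable Q) xs →
                 (∀ x → P x → Q x) → count P? xs ≤ count Q? xs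
    count-mono P? Q? []       f = z≤n
    count-mono P? Q? (x ∷ xs) f with P? x | Q? x
    ... | yes _ | yes _ = s≤s (count-mono P? Q? xs f)
    ... | yes p | no ¬q = contradiction (f x p) ¬q
    ... | no _  | yes _ = m≤n⇒m≤1+n (count-mono P? Q? xs f)
    ... | no _  | no _  = count-mono P? Q? xs f

    count-filter : ∀ {P Q : Pred A 0ℓ} (P? : Decidable P) (Q? : Decidable Q) xs →
                   (∀ x → P x → Q x) → count P? (filter Q? xs) ≡ count P? xs
    count-filter P? Q? xs f = begin
      count P? (filter Q? xs)                ≡⟨ count≡sum P? (filter Q? xs) ⟩
      sumOver (filter Q? xs) (𝟙 ∘ P?)        ≡⟨ sumOver-filter Q? xs (𝟙 ∘ P?) ⟩
      ∑[ x ∈ xs ] (𝟙 (Q? x) * 𝟙 (P? x))      ≡⟨ sumOver-cong xs absorb ⟩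
      ∑[ x ∈ xs ] 𝟙 (P? x)                   ≡⟨ count≡sum P? xs ⟨
      count P? xs                            ∎
      where
      open ≡-Reasoning
      absorb : ∀ x → 𝟙 (Q? x) * 𝟙 (P? x) ≡ 𝟙 (P? x)
      absorb x with P? x
      ... | yes p = trans (*-identityʳ _) (𝟙-true (Q? x) (f x p))
      ... | no _  = *-zeroʳ (𝟙 (Q? x))

  module _ {A B : Set} where

    sumOver-swap : ∀ (xs : List A) (ys : List B) (f : A → B → ℕ) →
                   ∑[ x ∈ xs ] sumOver ys (f x) ≡ ∑[ y ∈ ys ] ∑[ x ∈ xs ] f x y
    sumOver-swap []       ys f = sym (trans (sumOver-const ys 0) (*-zeroʳ (length ys)))
    sumOver-swap (x ∷ xs) ys f = trans (cong (sumOver ys (f x) +_) (sumOver-swap xs ys f))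
                                       (sym (sumOver-+ ys (f x) _))

    -- Duplicate-free lists with the same members are equal as bags, hence permutations of each
    -- other. The bijective counts below all rest on this.
    length-bijection : ∀ {xs : List A} {ys : List B} (φ : A → B) → Unique xs → Unique ys →
      (∀ {x y} → φ x ≡ φ y → x ≡ y) →
      (∀ {x} → x ∈ xs → φ x ∈ ys) →
      (∀ {y} → y ∈ ys → ∃ λ x → x ∈ xs × φ x ≡ y) →
      length xs ≡ length ys
    length-bijection {xs} {ys} φ xs! ys! injective into onto = trans (sym (List.length-map φ xs))
      (↭-length (∼bag⇒↭ (unique∧set⇒bag (Unique.map⁺ injective xs!) ys! (mk⇔ to from))))
      where
      to : ∀ {y} → y ∈ map φ xs → y ∈ ys
      to y∈ with _ , x∈ , refl ← ∈-map⁻ φ y∈ = into x∈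
      from : ∀ {y} → y ∈ ys → y ∈ map φ xs
      from y∈ with _ , x∈ , refl ← onto y∈ = ∈-map⁺ φ x∈

    count-bijection : ∀ {P : Pred A 0ℓ} {Q : Pred B 0ℓ} (P? : Decidable P) (Q? : Decidable Q) {xs ys} (φ : A → B) →
      Unique xs → Unique ys → (∀ x → x ∈ xs) → (∀ y → y ∈ ys) →
      (∀ {x y} → φ x ≡ φ y → x ≡ y) →
      (∀ x → P x → Q (φ x)) →
      (∀ y → Q y → ∃ λ x → P x × φ x ≡ y) →
      count P? xs ≡ count Q? ys
    count-bijection P? Q? {xs} {ys} φ xs! ys! ∈xs ∈ys injective into onto =
      length-bijection φ (Unique.filter⁺ P? xs!) (Unique.filter⁺ Q? ys!) injective
        (λ x∈ → ∈-filter⁺ Q? (∈ys _) (into _ (proj₂ (∈-filter⁻ P? {xs = xs} x∈))))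
        (λ y∈ → let x , px , eq = onto _ (proj₂ (∈-filter⁻ Q? {xs = ys} y∈)) in x , ∈-filter⁺ P? (∈xs x) px , eq)

  count-≡ : ∀ {A : Set} (_≟_ : B.DecidableEquality A) {xs x} → Unique xs → x ∈ xs → count (_≟ x) xs ≡ 1
  count-≡ _≟_ {xs} {x} xs! x∈ = length-bijection {ys = x ∷ []} (λ y → y) (Unique.filter⁺ (_≟ x) xs!)
    (All.[] ∷ []) (λ eq → eq)
    (λ y∈ → here (proj₂ (∈-filter⁻ (_≟ x) {xs = xs} y∈)))
    (λ { (here refl) → _ , ∈-filter⁺ (_≟ x) x∈ refl , refl })

  sumOver-cartesianProductWith : ∀ {A B C : Set} (g : A → B → C) (xs : List A) (ys : List B) (f : C → ℕ) →
    sumOver (cartesianProductWith g xs ys) f ≡ ∑[ x ∈ xs ] ∑[ y ∈ ys ] f (g x y)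
  sumOver-cartesianProductWith g []       ys f = refl
  sumOver-cartesianProductWith g (x ∷ xs) ys f =
    trans (sumOver-++ (map (g x) ys) _) (cong₂ _+_ (sumOver-map ys) (sumOver-cartesianProductWith g xs ys f))
    where
    sumOver-++ : ∀ zs ws → sumOver (zs ++ ws) f ≡ sumOver zs f + sumOver ws f
    sumOver-++ zs ws = trans (cong sum (List.map-++ f zs ws)) (sum-++ (map f zs) _)
    sumOver-map : ∀ zs → sumOver (map (g x) zs) f ≡ ∑[ y ∈ zs ] f (g x y)
    sumOver-map []       = refl
    sumOver-map (z ∷ zs) = cong (f (g x z) +_) (sumOver-map zs)

  module _ {A : Set} {R : A → A → Set} (R? : B.Decidable R)
           (R-refl : ∀ {x} → R x x) (R-sym : ∀ {x y} → R x y → R y x) (R-trans : ∀ {x y z} → R x y → R y z → R x z) where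

    -- `deduplicate` keeps the head `x` and strikes out of the deduplicated tail all that is related
    -- to `x`. If `R x y`, transitivity leaves nothing related to `y` behind `x`; if not, `y` lies
    -- in the tail and nothing related to `y` is struck out.
    representative-unique : ∀ xs {y} → y ∈ xs → count (λ r → R? r y) (deduplicate R? xs) ≡ 1
    representative-unique (x ∷ xs) {y} y∈ with R? x y | y∈
    ... | no ¬Rxy | here refl = contradiction R-refl ¬Rxy
    ... | no ¬Rxy | there y∈′ = trans
      (count-filter (λ r → R? r y) (¬? ∘ R? x) (deduplicate R? xs) (λ r Rry Rxr → ¬Rxy (R-trans Rxr Rry)))
      (representative-unique xs y∈′)
    ... | yes Rxy | _ = cong suc (begin
      count (λ r → R? r y) (filter (¬? ∘ R? x) (deduplicate R? xs))
        ≡⟨ count≡sum (λ r → R? r y) (filter (¬? ∘ R? x) (deduplicate R? xs)) ⟩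
      sumOver (filter (¬? ∘ R? x) (deduplicate R? xs)) (λ r → 𝟙 (R? r y))
        ≡⟨ sumOver-filter (¬? ∘ R? x) (deduplicate R? xs) _ ⟩
      ∑[ r ∈ deduplicate R? xs ] (𝟙 (¬? (R? x r)) * 𝟙 (R? r y))
        ≡⟨ sumOver-cong (deduplicate R? xs) vanish ⟩
      ∑[ r ∈ deduplicate R? xs ] 0
        ≡⟨ sumOver-const (deduplicate R? xs) 0 ⟩
      length (deduplicate R? xs) * 0
        ≡⟨ *-zeroʳ (length (deduplicate R? xs)) ⟩
      0 ∎)
      where
      open ≡-Reasoning
      vanish : ∀ r → 𝟙 (¬? (R? x r)) * 𝟙 (R? r y) ≡ 0
      vanish r with R? r y
      ... | no _    = *-zeroʳ (𝟙 (¬? (R? x r)))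
      ... | yes Rry = cong (_* 1) (𝟙-false (¬? (R? x r)) λ ¬Rxr → ¬Rxr (R-trans Rxy (R-sym Rry)))

    -- Double counting of the pairs (`r` , `x`) with `R r x`, where `r` is a representative and `x`
    -- runs over `xs`: each `r` occurs in `c` pairs, each `x` in one.
    length-classes : ∀ xs {c} → (∀ {r} → r ∈ xs → count (R? r) xs ≡ c) → length (deduplicate R? xs) * c ≡ length xs
    length-classes xs {c} size = begin
      length (deduplicate R? xs) * c
        ≡⟨ sumOver-const (deduplicate R? xs) c ⟨
      ∑[ r ∈ deduplicate R? xs ] c
        ≡⟨ sumOver-cong-∈ (deduplicate R? xs) (λ r∈ → size (∈-deduplicate⁻ R? xs r∈)) ⟨
      ∑[ r ∈ deduplicate R? xs ] count (R? r) xs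
        ≡⟨ sumOver-cong (deduplicate R? xs) (λ r → count≡sum (R? r) xs) ⟩
      ∑[ r ∈ deduplicate R? xs ] ∑[ x ∈ xs ] 𝟙 (R? r x)
        ≡⟨ sumOver-swap (deduplicate R? xs) xs (λ r x → 𝟙 (R? r x)) ⟩
      ∑[ x ∈ xs ] ∑[ r ∈ deduplicate R? xs ] 𝟙 (R? r x)
        ≡⟨ sumOver-cong xs (λ x → count≡sum (λ r → R? r x) (deduplicate R? xs)) ⟨
      ∑[ x ∈ xs ] count (λ r → R? r x) (deduplicate R? xs)
        ≡⟨ sumOver-cong-∈ xs (representative-unique xs) ⟩
      ∑[ x ∈ xs ] 1
        ≡⟨ sumOver-const xs 1 ⟩
      length xs * 1
        ≡⟨ *-identityʳ _ ⟩
      length xs ∎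
      where
      open ≡-Reasoning

  𝟙-× : {P Q : Set} (P? : Dec P) (Q? : Dec Q) → 𝟙 (P? ×-dec Q?) ≡ 𝟙 P? ℕ.* 𝟙 Q?
  𝟙-× (yes _) (yes _) = refl
  𝟙-× (yes _) (no _)  = refl
  𝟙-× (no _)  _       = refl

open FiniteSums

-- Enumeration of tuples

length-cartesianProductWith : ∀ {A B C : Set} (f : A → B → C) xs ys →
  length (cartesianProductWith f xs ys) ≡ length xs ℕ.* length ys
length-cartesianProductWith f List.[]       ys = refl
length-cartesianProductWith f (x List.∷ xs) ys =
  trans (List.length-++ (List.map (f x) ys))
        (cong₂ ℕ._+_ (List.length-map (f x) ys) (length-cartesianProductWith f xs ys))

length-tuples : ∀ {A : Set} (xs : List A) n → length (tuples xs n) ≡ length xs ^ n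
length-tuples xs zero    = refl
length-tuples xs (suc n) = trans (length-cartesianProductWith _∷_ xs (tuples xs n)) (cong (length xs ℕ.*_) (length-tuples xs n))

tuples-unique : ∀ {A : Set} {xs : List A} → Unique xs → ∀ n → Unique (tuples xs n)
tuples-unique xs! zero    = All.[] ∷ []
tuples-unique xs! (suc n) = Unique.cartesianProductWith⁺ _∷_ Vec.∷-injective xs! (tuples-unique xs! n)

transpose-∷ : ∀ {A : Set} {m n} (row : Vec A m) (M : Vec (Vec A m) n) →
              Vec.transpose (row ∷ M) ≡ Vec.zipWith _∷_ row (Vec.transpose M)
transpose-∷ row M = sym (Vec.zipWith-is-⊛ _∷_ row (Vec.transpose M))

-- Linear algebra over a finite field, by counting

module FiniteLinearAlgebra {order} (F : FiniteField order) where

  open FiniteField F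
  open LinearAlgebra F
  open SemiringSolver (CommutativeRing.commutativeSemiring commutativeRing) using (solve; _:=_; _:+_; _:*_)

  elements-unique : Unique elements
  elements-unique = Unique.map⁺ injective (Unique.allFin⁺ order)
    where
    injective : ∀ {x y} → Inverse.to enumeration x ≡ Inverse.to enumeration y → x ≡ y
    injective {x} {y} eq = trans (sym (Inverse.strictlyInverseʳ enumeration x))
      (trans (cong (Inverse.from enumeration) eq) (Inverse.strictlyInverseʳ enumeration y))

  vectors-unique : ∀ n → Unique (vectors n)
  vectors-unique = tuples-unique elements-unique

  length-elements : length elements ≡ order
  length-elements = trans (List.length-map (Inverse.to enumeration) (allFin order)) (List.length-tabulate {n = order} id)

  length-vectors : ∀ n → length (vectors n) ≡ order ^ n
  length-vectors n = trans (length-tuples elements n) (cong (_^ n) length-elements)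

  count-≡0 : ∀ n → count (_≟ᵥ 0ᵥ) (vectors n) ≡ 1
  count-≡0 n = count-≡ _≟ᵥ_ (vectors-unique n) (∈-vectors 0ᵥ)

  *-zero-cancel : ∀ {a b} → a ≢ 0# → a * b ≡ 0# → b ≡ 0#
  *-zero-cancel {a} {b} a≢0 ab≡0 with a⁻¹ , aa⁻¹≡1 ← inverse a a≢0 = begin
    b              ≡⟨ *-identityˡ b ⟨
    1# * b         ≡⟨ cong (_* b) (trans (sym aa⁻¹≡1) (*-comm a a⁻¹)) ⟩
    a⁻¹ * a * b    ≡⟨ *-assoc a⁻¹ a b ⟩
    a⁻¹ * (a * b)  ≡⟨ cong (a⁻¹ *_) ab≡0 ⟩
    a⁻¹ * 0#       ≡⟨ zeroʳ a⁻¹ ⟩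
    0#             ∎
    where open ≡-Reasoning

  ∙-comm : ∀ {n} (u v : Vec Carrier n) → u ∙ v ≡ v ∙ u
  ∙-comm []      []      = refl
  ∙-comm (x ∷ u) (y ∷ v) = cong₂ _+_ (*-comm x y) (∙-comm u v)

  ∙-distribʳ : ∀ {n} (u v w : Vec Carrier n) → (u ⊕ v) ∙ w ≡ u ∙ w + v ∙ w
  ∙-distribʳ u v w = trans (∙-comm (u ⊕ v) w) (trans (∙-distribˡ w u v) (cong₂ _+_ (∙-comm w u) (∙-comm w v)))

  ∙-·ˡ : ∀ {n} a (u v : Vec Carrier n) → (a · u) ∙ v ≡ a * (u ∙ v)
  ∙-·ˡ a u v = trans (∙-comm (a · u) v) (trans (∙-·ʳ v a u) (cong (a *_) (∙-comm v u)))

  ∙-zeroˡ : ∀ {n} (v : Vec Carrier n) → 0ᵥ ∙ v ≡ 0#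
  ∙-zeroˡ v = trans (∙-comm 0ᵥ v) (∙-zeroʳ v)

  ∙-nondegenerate : ∀ {n} {u : Vec Carrier n} → (∀ v → u ∙ v ≡ 0#) → u ≡ 0ᵥ
  ∙-nondegenerate {u = []}    _  = refl
  ∙-nondegenerate {u = x ∷ u} u⊥ = cong₂ _∷_ x≡0 (∙-nondegenerate λ v → trans (sym (+-identityˡ _))
    (trans (cong (_+ u ∙ v) (sym (zeroʳ x))) (u⊥ (0# ∷ v))))
    where
    open ≡-Reasoning
    x≡0 : x ≡ 0#
    x≡0 = begin
      x                  ≡⟨ trans (*-comm x 1#) (*-identityˡ x) ⟨
      x * 1#             ≡⟨ +-identityʳ _ ⟨
      x * 1# + 0#        ≡⟨ cong (x * 1# +_) (∙-zeroʳ u) ⟨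
      x * 1# + u ∙ 0ᵥ    ≡⟨ u⊥ (1# ∷ 0ᵥ) ⟩
      0#                 ∎

  lincomb-∙ : ∀ {n r} (cs : Vec Carrier r) (ws : Vec (Vec Carrier n) r) v → lincomb cs ws ∙ v ≡ cs ∙ Vec.map (_∙ v) ws
  lincomb-∙ []       []       v = ∙-zeroˡ v
  lincomb-∙ (c ∷ cs) (w ∷ ws) v = trans (∙-distribʳ (c · w) _ v) (cong₂ _+_ (∙-·ˡ c w v) (lincomb-∙ cs ws v))

  ⊕-·-cancel : ∀ {n} a (u v : Vec Carrier n) → a · u ⊕ ((- a) · u ⊕ v) ≡ v
  ⊕-·-cancel a u v = begin
    a · u ⊕ ((- a) · u ⊕ v)   ≡⟨ ⊕-assoc (a · u) _ v ⟨
    a · u ⊕ (- a) · u ⊕ v     ≡⟨ cong (_⊕ v) (·-distribʳ a (- a) u) ⟨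
    (a + - a) · u ⊕ v         ≡⟨ cong (λ s → s · u ⊕ v) (-‿inverseʳ a) ⟩
    0# · u ⊕ v                ≡⟨ cong (_⊕ v) (0· u) ⟩
    0ᵥ ⊕ v                    ≡⟨ ⊕-identityˡ v ⟩
    v                         ∎
    where open ≡-Reasoning

  ⊕-cancelˡ : ∀ {n} (u : Vec Carrier n) {v w} → u ⊕ v ≡ u ⊕ w → v ≡ w
  ⊕-cancelˡ u {v} {w} eq = trans (sym (undo v)) (trans (cong ((- 1#) · u ⊕_) eq) (undo w))
    where
    undo : ∀ x → (- 1#) · u ⊕ (u ⊕ x) ≡ x
    undo x = trans (sym (⊕-assoc _ u x)) (trans (cong (_⊕ x) (⊕-inverse u)) (⊕-identityˡ x))

  lincomb-injective : ∀ {n r} {bs : Vec (Vec Carrier n) r} → LinearlyIndependent bs →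
                      ∀ {cs ds} → lincomb cs bs ≡ lincomb ds bs → cs ≡ ds
  lincomb-injective {bs = bs} ind {cs} {ds} eq = begin
    -- `cs` and `ds` are both the negative of `(- 1#) · ds`.
    cs                          ≡⟨ ⊕-cancel (trans (⊕-comm cs _) (ind ((- 1#) · ds ⊕ cs) kernel)) ⟩
    (- 1#) · (- 1#) · ds        ≡⟨ ⊕-cancel (trans (⊕-comm ds _) (⊕-inverse ds)) ⟨
    ds                          ∎
    where
    open ≡-Reasoning
    kernel : lincomb ((- 1#) · ds ⊕ cs) bs ≡ 0ᵥ
    kernel = begin
      lincomb ((- 1#) · ds ⊕ cs) bs             ≡⟨ lincomb-⊕ ((- 1#) · ds) cs bs ⟩
      lincomb ((- 1#) · ds) bs ⊕ lincomb cs bs  ≡⟨ cong₂ _⊕_ (lincomb-· (- 1#) ds bs) eq ⟩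
      (- 1#) · lincomb ds bs ⊕ lincomb ds bs    ≡⟨ ⊕-inverse _ ⟩
      0ᵥ                                        ∎

  lincomb-lincomb : ∀ {n r s} (cs : Vec Carrier s) (ts : Vec (Vec Carrier r) s) (bs : Vec (Vec Carrier n) r) →
                    lincomb cs (Vec.map (λ t → lincomb t bs) ts) ≡ lincomb (lincomb cs ts) bs
  lincomb-lincomb []       []       bs = sym (lincomb-0 bs)
  lincomb-lincomb (c ∷ cs) (t ∷ ts) bs = trans
    (cong₂ _⊕_ (sym (lincomb-· c t bs)) (lincomb-lincomb cs ts bs)) (sym (lincomb-⊕ (c · t) _ bs))

  independent-tail : ∀ {n r} {b : Vec Carrier n} {bs : Vec (Vec Carrier n) r} →
                     LinearlyIndependent (b ∷ bs) → LinearlyIndependent bs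
  independent-tail {b = b} ind cs eq =
    Vec.∷-injectiveʳ (ind (0# ∷ cs) (trans (cong₂ _⊕_ (0· b) eq) (⊕-identityˡ 0ᵥ)))

  independent-head : ∀ {n r} {b : Vec Carrier n} {bs : Vec (Vec Carrier n) r} →
                     LinearlyIndependent (b ∷ bs) → ¬ Span bs b
  independent-head {b = b} {bs} ind (cs , eq) = 0≢1 (sym (trans (sym (involutive 1#)) (trans (cong -_ -1≡0) -0#≈0#)))
    where
    open RingProperties ring using (-0#≈0#) renaming (-‿involutive to involutive)
    -1≡0 : - 1# ≡ 0#
    -1≡0 = Vec.∷-injectiveˡ (ind (- 1# ∷ cs) (trans (cong ((- 1#) · b ⊕_) eq) (⊕-inverse b)))

  span-self-dual : ∀ {n r} {ws : Vec (Vec Carrier n) r} {u v} → Span ws u → Vec.map (_∙ v) ws ≡ 0ᵥ → u ∙ v ≡ 0#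
  span-self-dual {ws = ws} {v = v} (cs , refl) ws⊥v = trans (lincomb-∙ cs ws v) (trans (cong (cs ∙_) ws⊥v) (∙-zeroʳ cs))

  ⊥-span : ∀ {n r} (ws : Vec (Vec Carrier n) r) {v} → (∀ u → Span ws u → u ∙ v ≡ 0#) → Vec.map (_∙ v) ws ≡ 0ᵥ
  ⊥-span []       _  = refl
  ⊥-span (w ∷ ws) ⊥v = cong₂ _∷_ (⊥v w (span-head {ws = ws})) (⊥-span ws λ u u∈ → ⊥v u (span-∷ {w = w} u∈))

  size : ∀ {n} → Subspace n → ℕ
  size {n} V = count (Subspace.member? V) (vectors n)

  infixl 7 _∩ker_
  _∩ker_ : ∀ {n} → Subspace n → Vec Carrier n → Subspace n
  V ∩ker b = record
    { Member   = λ v → Member v × b ∙ v ≡ 0#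
    ; member?  = λ v → member? v ×-dec (b ∙ v ≟ 0#)
    ; 0-closed = 0-closed , ∙-zeroʳ b
    ; ⊕-closed = λ {u} {v} (u∈ , p) (v∈ , q) → ⊕-closed u∈ v∈ ,
        trans (∙-distribˡ b u v) (trans (cong₂ _+_ p q) (+-identityˡ 0#))
    ; ·-closed = λ a {v} (v∈ , p) → ·-closed a v∈ , trans (∙-·ʳ b a v) (trans (cong (a *_) p) (zeroʳ a))
    }
    where open Subspace V

  whole : ∀ n → Subspace n
  whole n = record
    { Member   = λ _ → ⊤
    ; member?  = λ _ → yes tt
    ; 0-closed = tt
    ; ⊕-closed = λ _ _ → tt
    ; ·-closed = λ _ _ → tt
    }

  Vanishes : ∀ {n} → Subspace n → Vec Carrier n → Set
  Vanishes V b = ∀ v → Subspace.Member V v → b ∙ v ≡ 0#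

  -- A finite search decides whether `b` takes a nonzero value on `V`. Scaling makes that value
  -- `1#`, after which `a · u` realises every value `a`.
  vanishes⊎unit : ∀ {n} (V : Subspace n) b → Vanishes V b ⊎ ∃ λ u → Subspace.Member V u × b ∙ u ≡ 1#
  vanishes⊎unit V b with exists? ∈-vectors (λ v → Subspace.member? V v ×-dec ¬? (b ∙ v ≟ 0#))
  ... | no  ¬∃ = inj₁ λ v v∈ → decidable-stable (b ∙ v ≟ 0#) λ bv≢0 → ¬∃ (v , v∈ , bv≢0)
  ... | yes (v , v∈ , bv≢0) with a , eq ← inverse (b ∙ v) bv≢0 =
    inj₂ (a · v , Subspace.·-closed V a v∈ , trans (∙-·ʳ b a v) (trans (*-comm a _) eq))

  -- The values of `b` cut `V` into `order` fibres, and adding `a · u` carries the fibre over `0#`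
  -- onto the fibre over `a`, so each fibre has the size of the kernel.
  size-∩ker : ∀ {n} (V : Subspace n) {b u} → Subspace.Member V u → b ∙ u ≡ 1# →
              order ℕ.* size (V ∩ker b) ≡ size V
  size-∩ker {n} V {b} {u} u∈ bu≡1 = sym (begin
    size V
      ≡⟨ count≡sum member? (vectors n) ⟩
    ∑[ v ∈ vectors n ] 𝟙 (member? v)
      ≡⟨ sumOver-cong (vectors n) value ⟨
    ∑[ v ∈ vectors n ] ∑[ a ∈ elements ] 𝟙 (fibre? a v)
      ≡⟨ sumOver-swap (vectors n) elements (λ v a → 𝟙 (fibre? a v)) ⟩
    ∑[ a ∈ elements ] ∑[ v ∈ vectors n ] 𝟙 (fibre? a v)
      ≡⟨ sumOver-cong elements (λ a → count≡sum (fibre? a) (vectors n)) ⟨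
    ∑[ a ∈ elements ] count (fibre? a) (vectors n)
      ≡⟨ sumOver-cong elements translate ⟩
    ∑[ a ∈ elements ] size (V ∩ker b)
      ≡⟨ sumOver-const elements (size (V ∩ker b)) ⟩
    length elements ℕ.* size (V ∩ker b)
      ≡⟨ cong (ℕ._* size (V ∩ker b)) length-elements ⟩
    order ℕ.* size (V ∩ker b) ∎)
    where
    open ≡-Reasoning
    open Subspace V
    fibre? : ∀ a → Decidable (λ v → Member v × b ∙ v ≡ a)
    fibre? a v = member? v ×-dec (b ∙ v ≟ a)
    value : ∀ v → ∑[ a ∈ elements ] 𝟙 (fibre? a v) ≡ 𝟙 (member? v)
    value v with member? v
    ... | no _  = trans (sumOver-const elements 0) (ℕ.*-zeroʳ (length elements))
    ... | yes _ = begin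
      ∑[ a ∈ elements ] 𝟙 (b ∙ v ≟ a)   ≡⟨ sumOver-cong elements (λ a → 𝟙-cong (b ∙ v ≟ a) (a ≟ b ∙ v) sym sym) ⟩
      ∑[ a ∈ elements ] 𝟙 (a ≟ b ∙ v)   ≡⟨ count≡sum (_≟ b ∙ v) elements ⟨
      count (_≟ b ∙ v) elements         ≡⟨ count-≡ _≟_ elements-unique (∈-elements (b ∙ v)) ⟩
      1                                 ∎
    value-· : ∀ a {v} → b ∙ (a · u ⊕ v) ≡ a + b ∙ v
    value-· a {v} = trans (∙-distribˡ b (a · u) v) (cong (_+ b ∙ v)
      (trans (∙-·ʳ b a u) (trans (cong (a *_) bu≡1) (trans (*-comm a 1#) (*-identityˡ a)))))
    translate : ∀ a → count (fibre? a) (vectors n) ≡ size (V ∩ker b)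
    translate a = sym (count-bijection (Subspace.member? (V ∩ker b)) (fibre? a) (a · u ⊕_)
      (vectors-unique n) (vectors-unique n) ∈-vectors ∈-vectors (⊕-cancelˡ (a · u))
      (λ v (v∈ , bv≡0) → ⊕-closed (·-closed a u∈) v∈ , trans (value-· a) (trans (cong (a +_) bv≡0) (+-identityʳ a)))
      (λ v (v∈ , bv≡a) → (- a) · u ⊕ v
        , (⊕-closed (·-closed (- a) u∈) v∈ , trans (value-· (- a)) (trans (cong (- a +_) bv≡a) (-‿inverseˡ a)))
        , ⊕-·-cancel a u v))

  -- Induction on bs: restricted to the kernel of b, y is a combination of the other functionals,
  -- and what is left of y vanishes on that kernel, so it is a multiple of b.
  separation : ∀ {n r} (V : Subspace n) (bs : Vec (Vec Carrier n) r) y →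
    (∀ v → Subspace.Member V v → Vec.map (_∙ v) bs ≡ 0ᵥ → y ∙ v ≡ 0#) →
    ∃ λ cs → ∀ v → Subspace.Member V v → y ∙ v ≡ lincomb cs bs ∙ v
  separation V []       y y⊥ = [] , λ v v∈ → trans (y⊥ v v∈ refl) (sym (∙-zeroˡ v))
  separation V (b ∷ bs) y y⊥
    with cs , y≡ ← separation (V ∩ker b) bs y (λ v (v∈ , bv≡0) bs⊥v → y⊥ v v∈ (cong₂ _∷_ bv≡0 bs⊥v))
    with vanishes⊎unit V b
  ... | inj₁ b⊥ = 0# ∷ cs , λ v v∈ → trans (y≡ v (v∈ , b⊥ v v∈))
    (cong (_∙ v) (sym (trans (cong (_⊕ lincomb cs bs) (0· b)) (⊕-identityˡ _))))
  -- Evaluation at `u`, where `b` is `1#`, reads off the factor of `b`. Subtracting `(b ∙ v) · u`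
  -- from `v` projects `V` onto the kernel of `b`, where `y` and `z` agree.
  ... | inj₂ (u , u∈ , bu≡1) = (y ∙ u + - (z ∙ u)) ∷ cs , λ v v∈ → trans
    (rearrange (trans (sym (expand y v)) (trans (y≡ _ (projection∈ v v∈)) (expand z v))))
    (sym (trans (∙-distribʳ ((y ∙ u + - (z ∙ u)) · b) z v) (cong (_+ z ∙ v) (∙-·ˡ _ b v))))
    where
    open Subspace V
    open ≡-Reasoning
    z = lincomb cs bs
    expand : ∀ w v → w ∙ ((- (b ∙ v)) · u ⊕ v) ≡ - (b ∙ v) * (w ∙ u) + w ∙ v
    expand w v = trans (∙-distribˡ w _ v) (cong (_+ w ∙ v) (∙-·ʳ w _ u))
    projection∈ : ∀ v → Member v → Subspace.Member (V ∩ker b) ((- (b ∙ v)) · u ⊕ v)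
    projection∈ v v∈ = ⊕-closed (·-closed _ u∈) v∈ , (begin
      b ∙ ((- (b ∙ v)) · u ⊕ v)         ≡⟨ expand b v ⟩
      - (b ∙ v) * (b ∙ u) + b ∙ v       ≡⟨ cong (λ t → - (b ∙ v) * t + b ∙ v) bu≡1 ⟩
      - (b ∙ v) * 1# + b ∙ v            ≡⟨ cong (_+ b ∙ v) (trans (*-comm _ 1#) (*-identityˡ _)) ⟩
      - (b ∙ v) + b ∙ v                 ≡⟨ -‿inverseˡ _ ⟩
      0#                                ∎)
    rearrange : ∀ {s p r a d} → - s * p + a ≡ - s * r + d → a ≡ (p + - r) * s + d
    rearrange {s} {p} {r} {a} {d} eq = begin
      a                                      ≡⟨ +-identityˡ a ⟨
      0# + a                                 ≡⟨ cong (_+ a) (trans (cong (_* p) (-‿inverseˡ s)) (zeroˡ p)) ⟨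
      (- s + s) * p + a                      ≡⟨ solve 4 (λ s t p a → (t :+ s) :* p :+ a := s :* p :+ (t :* p :+ a)) refl s (- s) p a ⟩
      s * p + (- s * p + a)                  ≡⟨ cong (s * p +_) eq ⟩
      s * p + (- s * r + d)                  ≡⟨ +-identityʳ _ ⟨
      s * p + (- s * r + d) + 0#             ≡⟨ cong (s * p + (- s * r + d) +_) (trans (cong (_* s) (-‿inverseˡ r)) (zeroˡ s)) ⟨
      s * p + (- s * r + d) + (- r + r) * s  ≡⟨ solve 6 (λ s t p r r′ d → s :* p :+ (t :* r :+ d) :+ (r′ :+ r) :* s
                                                  := (p :+ r′) :* s :+ d :+ (t :+ s) :* r) refl s (- s) p r (- r) d ⟩
      (p + - r) * s + d + (- s + s) * r      ≡⟨ cong ((p + - r) * s + d +_) (trans (cong (_* r) (-‿inverseˡ s)) (zeroˡ r)) ⟩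
      (p + - r) * s + d + 0#                 ≡⟨ +-identityʳ _ ⟩
      (p + - r) * s + d                      ∎

  -- `separation` on the whole space gives a combination with the same values as `y` everywhere, and
  -- the dot product is nondegenerate.
  ⊥⊥⇒span : ∀ {n r} (bs : Vec (Vec Carrier n) r) {y} →
            (∀ v → Vec.map (_∙ v) bs ≡ 0ᵥ → y ∙ v ≡ 0#) → Span bs y
  ⊥⊥⇒span {n} bs {y} y⊥ with cs , y≡ ← separation (whole n) bs y (λ v _ → y⊥ v) = cs , (begin
    lincomb cs bs                ≡⟨ ⊕-cancel (trans (⊕-comm (lincomb cs bs) _) (∙-nondegenerate difference⊥)) ⟩
    (- 1#) · (- 1#) · y          ≡⟨ ⊕-cancel (trans (⊕-comm y _) (⊕-inverse y)) ⟨
    y                            ∎)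
    where
    open ≡-Reasoning
    difference⊥ : ∀ v → ((- 1#) · y ⊕ lincomb cs bs) ∙ v ≡ 0#
    difference⊥ v = begin
      ((- 1#) · y ⊕ lincomb cs bs) ∙ v        ≡⟨ ∙-distribʳ ((- 1#) · y) (lincomb cs bs) v ⟩
      ((- 1#) · y) ∙ v + lincomb cs bs ∙ v    ≡⟨ cong (((- 1#) · y) ∙ v +_) (y≡ v tt) ⟨
      ((- 1#) · y) ∙ v + y ∙ v                ≡⟨ ∙-distribʳ ((- 1#) · y) y v ⟨
      ((- 1#) · y ⊕ y) ∙ v                    ≡⟨ cong (_∙ v) (⊕-inverse y) ⟩
      0ᵥ ∙ v                                  ≡⟨ ∙-zeroˡ v ⟩
      0#                                      ∎

  -- The orthogonal complement of `bs` as an iterated kernel, so that `size-∩ker` applies at each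
  -- vector.
  annihilator : ∀ {n r} → Vec (Vec Carrier n) r → Subspace n
  annihilator []       = whole _
  annihilator (b ∷ bs) = annihilator bs ∩ker b

  annihilator⁻ : ∀ {n r} (bs : Vec (Vec Carrier n) r) {v} →
                 Subspace.Member (annihilator bs) v → Vec.map (_∙ v) bs ≡ 0ᵥ
  annihilator⁻ []       _           = refl
  annihilator⁻ (b ∷ bs) (v∈ , bv≡0) = cong₂ _∷_ bv≡0 (annihilator⁻ bs v∈)

  annihilator⁺ : ∀ {n r} (bs : Vec (Vec Carrier n) r) {v} →
                 Vec.map (_∙ v) bs ≡ 0ᵥ → Subspace.Member (annihilator bs) v
  annihilator⁺ []       _    = tt
  annihilator⁺ (b ∷ bs) bs⊥v = annihilator⁺ bs (Vec.∷-injectiveʳ bs⊥v) , Vec.∷-injectiveˡ bs⊥v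

  -- By `⊥⊥⇒span`, a vector outside the span of `bs` cannot vanish on their annihilator, so each
  -- further independent vector divides the size by `order`.
  size-annihilator : ∀ {n r} (bs : Vec (Vec Carrier n) r) → LinearlyIndependent bs →
                     order ^ r ℕ.* size (annihilator bs) ≡ order ^ n
  size-annihilator {n} [] _ = trans (ℕ.*-identityˡ _)
    (trans (cong length (List.filter-all (λ _ → yes tt) (All.universal (λ _ → tt) (vectors n)))) (length-vectors n))
  size-annihilator {n} {suc r} (b ∷ bs) ind with vanishes⊎unit (annihilator bs) b
  ... | inj₁ b⊥ = contradiction (⊥⊥⇒span bs λ v bs⊥v → b⊥ v (annihilator⁺ bs bs⊥v)) (independent-head ind)
  ... | inj₂ (u , u∈ , bu≡1) = begin
    order ℕ.* order ^ r ℕ.* size (annihilator bs ∩ker b)     ≡⟨ cong (ℕ._* size (annihilator bs ∩ker b)) (ℕ.*-comm order (order ^ r)) ⟩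
    order ^ r ℕ.* order ℕ.* size (annihilator bs ∩ker b)     ≡⟨ ℕ.*-assoc (order ^ r) order (size (annihilator bs ∩ker b)) ⟩
    order ^ r ℕ.* (order ℕ.* size (annihilator bs ∩ker b))   ≡⟨ cong (order ^ r ℕ.*_) (size-∩ker (annihilator bs) {b} u∈ bu≡1) ⟩
    order ^ r ℕ.* size (annihilator bs)                      ≡⟨ size-annihilator bs (independent-tail ind) ⟩
    order ^ n                                                ∎
    where open ≡-Reasoning

  count-basis : ∀ {n r} {U : Pred (Vec Carrier n) 0ℓ} (U? : Decidable U) (bs : Vec (Vec Carrier n) r) →
                IsBasis U bs → count U? (vectors n) ≡ order ^ r
  count-basis {n} {r} U? bs ((U⊆ , ⊆U) , ind) = sym (trans (sym (length-vectors r))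
    (length-bijection (λ cs → lincomb cs bs) (vectors-unique r) (Unique.filter⁺ U? (vectors-unique n))
      (lincomb-injective {bs = bs} ind)
      (λ {cs} _ → ∈-filter⁺ U? (∈-vectors _) (⊆U (cs , refl)))
      (λ y∈ → let cs , eq = U⊆ (proj₂ (∈-filter⁻ U? {xs = vectors n} y∈)) in cs , ∈-vectors cs , eq)))

  count-span : ∀ {n r} (bs : Vec (Vec Carrier n) r) → LinearlyIndependent bs →
               count (span? bs) (vectors n) ≡ order ^ r
  count-span bs ind = count-basis (span? bs) bs ((id , id) , ind)

  lincomb-zipWith-∷ : ∀ {n r} (cs row : Vec Carrier r) (ws : Vec (Vec Carrier n) r) →
                      lincomb cs (Vec.zipWith _∷_ row ws) ≡ (cs ∙ row) ∷ lincomb cs ws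
  lincomb-zipWith-∷ []       []        []       = refl
  lincomb-zipWith-∷ (c ∷ cs) (x ∷ row) (w ∷ ws) = cong (((c * x) ∷ c · w) ⊕_) (lincomb-zipWith-∷ cs row ws)

  -- One bilinear form in `cs` and `x`, its matrix `M` taken by columns on the left and by rows on
  -- the right. It turns orthogonality of `x` to the column space into a statement on a single
  -- combination of rows.
  lincomb-transpose : ∀ {m n} (cs : Vec Carrier m) (M : Vec (Vec Carrier m) n) x →
                      lincomb cs (Vec.transpose M) ∙ x ≡ cs ∙ lincomb x M
  lincomb-transpose cs []        []      = trans (∙-[] (lincomb cs (Vec.transpose []))) (sym (∙-zeroʳ cs))
    where
    ∙-[] : (u : Vec Carrier 0) → u ∙ [] ≡ 0#
    ∙-[] [] = refl
  lincomb-transpose cs (row ∷ M) (y ∷ x) = begin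
    lincomb cs (Vec.transpose (row ∷ M)) ∙ (y ∷ x)
      ≡⟨ cong (λ T → lincomb cs T ∙ (y ∷ x)) (transpose-∷ row M) ⟩
    lincomb cs (Vec.zipWith _∷_ row (Vec.transpose M)) ∙ (y ∷ x)
      ≡⟨ cong (_∙ (y ∷ x)) (lincomb-zipWith-∷ cs row (Vec.transpose M)) ⟩
    (cs ∙ row) * y + lincomb cs (Vec.transpose M) ∙ x
      ≡⟨ cong₂ _+_ (*-comm _ y) (lincomb-transpose cs M x) ⟩
    y * (cs ∙ row) + cs ∙ lincomb x M
      ≡⟨ cong (_+ cs ∙ lincomb x M) (∙-·ʳ cs y row) ⟨
    cs ∙ (y · row) + cs ∙ lincomb x M
      ≡⟨ ∙-distribˡ cs (y · row) (lincomb x M) ⟨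
    cs ∙ (y · row ⊕ lincomb x M) ∎
    where open ≡-Reasoning

  size-∩ker-vanishing : ∀ {n} (V : Subspace n) b → Vanishes V b → size (V ∩ker b) ≡ size V
  size-∩ker-vanishing {n} V b b⊥ = count-cong (Subspace.member? (V ∩ker b)) (Subspace.member? V) (vectors n)
    (λ _ → proj₁) (λ v v∈ → v∈ , b⊥ v v∈)

  vanishes? : ∀ {n} (V : Subspace n) b → Dec (Vanishes V b)
  vanishes? V b = forall? ∈-vectors (λ v → Subspace.member? V v →-dec (b ∙ v ≟ 0#))

  ¬vanishes⇒order*size : ∀ {n} (V : Subspace n) b → ¬ Vanishes V b → order ℕ.* size (V ∩ker b) ≡ size V
  ¬vanishes⇒order*size V b ¬b⊥ with vanishes⊎unit V b
  ... | inj₁ b⊥             = contradiction b⊥ ¬b⊥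
  ... | inj₂ (u , u∈ , bu≡1) = size-∩ker V {b} u∈ bu≡1

  span-singleton : ∀ {n} {x : Vec Carrier n} → x ≢ 0ᵥ → LinearlyIndependent (x ∷ [])
  span-singleton {x = x} x≢0 = extend-independent {bs = []} (λ { [] _ → refl }) λ { ([] , eq) → x≢0 (sym eq) }

  count-≢0 : ∀ n → suc (count (¬? ∘ (_≟ᵥ 0ᵥ)) (vectors n)) ≡ order ^ n
  count-≢0 n = trans (cong (ℕ._+ count (¬? ∘ (_≟ᵥ 0ᵥ)) (vectors n)) (sym (count-≡0 n)))
    (trans (sym (count-complement (_≟ᵥ 0ᵥ) (vectors n))) (length-vectors n))

  count-∉span : ∀ {n} {x : Vec Carrier n} → x ≢ 0ᵥ → order ℕ.+ count (¬? ∘ span? (x ∷ [])) (vectors n) ≡ order ^ n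
  count-∉span {n} {x} x≢0 =
    trans (cong (ℕ._+ count (¬? ∘ span? (x ∷ [])) (vectors n)) (sym (trans (count-span (x ∷ []) (span-singleton x≢0)) (ℕ.*-identityʳ order))))
    (trans (sym (count-complement (span? (x ∷ [])) (vectors n))) (length-vectors n))

-- Independent tuples and Gaussian binomials

module IndependentTuples {order} (F : FiniteField order) where

  open FiniteField F using (Carrier; 0#; 1#; -_)
  open LinearAlgebra F
  open FiniteLinearAlgebra F

  independentTuples : ∀ n r → List.List (Vec (Vec Carrier n) r)
  independentTuples n r = filter (linearlyIndependent? {n} {r}) (tuples (vectors n) r)

  #independent : ℕ → ℕ → ℕ
  #independent n r = length (independentTuples n r)

  ∈-tuples-vectors : ∀ {n r} (ws : Vec (Vec Carrier n) r) → ws ∈ tuples (vectors n) r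
  ∈-tuples-vectors = ∈-tuples ∈-vectors

  #independent-zero : ∀ n → #independent n 0 ≡ 1
  #independent-zero n = cong length (List.filter-accept (linearlyIndependent? {n} {0}) {x = []} {xs = List.[]} λ { [] _ → refl })

  -- An independent `r`-tuple is prolonged by the vectors outside its span, which number `order ^ n`
  -- minus `order ^ r`, and a dependent one by none. The difference is written as a sum to stay in
  -- ℕ.
  #independent-suc : ∀ n r → #independent n (suc r) ℕ.+ #independent n r ℕ.* order ^ r ≡ #independent n r ℕ.* order ^ n
  #independent-suc n r = begin
    #independent n (suc r) ℕ.+ #independent n r ℕ.* order ^ r
      ≡⟨ cong₂ ℕ._+_ byTail (indicators (order ^ r)) ⟩
    (∑[ bs ∈ tuples (vectors n) r ] ∑[ w ∈ vectors n ] 𝟙 (linearlyIndependent? (w ∷ bs)))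
      ℕ.+ ∑[ bs ∈ tuples (vectors n) r ] (𝟙 (linearlyIndependent? bs) ℕ.* order ^ r)
      ≡⟨ sumOver-+ (tuples (vectors n) r) _ _ ⟨
    ∑[ bs ∈ tuples (vectors n) r ] (∑[ w ∈ vectors n ] 𝟙 (linearlyIndependent? (w ∷ bs)) ℕ.+ 𝟙 (linearlyIndependent? bs) ℕ.* order ^ r)
      ≡⟨ sumOver-cong (tuples (vectors n) r) (λ bs → extensions bs (linearlyIndependent? bs)) ⟩
    ∑[ bs ∈ tuples (vectors n) r ] (𝟙 (linearlyIndependent? bs) ℕ.* order ^ n)
      ≡⟨ indicators (order ^ n) ⟨
    #independent n r ℕ.* order ^ n ∎
    where
    open ≡-Reasoning
    indicators : ∀ a → #independent n r ℕ.* a ≡ ∑[ bs ∈ tuples (vectors n) r ] (𝟙 (linearlyIndependent? bs) ℕ.* a)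
    indicators a = trans (cong (ℕ._* a) (count≡sum linearlyIndependent? (tuples (vectors n) r)))
      (sym (sumOver-*ʳ (tuples (vectors n) r) (λ bs → 𝟙 (linearlyIndependent? bs)) a))
    byTail : #independent n (suc r) ≡ ∑[ bs ∈ tuples (vectors n) r ] ∑[ w ∈ vectors n ] 𝟙 (linearlyIndependent? (w ∷ bs))
    byTail = trans (count≡sum linearlyIndependent? (tuples (vectors n) (suc r)))
      (trans (sumOver-cartesianProductWith _∷_ (vectors n) (tuples (vectors n) r) _)
             (sumOver-swap (vectors n) (tuples (vectors n) r) (λ w bs → 𝟙 (linearlyIndependent? (w ∷ bs)))))
    extensions : ∀ bs (bs? : Dec (LinearlyIndependent bs)) →
      ∑[ w ∈ vectors n ] 𝟙 (linearlyIndependent? (w ∷ bs)) ℕ.+ 𝟙 bs? ℕ.* order ^ r ≡ 𝟙 bs? ℕ.* order ^ n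
    extensions bs (no ¬ind) = begin
      ∑[ w ∈ vectors n ] 𝟙 (linearlyIndependent? (w ∷ bs)) ℕ.+ 0
        ≡⟨ ℕ.+-identityʳ _ ⟩
      ∑[ w ∈ vectors n ] 𝟙 (linearlyIndependent? (w ∷ bs))
        ≡⟨ sumOver-cong (vectors n) (λ w → 𝟙-false (linearlyIndependent? (w ∷ bs)) (¬ind ∘ independent-tail)) ⟩
      ∑[ w ∈ vectors n ] 0
        ≡⟨ trans (sumOver-const (vectors n) 0) (ℕ.*-zeroʳ (length (vectors n))) ⟩
      0 ∎
    extensions bs (yes ind) = begin
      ∑[ w ∈ vectors n ] 𝟙 (linearlyIndependent? (w ∷ bs)) ℕ.+ 1 ℕ.* order ^ r
        ≡⟨ cong₂ ℕ._+_ (sumOver-cong (vectors n) λ w → 𝟙-cong (linearlyIndependent? (w ∷ bs)) (¬? (span? bs w))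
              independent-head (extend-independent ind)) (ℕ.*-identityˡ (order ^ r)) ⟩
      ∑[ w ∈ vectors n ] 𝟙 (¬? (span? bs w)) ℕ.+ order ^ r
        ≡⟨ cong₂ ℕ._+_ (count≡sum (¬? ∘ span? bs) (vectors n)) (count-span bs ind) ⟨
      count (¬? ∘ span? bs) (vectors n) ℕ.+ count (span? bs) (vectors n)
        ≡⟨ ℕ.+-comm _ (count (span? bs) (vectors n)) ⟩
      count (span? bs) (vectors n) ℕ.+ count (¬? ∘ span? bs) (vectors n)
        ≡⟨ count-complement (span? bs) (vectors n) ⟨
      length (vectors n)
        ≡⟨ trans (length-vectors n) (sym (ℕ.*-identityˡ (order ^ n))) ⟩
      1 ℕ.* order ^ n ∎

  -- By `count-span` the span has as many elements as the whole space, and a filter that keeps the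
  -- length of a list keeps every entry.
  independent⇒spanning : ∀ {r} (ts : Vec (Vec Carrier r) r) → LinearlyIndependent ts → ∀ v → Span ts v
  independent⇒spanning {r} ts ind v = proj₂ (∈-filter⁻ (span? ts) {xs = vectors r}
    (subst (v ∈_) (sym (List.filter-complete (span? ts) (trans (count-span ts ind) (sym (length-vectors r))))) (∈-vectors v)))

  -- Unit coefficient vectors single out the entries of `ts`, so the hypothesis supplies coordinates
  -- of each entry with respect to `bs`.
  lincomb-closed : ∀ {n r s} {bs : Vec (Vec Carrier n) r} (ts : Vec (Vec Carrier n) s) →
                   (∀ cs → Span bs (lincomb cs ts)) → ∃ λ ds → Vec.map (λ d → lincomb d bs) ds ≡ ts
  lincomb-closed []       _   = [] , refl
  lincomb-closed {bs = bs} (t ∷ ts) ⊆bs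
    with ds , eqs ← lincomb-closed {bs = bs} ts (λ cs → subst (Span bs) (trans (cong (_⊕ lincomb cs ts) (0· t)) (⊕-identityˡ _)) (⊆bs (0# ∷ cs)))
    with d , eq ← ⊆bs (1# ∷ 0ᵥ)
    = d ∷ ds , cong₂ _∷_ (trans eq (proj₂ (span-head {w = t} {ts}))) eqs

  -- Coordinates with respect to `bs` match the bases of its span with the bases of the coordinate
  -- space, so all spans of the same dimension have equally many bases.
  bases-of-span : ∀ {n r} (bs : Vec (Vec Carrier n) r) → LinearlyIndependent bs →
                  count (bs ≐ₛ?_) (independentTuples n r) ≡ #independent r r
  bases-of-span {n} {r} bs ind = sym (length-bijection φ
    (Unique.filter⁺ linearlyIndependent? (tuples-unique (vectors-unique r) r))
    (Unique.filter⁺ (bs ≐ₛ?_) (Unique.filter⁺ linearlyIndependent? (tuples-unique (vectors-unique n) r)))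
    (map-injective (lincomb-injective {bs = bs} ind))
    (λ {ts} ts∈ → let tind = proj₂ (∈-filter⁻ linearlyIndependent? {xs = tuples (vectors r) r} ts∈) in
      ∈-filter⁺ (bs ≐ₛ?_) (∈-filter⁺ linearlyIndependent? (∈-tuples-vectors (φ ts)) (φ-independent ts tind)) (φ-span ts tind))
    onto)
    where
    φ : Vec (Vec Carrier r) r → Vec (Vec Carrier n) r
    φ = Vec.map λ t → lincomb t bs
    map-injective : ∀ {A B : Set} {f : A → B} → (∀ {x y} → f x ≡ f y → x ≡ y) →
                    ∀ {s} {xs ys : Vec A s} → Vec.map f xs ≡ Vec.map f ys → xs ≡ ys
    map-injective injective {xs = []}     {[]}     _  = refl
    map-injective injective {xs = x ∷ xs} {y ∷ ys} eq =
      cong₂ _∷_ (injective (Vec.∷-injectiveˡ eq)) (map-injective injective (Vec.∷-injectiveʳ eq))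
    φ-independent : ∀ ts → LinearlyIndependent ts → LinearlyIndependent (φ ts)
    φ-independent ts tind cs eq = tind cs (ind _ (trans (sym (lincomb-lincomb cs ts bs)) eq))
    φ-span : ∀ ts → LinearlyIndependent ts → Span bs ≐ Span (φ ts)
    φ-span ts tind =
      (λ { (cs , refl) → let ds , eq = independent⇒spanning ts tind cs in
             ds , trans (lincomb-lincomb ds ts bs) (cong (λ c → lincomb c bs) eq) }) ,
      (λ { (cs , refl) → lincomb cs ts , sym (lincomb-lincomb cs ts bs) })
    onto : ∀ {ws} → ws ∈ filter (bs ≐ₛ?_) (independentTuples n r) → ∃ λ ts → ts ∈ independentTuples r r × φ ts ≡ ws
    onto {ws} ws∈
      with ws∈′ , (_ , ws⊆bs) ← ∈-filter⁻ (bs ≐ₛ?_) {xs = independentTuples n r} ws∈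
      with wind ← proj₂ (∈-filter⁻ linearlyIndependent? {xs = tuples (vectors n) r} ws∈′)
      with ts , refl ← lincomb-closed {bs = bs} ws (λ cs → ws⊆bs (cs , refl))
      = ts , ∈-filter⁺ linearlyIndependent? (∈-tuples-vectors ts) tind , refl
      where
      tind : LinearlyIndependent ts
      tind cs eq = wind cs (trans (lincomb-lincomb cs ts bs) (trans (cong (λ c → lincomb c bs) eq) (lincomb-0 bs)))

  -- The definition counts classes of independent tuples with equal span, and `bases-of-span` gives
  -- every class the size `#independent r r`. This trades the enumeration for the recursion
  -- `#independent-suc`.
  gaussianBinomial-independent : ∀ n r → gaussianBinomial n r ℕ.* #independent r r ≡ #independent n r
  gaussianBinomial-independent n r = length-classes _≐ₛ?_
    (id , id) (λ (f , g) → g , f) (λ (f , g) (f′ , g′) → f′ ∘ f , g ∘ g′)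
    (independentTuples n r)
    (λ {bs} bs∈ → bases-of-span bs (proj₂ (∈-filter⁻ linearlyIndependent? {xs = tuples (vectors n) r} bs∈)))

  #independent-one : ∀ n → #independent n 1 ℕ.+ 1 ≡ order ^ n
  #independent-one n = begin
    #independent n 1 ℕ.+ 1                              ≡⟨ cong (λ i → #independent n 1 ℕ.+ i ℕ.* 1) (#independent-zero n) ⟨
    #independent n 1 ℕ.+ #independent n 0 ℕ.* order ^ 0 ≡⟨ #independent-suc n 0 ⟩
    #independent n 0 ℕ.* order ^ n                      ≡⟨ cong (ℕ._* order ^ n) (#independent-zero n) ⟩
    1 ℕ.* order ^ n                                     ≡⟨ ℕ.*-identityˡ (order ^ n) ⟩
    order ^ n                                           ∎
    where open ≡-Reasoning

  #independent-two : ∀ n → #independent n 2 ℕ.+ #independent n 1 ℕ.* order ≡ #independent n 1 ℕ.* order ^ n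
  #independent-two n = trans (cong (λ i → #independent n 2 ℕ.+ #independent n 1 ℕ.* i) (sym (ℕ.*-identityʳ order))) (#independent-suc n 1)

  -- Allows cancellation in `gaussianBinomial-independent`. Were the number zero, `#independent-suc`
  -- would equate `order ^ r` and `order ^ n` times the same nonzero number, although `r < n`.
  #independent≢0 : 1 ℕ.< order → ∀ {r} n → r ℕ.≤ n → #independent n r ≢ 0
  #independent≢0 1<order {zero}  n _   eq = contradiction (trans (sym (#independent-zero n)) eq) λ ()
  #independent≢0 1<order {suc r} n r<n eq = ℕ.<-irrefl (trans (cong (ℕ._+ #independent n r ℕ.* order ^ r) (sym eq)) (#independent-suc n r))
    (ℕ.*-monoʳ-< (#independent n r) {{ℕ.≢-nonZero (#independent≢0 1<order n (ℕ.<⇒≤ r<n))}} (ℕ.^-monoʳ-< order 1<order r<n))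

  gaussianBinomial-zero : ∀ n → gaussianBinomial n 0 ≡ 1
  gaussianBinomial-zero n = trans (sym (ℕ.*-identityʳ (gaussianBinomial n 0)))
    (trans (cong (gaussianBinomial n 0 ℕ.*_) (sym (#independent-zero 0)))
           (trans (gaussianBinomial-independent n 0) (#independent-zero n)))

  gaussianBinomial-self : 1 ℕ.< order → ∀ r → gaussianBinomial r r ≡ 1
  gaussianBinomial-self 1<order r = ℕ.*-cancelʳ-≡ _ 1 (#independent r r) {{ℕ.≢-nonZero (#independent≢0 1<order r ℕ.≤-refl)}}
    (trans (gaussianBinomial-independent r r) (sym (ℕ.*-identityˡ (#independent r r))))

  gaussianBinomial-two-one : 1 ℕ.< order → gaussianBinomial 2 1 ≡ order ℕ.+ 1
  gaussianBinomial-two-one 1<order = ℕ.*-cancelʳ-≡ _ _ (#independent 1 1) {{ℕ.≢-nonZero (#independent≢0 1<order 1 ℕ.≤-refl)}}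
    (trans (gaussianBinomial-independent 2 1) (ℕ.+-cancelʳ-≡ 1 _ _ (trans (#independent-one 2)
      (difference-of-squares (trans (#independent-one 1) (ℕ.*-identityʳ order))))))
    where
    difference-of-squares : ∀ {a b} → a ℕ.+ 1 ≡ b → b ^ 2 ≡ (b ℕ.+ 1) ℕ.* a ℕ.+ 1
    difference-of-squares {a} refl = expand a
      where
      expand : ∀ a → (a ℕ.+ 1) ℕ.* ((a ℕ.+ 1) ℕ.* 1) ≡ (a ℕ.+ 1 ℕ.+ 1) ℕ.* a ℕ.+ 1
      expand = solve-∀

-- Extension of scalars from K to L

module ExtensionOfScalars {q r} {K : FiniteField q} {L : FiniteField r} (E : FieldExtension K L) where

  private
    module K  = FiniteField K
    module L  = FiniteField L
    module K# = LinearAlgebra K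
    module L# = LinearAlgebra L
    module L′ = FiniteLinearAlgebra L
  open FieldExtension E
  open RingMorphisms K.rawRing L.rawRing using (module IsRingHomomorphism)
  open IsRingHomomorphism isRingHomomorphism public using (+-homo; *-homo; 0#-homo; 1#-homo)

  ιᵥ : ∀ {n} → Vec K.Carrier n → Vec L.Carrier n
  ιᵥ = Vec.map ι

  ι-kernel : ∀ {a} → ι a ≡ L.0# → a ≡ K.0#
  ι-kernel {a} ιa≡0 = decidable-stable (a K.≟ K.0#) λ a≢0 → let b , ab≡1 = K.inverse a a≢0 in
    L.0≢1 (begin
      L.0#            ≡⟨ L.zeroˡ (ι b) ⟨
      L.0# L.* ι b    ≡⟨ cong (L._* ι b) ιa≡0 ⟨
      ι a L.* ι b     ≡⟨ *-homo a b ⟨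
      ι (a K.* b)     ≡⟨ cong ι ab≡1 ⟩
      ι K.1#          ≡⟨ 1#-homo ⟩
      L.1#            ∎)
    where open ≡-Reasoning

  ιᵥ-0 : ∀ n → ιᵥ (K#.0ᵥ {n}) ≡ L#.0ᵥ
  ιᵥ-0 zero    = refl
  ιᵥ-0 (suc n) = cong₂ _∷_ 0#-homo (ιᵥ-0 n)

  ιᵥ-⊕ : ∀ {n} (u v : Vec K.Carrier n) → ιᵥ (u K#.⊕ v) ≡ ιᵥ u L#.⊕ ιᵥ v
  ιᵥ-⊕ []      []      = refl
  ιᵥ-⊕ (x ∷ u) (y ∷ v) = cong₂ _∷_ (+-homo x y) (ιᵥ-⊕ u v)

  ιᵥ-· : ∀ {n} a (v : Vec K.Carrier n) → ιᵥ (a K#.· v) ≡ ι a L#.· ιᵥ v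
  ιᵥ-· a []      = refl
  ιᵥ-· a (x ∷ v) = cong₂ _∷_ (*-homo a x) (ιᵥ-· a v)

  ιᵥ-∙ : ∀ {n} (u v : Vec K.Carrier n) → ιᵥ u L#.∙ ιᵥ v ≡ ι (u K#.∙ v)
  ιᵥ-∙ []      []      = sym 0#-homo
  ιᵥ-∙ (x ∷ u) (y ∷ v) = sym (trans (+-homo _ _) (cong₂ L._+_ (*-homo x y) (sym (ιᵥ-∙ u v))))

  ιᵥ-lincomb : ∀ {n s} (cs : Vec K.Carrier s) (ws : Vec (Vec K.Carrier n) s) →
               ιᵥ (K#.lincomb cs ws) ≡ L#.lincomb (ιᵥ cs) (Vec.map ιᵥ ws)
  ιᵥ-lincomb {n} []  []       = ιᵥ-0 n
  ιᵥ-lincomb (c ∷ cs) (w ∷ ws) = trans (ιᵥ-⊕ (c K#.· w) _) (cong₂ L#._⊕_ (ιᵥ-· c w) (ιᵥ-lincomb cs ws))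

-- Rank supports and orthogonality

module RankSupport
  {q m : ℕ} {{_ : PrimePower q}} {K : FiniteField q} {L : FiniteField (q ^ m)} {E : FieldExtension K L}
  (Γ : OrderedBasis E m)
  where

  private
    module K  = FiniteField K
    module L  = FiniteField L
    module K# = LinearAlgebra K
    module L# = LinearAlgebra L
    module K′ = FiniteLinearAlgebra K
    module L′ = FiniteLinearAlgebra L
  open FieldExtension E
  open OrderedBasis Γ
  open ExtensionOfScalars E
  open RankMetric Γ

  -- Expanding every entry of `v` in the basis `γ` gives the product coordinates that are a row
  -- combination of `Γ-matrix v`. As `γ` is independent, the product vanishes exactly when this
  -- combination does.
  ιᵥ-∙-Γ-matrix : ∀ {n} (x : Vec K.Carrier n) v → ιᵥ x L#.∙ v ≡ ιᵥ (K#.lincomb x (Γ-matrix v)) L#.∙ γ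
  ιᵥ-∙-Γ-matrix []      []      = sym (trans (cong (L#._∙ γ) (ιᵥ-0 m)) (L′.∙-zeroˡ γ))
  ιᵥ-∙-Γ-matrix (a ∷ x) (b ∷ v) = sym (begin
    ιᵥ (a K#.· coordinates b K#.⊕ K#.lincomb x (Γ-matrix v)) L#.∙ γ
      ≡⟨ cong (L#._∙ γ) (trans (ιᵥ-⊕ (a K#.· coordinates b) _) (cong (L#._⊕ _) (ιᵥ-· a (coordinates b)))) ⟩
    (ι a L#.· ιᵥ (coordinates b) L#.⊕ ιᵥ (K#.lincomb x (Γ-matrix v))) L#.∙ γ
      ≡⟨ L′.∙-distribʳ (ι a L#.· ιᵥ (coordinates b)) _ γ ⟩
    (ι a L#.· ιᵥ (coordinates b)) L#.∙ γ L.+ ιᵥ (K#.lincomb x (Γ-matrix v)) L#.∙ γ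
      ≡⟨ cong₂ L._+_ (trans (L′.∙-·ˡ (ι a) (ιᵥ (coordinates b)) γ) (cong (ι a L.*_) (proj₂ (spanning b))))
                     (sym (ιᵥ-∙-Γ-matrix x v)) ⟩
    ι a L.* b L.+ ιᵥ x L#.∙ v ∎)
    where open ≡-Reasoning

  ⊥-rankSupport⁺ : ∀ {n} (x : Vec K.Carrier n) v → ιᵥ x L#.∙ v ≡ L.0# → ∀ y → rankSupport v y → y K#.∙ x ≡ K.0#
  ⊥-rankSupport⁺ x v xv≡0 _ (cs , refl) = begin
    K#.lincomb cs (columns v) K#.∙ x        ≡⟨ K′.lincomb-transpose cs (Γ-matrix v) x ⟩
    cs K#.∙ K#.lincomb x (Γ-matrix v)       ≡⟨ cong (cs K#.∙_) (independent _ (trans (sym (ιᵥ-∙-Γ-matrix x v)) xv≡0)) ⟩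
    cs K#.∙ K#.0ᵥ                           ≡⟨ K#.∙-zeroʳ cs ⟩
    K.0#                                    ∎
    where open ≡-Reasoning

  ⊥-rankSupport⁻ : ∀ {n} (x : Vec K.Carrier n) v → (∀ y → rankSupport v y → y K#.∙ x ≡ K.0#) → ιᵥ x L#.∙ v ≡ L.0#
  ⊥-rankSupport⁻ x v x⊥ = begin
    ιᵥ x L#.∙ v                                  ≡⟨ ιᵥ-∙-Γ-matrix x v ⟩
    ιᵥ (K#.lincomb x (Γ-matrix v)) L#.∙ γ        ≡⟨ cong (λ u → ιᵥ u L#.∙ γ) xM≡0 ⟩
    ιᵥ K#.0ᵥ L#.∙ γ                              ≡⟨ cong (L#._∙ γ) (ιᵥ-0 m) ⟩
    L#.0ᵥ L#.∙ γ                                 ≡⟨ L′.∙-zeroˡ γ ⟩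
    L.0#                                         ∎
    where
    open ≡-Reasoning
    xM≡0 : K#.lincomb x (Γ-matrix v) ≡ K#.0ᵥ
    xM≡0 = K′.∙-nondegenerate λ cs → trans (K′.∙-comm _ cs)
      (trans (sym (K′.lincomb-transpose cs (Γ-matrix v) x)) (x⊥ _ (cs , refl)))

  orthogonal? : ∀ {n} (v : Vec L.Carrier n) (x : Vec K.Carrier n) → Dec (ιᵥ x L#.∙ v ≡ L.0#)
  orthogonal? v x = ιᵥ x L#.∙ v L.≟ L.0#

  #orthogonal : ∀ {n} → Vec L.Carrier n → ℕ
  #orthogonal {n} v = count (orthogonal? v) (K#.vectors n)

  #orthogonal-rk : ∀ {n} (v : Vec L.Carrier n) → q ^ rk v ℕ.* #orthogonal v ≡ q ^ n
  -- This basis is the one that defines `rk v`, so `rk v` becomes `r` here and `size-annihilator`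
  -- gives the count.
  #orthogonal-rk {n} v with r , bs , (⊆bs , bs⊆) , ind ← K#.span-hasDimension (columns v) =
    trans (cong (q ^ r ℕ.*_) (count-cong (orthogonal? v) (K#.Subspace.member? (K′.annihilator bs)) (K#.vectors n)
      (λ x xv≡0 → K′.annihilator⁺ bs (K′.⊥-span bs λ y y∈ → ⊥-rankSupport⁺ x v xv≡0 y (bs⊆ y∈)))
      (λ x x∈ → ⊥-rankSupport⁻ x v λ y y∈ → K′.span-self-dual {ws = bs} (⊆bs y∈) (K′.annihilator⁻ bs x∈))))
    (K′.size-annihilator bs ind)

  -- The defining property of `Γ-matrix`, read by columns. It puts `v` into the `L`-span of its rank
  -- support.
  lincomb-columns : ∀ {n} (v : Vec L.Carrier n) → L#.lincomb γ (Vec.map ιᵥ (columns v)) ≡ v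
  lincomb-columns []      with [] ← L#.lincomb γ (Vec.map ιᵥ (columns [])) = refl
  lincomb-columns (a ∷ v) = begin
    L#.lincomb γ (Vec.map ιᵥ (columns (a ∷ v)))
      ≡⟨ cong (L#.lincomb γ ∘ Vec.map ιᵥ) (transpose-∷ (coordinates a) (Γ-matrix v)) ⟩
    L#.lincomb γ (Vec.map ιᵥ (Vec.zipWith _∷_ (coordinates a) (columns v)))
      ≡⟨ cong (L#.lincomb γ) (map-zipWith-∷ (coordinates a) (columns v)) ⟩
    L#.lincomb γ (Vec.zipWith _∷_ (ιᵥ (coordinates a)) (Vec.map ιᵥ (columns v)))
      ≡⟨ L′.lincomb-zipWith-∷ γ (ιᵥ (coordinates a)) (Vec.map ιᵥ (columns v)) ⟩
    (γ L#.∙ ιᵥ (coordinates a)) ∷ L#.lincomb γ (Vec.map ιᵥ (columns v))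
      ≡⟨ cong₂ _∷_ (trans (L′.∙-comm γ _) (proj₂ (spanning a))) (lincomb-columns v) ⟩
    a ∷ v ∎
    where
    open ≡-Reasoning
    map-zipWith-∷ : ∀ {n r} (row : Vec K.Carrier r) (ws : Vec (Vec K.Carrier n) r) →
                    Vec.map ιᵥ (Vec.zipWith _∷_ row ws) ≡ Vec.zipWith _∷_ (ιᵥ row) (Vec.map ιᵥ ws)
    map-zipWith-∷ []        []       = refl
    map-zipWith-∷ (x ∷ row) (w ∷ ws) = cong (_ ∷_) (map-zipWith-∷ row ws)

  -- The columns of `v` are written through `bs` and substituted into `lincomb-columns`. With `bs` a
  -- basis of the rank support, a word of rank `r` becomes an `L`-combination of `r` independent
  -- vectors over `K`.
  rankSupport⊆⇒span : ∀ {n r} (v : Vec L.Carrier n) (bs : Vec (Vec K.Carrier n) r) →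
                      rankSupport v ⊆ K#.Span bs → L#.Span (Vec.map ιᵥ bs) v
  rankSupport⊆⇒span v bs v⊆bs
    with ds , eq ← IndependentTuples.lincomb-closed K {bs = bs} (columns v) (λ cs → v⊆bs (cs , refl)) =
    L#.lincomb γ (Vec.map ιᵥ ds) , (begin
      L#.lincomb (L#.lincomb γ (Vec.map ιᵥ ds)) (Vec.map ιᵥ bs)
        ≡⟨ L′.lincomb-lincomb γ (Vec.map ιᵥ ds) (Vec.map ιᵥ bs) ⟨
      L#.lincomb γ (Vec.map (λ d → L#.lincomb d (Vec.map ιᵥ bs)) (Vec.map ιᵥ ds))
        ≡⟨ cong (L#.lincomb γ) (Vec.map-∘ (λ d → L#.lincomb d (Vec.map ιᵥ bs)) ιᵥ ds) ⟨
      L#.lincomb γ (Vec.map (λ d → L#.lincomb (ιᵥ d) (Vec.map ιᵥ bs)) ds)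
        ≡⟨ cong (L#.lincomb γ) (Vec.map-cong (λ d → ιᵥ-lincomb d bs) ds) ⟨
      L#.lincomb γ (Vec.map (λ d → ιᵥ (K#.lincomb d bs)) ds)
        ≡⟨ cong (L#.lincomb γ) (Vec.map-∘ ιᵥ (λ d → K#.lincomb d bs) ds) ⟩
      L#.lincomb γ (Vec.map ιᵥ (Vec.map (λ d → K#.lincomb d bs) ds))
        ≡⟨ cong (L#.lincomb γ ∘ Vec.map ιᵥ) eq ⟩
      L#.lincomb γ (Vec.map ιᵥ (columns v))
        ≡⟨ lincomb-columns v ⟩
      v ∎)
    where open ≡-Reasoning

  -- If `x` has zero functional on `C`, it is orthogonal to the rank support of each codeword, hence
  -- to their sum, which is the whole space. Nondegeneracy enters the proof through this alone.
  nondegenerate⇒faithful : ∀ {n} (C : L#.Subspace n) → RankNondegenerate C →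
                           ∀ {x : Vec K.Carrier n} → L′.Vanishes C (ιᵥ x) → x ≡ K#.0ᵥ
  nondegenerate⇒faithful C nondeg {x} x⊥ = K′.∙-nondegenerate λ y → trans (K′.∙-comm x y) (sum⊥ (nondeg y))
    where
    sum⊥ : ∀ {y} → SumOfSupports C y → y K#.∙ x ≡ K.0#
    sum⊥ zero = K′.∙-zeroˡ x
    sum⊥ (add {v} {y} {z} v∈ y∈ z∈) = trans (K′.∙-distribʳ y z x)
      (trans (cong₂ K._+_ (⊥-rankSupport⁺ x v (x⊥ v v∈) y y∈) (sum⊥ z∈)) (K.+-identityˡ K.0#))

-- The first two moments of the number of orthogonal vectors

module Moments
  {q m : ℕ} {{primePower : PrimePower q}} {K : FiniteField q} {L : FiniteField (q ^ m)} {E : FieldExtension K L}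
  (Γ : OrderedBasis E m) {n k : ℕ} (C : LinearAlgebra.Subspace L n)
  (dimension : LinearAlgebra.HasDimension L (LinearAlgebra.Subspace.Member C) k)
  (nondegenerate : RankMetric.RankNondegenerate Γ C)
  where

  private
    module K  = FiniteField K
    module L  = FiniteField L
    module K# = LinearAlgebra K
    module L# = LinearAlgebra L
    module K′ = FiniteLinearAlgebra K
    module L′ = FiniteLinearAlgebra L
  open FieldExtension E
  open ExtensionOfScalars E
  open RankMetric Γ
  open RankSupport Γ
  open L#.Subspace C using (Member; member?)
  open L′ using (size; _∩ker_; Vanishes)

  Q M : ℕ
  Q = q ^ m
  M = q ^ (m ℕ.* k)

  #nonzero : ℕ
  #nonzero = count (¬? ∘ (K#._≟ᵥ K#.0ᵥ)) (K#.vectors n)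

  size-code : size C ≡ M
  size-code = trans (L′.count-basis member? (proj₁ dimension) (proj₂ dimension)) (ℕ.^-*-assoc q m k)

  kernel₁ : Vec K.Carrier n → L#.Subspace n
  kernel₁ x = C ∩ker ιᵥ x

  kernel₂ : Vec K.Carrier n → Vec K.Carrier n → L#.Subspace n
  kernel₂ x y = kernel₁ x ∩ker ιᵥ y

  ι0-vanishes : ∀ (V : L#.Subspace n) → Vanishes V (ιᵥ K#.0ᵥ)
  ι0-vanishes V v _ = trans (cong (L#._∙ v) (ιᵥ-0 n)) (L′.∙-zeroˡ v)

  size-kernel₁-0 : size (kernel₁ K#.0ᵥ) ≡ M
  size-kernel₁-0 = trans (L′.size-∩ker-vanishing C (ιᵥ K#.0ᵥ) (ι0-vanishes C)) size-code

  size-kernel₁ : ∀ {x} → x ≢ K#.0ᵥ → Q ℕ.* size (kernel₁ x) ≡ M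
  size-kernel₁ {x} x≢0 = trans (L′.¬vanishes⇒order*size C (ιᵥ x) λ x⊥ → x≢0 (nondegenerate⇒faithful C nondegenerate x⊥)) size-code

  -- The first two conditions make `x` and `y` independent over `K`. By `separation`, the third says
  -- that on `C` the functional of `y` is an `L`-multiple of that of `x`; vanishing on the kernel is
  -- the form that decides the size of `kernel₂ x y`.
  Bad : Vec K.Carrier n → Vec K.Carrier n → Set
  Bad x y = x ≢ K#.0ᵥ × ¬ K#.Span (x ∷ []) y × Vanishes (kernel₁ x) (ιᵥ y)

  bad? : ∀ x y → Dec (Bad x y)
  bad? x y = ¬? (x K#.≟ᵥ K#.0ᵥ) ×-dec ¬? (K#.span? (x ∷ []) y) ×-dec L′.vanishes? (kernel₁ x) (ιᵥ y)

  #bad : ℕ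
  #bad = ∑[ x ∈ K#.vectors n ] ∑[ y ∈ K#.vectors n ] 𝟙 (bad? x y)

  -- Q² · size (kernel₂ x y) is M · weight x y unless (x , y) is bad, when it is M · Q.
  weightOf : {X Y Z : Set} → Dec X → Dec Y → Dec Z → ℕ
  weightOf x≡0? y≡0? y∈? = if does x≡0? then (if does y≡0? then Q ℕ.* Q else Q) else (if does y∈? then Q else 1)

  weight : Vec K.Carrier n → Vec K.Carrier n → ℕ
  weight x y = weightOf (x K#.≟ᵥ K#.0ᵥ) (y K#.≟ᵥ K#.0ᵥ) (K#.span? (x ∷ []) y)

  Q≡suc : Q ≡ suc (ℕ.pred Q)
  Q≡suc = sym (ℕ.suc-pred Q {{ℕ.m^n≢0 q m {{primePower⇒nonZero primePower}}}})

  span-vanishes : ∀ {x y} → K#.Span (x ∷ []) y → Vanishes (kernel₁ x) (ιᵥ y)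
  span-vanishes {x} (c ∷ [] , refl) v (_ , xv≡0) = trans (cong (L#._∙ v) (ιᵥ-lincomb (c ∷ []) (x ∷ [])))
    (trans (L′.lincomb-∙ (ι c ∷ []) (ιᵥ x ∷ []) v)
           (trans (cong (λ s → (ι c ∷ []) L#.∙ (s ∷ [])) xv≡0) (L#.∙-zeroʳ (ι c ∷ []))))

  -- Each of the two kernels either keeps the size or divides it by `Q`, and the factor `Q ℕ.* Q`
  -- clears both divisions.
  size-kernel₂ : ∀ x y → Q ℕ.* Q ℕ.* size (kernel₂ x y) ≡ M ℕ.* (weight x y ℕ.+ ℕ.pred Q ℕ.* 𝟙 (bad? x y))
  size-kernel₂ x y = go x (x K#.≟ᵥ K#.0ᵥ) (y K#.≟ᵥ K#.0ᵥ) (K#.span? (x ∷ []) y) (L′.vanishes? (kernel₁ x) (ιᵥ y))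
    where
    open ≡-Reasoning
    factor : ∀ s t p → t ℕ.* s ≡ s ℕ.* (t ℕ.+ p ℕ.* 0)
    factor = solve-∀
    factor-suc : ∀ s p → suc p ℕ.* s ≡ s ℕ.* (1 ℕ.+ p ℕ.* 1)
    factor-suc = solve-∀
    kernel₂-0 : size (kernel₂ K#.0ᵥ y) ≡ size (kernel₁ y)
    kernel₂-0 = count-cong (L#.Subspace.member? (kernel₂ K#.0ᵥ y)) (L#.Subspace.member? (kernel₁ y)) (L#.vectors n)
      (λ v ((v∈ , _) , yv≡0) → v∈ , yv≡0) (λ v (v∈ , yv≡0) → (v∈ , ι0-vanishes C v v∈) , yv≡0)
    kernel₂-vanishing : ∀ {x} → x ≢ K#.0ᵥ → Vanishes (kernel₁ x) (ιᵥ y) → Q ℕ.* Q ℕ.* size (kernel₂ x y) ≡ Q ℕ.* M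
    kernel₂-vanishing {x} x≢0 y⊥ = trans (ℕ.*-assoc Q Q _)
      (cong (Q ℕ.*_) (trans (cong (Q ℕ.*_) (L′.size-∩ker-vanishing (kernel₁ x) (ιᵥ y) y⊥)) (size-kernel₁ x≢0)))
    go : ∀ x (x≡0? : Dec (x ≡ K#.0ᵥ)) (y≡0? : Dec (y ≡ K#.0ᵥ)) (y∈? : Dec (K#.Span (x ∷ []) y))
         (y⊥? : Dec (Vanishes (kernel₁ x) (ιᵥ y))) →
         Q ℕ.* Q ℕ.* size (kernel₂ x y)
         ≡ M ℕ.* (weightOf x≡0? y≡0? y∈? ℕ.+ ℕ.pred Q ℕ.* 𝟙 (¬? x≡0? ×-dec ¬? y∈? ×-dec y⊥?))
    go _ (yes refl) (yes refl) _ _ = trans (cong (Q ℕ.* Q ℕ.*_) (trans kernel₂-0 size-kernel₁-0)) (factor M (Q ℕ.* Q) (ℕ.pred Q))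
    go _ (yes refl) (no y≢0) _ _ = trans (cong (Q ℕ.* Q ℕ.*_) kernel₂-0)
      (trans (ℕ.*-assoc Q Q _) (trans (cong (Q ℕ.*_) (size-kernel₁ y≢0)) (factor M Q (ℕ.pred Q))))
    go x (no x≢0) _ (yes y∈) _ = trans (kernel₂-vanishing x≢0 (span-vanishes y∈)) (factor M Q (ℕ.pred Q))
    -- The bad case: the second kernel does not shrink although the weight is `1`, and `ℕ.pred Q` is
    -- what `1` lacks to `Q`.
    go x (no x≢0) _ (no _) (yes y⊥) = trans (kernel₂-vanishing x≢0 y⊥)
      (trans (cong (ℕ._* M) Q≡suc) (factor-suc M (ℕ.pred Q)))
    go x (no x≢0) _ (no _) (no ¬y⊥) = begin
      Q ℕ.* Q ℕ.* size (kernel₂ x y)       ≡⟨ ℕ.*-assoc Q Q _ ⟩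
      Q ℕ.* (Q ℕ.* size (kernel₂ x y))     ≡⟨ cong (Q ℕ.*_) (L′.¬vanishes⇒order*size (kernel₁ x) (ιᵥ y) ¬y⊥) ⟩
      Q ℕ.* size (kernel₁ x)               ≡⟨ size-kernel₁ x≢0 ⟩
      M                                    ≡⟨ ℕ.*-identityˡ M ⟨
      1 ℕ.* M                              ≡⟨ factor M 1 (ℕ.pred Q) ⟩
      M ℕ.* (1 ℕ.+ ℕ.pred Q ℕ.* 0)         ∎

  -- The zero pair has weight `Q ℕ.* Q`, and a nonzero `y` next to a zero `x` has weight `Q`. For
  -- each nonzero `x` there are `q` multiples `y` of weight `Q` and `q ^ n ℕ.∸ q` other vectors of
  -- weight `1`.
  ∑-weight : ∑[ x ∈ K#.vectors n ] ∑[ y ∈ K#.vectors n ] weight x y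
             ≡ Q ℕ.* Q ℕ.+ #nonzero ℕ.* Q ℕ.+ #nonzero ℕ.* (q ℕ.* Q ℕ.+ (q ^ n ℕ.∸ q))
  ∑-weight = begin
    ∑[ x ∈ K#.vectors n ] ∑[ y ∈ K#.vectors n ] weight x y
      ≡⟨ sumOver-split-const (K#._≟ᵥ K#.0ᵥ) (K#.vectors n) _ (λ { _ refl → atZero }) awayFromZero ⟩
    count (K#._≟ᵥ K#.0ᵥ) (K#.vectors n) ℕ.* (Q ℕ.* Q ℕ.+ #nonzero ℕ.* Q) ℕ.+ #nonzero ℕ.* (q ℕ.* Q ℕ.+ (q ^ n ℕ.∸ q))
      ≡⟨ cong (λ s → s ℕ.* (Q ℕ.* Q ℕ.+ #nonzero ℕ.* Q) ℕ.+ #nonzero ℕ.* (q ℕ.* Q ℕ.+ (q ^ n ℕ.∸ q))) (K′.count-≡0 n) ⟩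
    1 ℕ.* (Q ℕ.* Q ℕ.+ #nonzero ℕ.* Q) ℕ.+ #nonzero ℕ.* (q ℕ.* Q ℕ.+ (q ^ n ℕ.∸ q))
      ≡⟨ cong (ℕ._+ #nonzero ℕ.* (q ℕ.* Q ℕ.+ (q ^ n ℕ.∸ q))) (ℕ.*-identityˡ (Q ℕ.* Q ℕ.+ #nonzero ℕ.* Q)) ⟩
    Q ℕ.* Q ℕ.+ #nonzero ℕ.* Q ℕ.+ #nonzero ℕ.* (q ℕ.* Q ℕ.+ (q ^ n ℕ.∸ q)) ∎
    where
    open ≡-Reasoning
    if-yes : ∀ {P : Set} (P? : Dec P) {a b : ℕ} → P → (if does P? then a else b) ≡ a
    if-yes (yes _) _ = refl
    if-yes (no ¬p) p = contradiction p ¬p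
    if-no : ∀ {P : Set} (P? : Dec P) {a b : ℕ} → ¬ P → (if does P? then a else b) ≡ b
    if-no (yes p) ¬p = contradiction p ¬p
    if-no (no _)  _  = refl
    atZero : ∑[ y ∈ K#.vectors n ] weight K#.0ᵥ y ≡ Q ℕ.* Q ℕ.+ #nonzero ℕ.* Q
    atZero = trans (sumOver-split-const (K#._≟ᵥ K#.0ᵥ) (K#.vectors n) (weight K#.0ᵥ)
      (λ y y≡0 → trans (if-yes (K#.0ᵥ {n} K#.≟ᵥ K#.0ᵥ) refl) (if-yes (y K#.≟ᵥ K#.0ᵥ) y≡0))
      (λ y y≢0 → trans (if-yes (K#.0ᵥ {n} K#.≟ᵥ K#.0ᵥ) refl) (if-no (y K#.≟ᵥ K#.0ᵥ) y≢0)))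
      (cong (ℕ._+ #nonzero ℕ.* Q) (trans (cong (ℕ._* (Q ℕ.* Q)) (K′.count-≡0 n)) (ℕ.*-identityˡ (Q ℕ.* Q))))
    awayFromZero : ∀ x → x ≢ K#.0ᵥ → ∑[ y ∈ K#.vectors n ] weight x y ≡ q ℕ.* Q ℕ.+ (q ^ n ℕ.∸ q)
    awayFromZero x x≢0 = trans (sumOver-split-const (K#.span? (x ∷ [])) (K#.vectors n) (weight x)
      (λ y y∈ → trans (if-no (x K#.≟ᵥ K#.0ᵥ) x≢0) (if-yes (K#.span? (x ∷ []) y) y∈))
      (λ y y∉ → trans (if-no (x K#.≟ᵥ K#.0ᵥ) x≢0) (if-no (K#.span? (x ∷ []) y) y∉)))
      (cong₂ ℕ._+_
        (cong (ℕ._* Q) (trans (K′.count-span (x ∷ []) (K′.span-singleton x≢0)) (ℕ.*-identityʳ q)))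
        (trans (ℕ.*-identityʳ _) (trans (sym (ℕ.m+n∸m≡n q _)) (cong (ℕ._∸ q) (K′.count-∉span x≢0)))))

  -- Runs over all of `C`, the zero word included, so that exchanging sums yields sizes of
  -- subspaces; `nonzeroCodewords-sum` takes that word out again.
  codewordSum : (Vec L.Carrier n → ℕ) → ℕ
  codewordSum g = ∑[ v ∈ L#.vectors n ] (𝟙 (member? v) ℕ.* g v)

  codewordSum-#orthogonal : codewordSum #orthogonal ≡ ∑[ x ∈ K#.vectors n ] size (kernel₁ x)
  codewordSum-#orthogonal = begin
    ∑[ v ∈ L#.vectors n ] (𝟙 (member? v) ℕ.* #orthogonal v)
      ≡⟨ sumOver-cong (L#.vectors n) (λ v → trans (cong (𝟙 (member? v) ℕ.*_) (count≡sum (orthogonal? v) (K#.vectors n)))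
           (sym (sumOver-*ˡ (K#.vectors n) (𝟙 (member? v)) (λ x → 𝟙 (orthogonal? v x))))) ⟩
    ∑[ v ∈ L#.vectors n ] ∑[ x ∈ K#.vectors n ] (𝟙 (member? v) ℕ.* 𝟙 (orthogonal? v x))
      ≡⟨ sumOver-swap (L#.vectors n) (K#.vectors n) (λ v x → 𝟙 (member? v) ℕ.* 𝟙 (orthogonal? v x)) ⟩
    ∑[ x ∈ K#.vectors n ] ∑[ v ∈ L#.vectors n ] (𝟙 (member? v) ℕ.* 𝟙 (orthogonal? v x))
      ≡⟨ sumOver-cong (K#.vectors n) (λ x → trans (count≡sum (L#.Subspace.member? (kernel₁ x)) (L#.vectors n))
           (sumOver-cong (L#.vectors n) λ v → 𝟙-× (member? v) (orthogonal? v x))) ⟨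
    ∑[ x ∈ K#.vectors n ] size (kernel₁ x) ∎
    where open ≡-Reasoning

  firstMoment : Q ℕ.* codewordSum #orthogonal ≡ Q ℕ.* M ℕ.+ #nonzero ℕ.* M
  firstMoment = begin
    Q ℕ.* codewordSum #orthogonal
      ≡⟨ cong (Q ℕ.*_) codewordSum-#orthogonal ⟩
    Q ℕ.* (∑[ x ∈ K#.vectors n ] size (kernel₁ x))
      ≡⟨ sumOver-*ˡ (K#.vectors n) Q (λ x → size (kernel₁ x)) ⟨
    ∑[ x ∈ K#.vectors n ] (Q ℕ.* size (kernel₁ x))
      ≡⟨ sumOver-split-const (K#._≟ᵥ K#.0ᵥ) (K#.vectors n) _
           (λ { _ refl → cong (Q ℕ.*_) size-kernel₁-0 }) (λ _ → size-kernel₁) ⟩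
    count (K#._≟ᵥ K#.0ᵥ) (K#.vectors n) ℕ.* (Q ℕ.* M) ℕ.+ #nonzero ℕ.* M
      ≡⟨ cong (ℕ._+ #nonzero ℕ.* M) (trans (cong (ℕ._* (Q ℕ.* M)) (K′.count-≡0 n)) (ℕ.*-identityˡ (Q ℕ.* M))) ⟩
    Q ℕ.* M ℕ.+ #nonzero ℕ.* M ∎
    where open ≡-Reasoning

  codewordSum-#orthogonal² : codewordSum (λ v → #orthogonal v ℕ.* #orthogonal v)
                           ≡ ∑[ x ∈ K#.vectors n ] ∑[ y ∈ K#.vectors n ] size (kernel₂ x y)
  codewordSum-#orthogonal² = begin
    ∑[ v ∈ L#.vectors n ] (𝟙 (member? v) ℕ.* (#orthogonal v ℕ.* #orthogonal v))
      ≡⟨ sumOver-cong (L#.vectors n) expand ⟩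
    ∑[ v ∈ L#.vectors n ] ∑[ x ∈ K#.vectors n ] ∑[ y ∈ K#.vectors n ] term v x y
      ≡⟨ sumOver-swap (L#.vectors n) (K#.vectors n) (λ v x → ∑[ y ∈ K#.vectors n ] term v x y) ⟩
    ∑[ x ∈ K#.vectors n ] ∑[ v ∈ L#.vectors n ] ∑[ y ∈ K#.vectors n ] term v x y
      ≡⟨ sumOver-cong (K#.vectors n) (λ x → sumOver-swap (L#.vectors n) (K#.vectors n) (λ v y → term v x y)) ⟩
    ∑[ x ∈ K#.vectors n ] ∑[ y ∈ K#.vectors n ] ∑[ v ∈ L#.vectors n ] term v x y
      ≡⟨ sumOver-cong (K#.vectors n) (λ x → sumOver-cong (K#.vectors n) λ y →
           trans (count≡sum (L#.Subspace.member? (kernel₂ x y)) (L#.vectors n)) (sumOver-cong (L#.vectors n) λ v →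
             trans (𝟙-× (member? v ×-dec orthogonal? v x) (orthogonal? v y))
                   (cong (ℕ._* 𝟙 (orthogonal? v y)) (𝟙-× (member? v) (orthogonal? v x))))) ⟨
    ∑[ x ∈ K#.vectors n ] ∑[ y ∈ K#.vectors n ] size (kernel₂ x y) ∎
    where
    open ≡-Reasoning
    term : Vec L.Carrier n → Vec K.Carrier n → Vec K.Carrier n → ℕ
    term v x y = 𝟙 (member? v) ℕ.* 𝟙 (orthogonal? v x) ℕ.* 𝟙 (orthogonal? v y)
    expand : ∀ v → 𝟙 (member? v) ℕ.* (#orthogonal v ℕ.* #orthogonal v)
                 ≡ ∑[ x ∈ K#.vectors n ] ∑[ y ∈ K#.vectors n ] term v x y
    expand v = sym (begin
      ∑[ x ∈ K#.vectors n ] ∑[ y ∈ K#.vectors n ] term v x y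
        ≡⟨ sumOver-cong (K#.vectors n) (λ x → trans (sumOver-*ˡ (K#.vectors n) (𝟙 (member? v) ℕ.* 𝟙 (orthogonal? v x)) (λ y → 𝟙 (orthogonal? v y)))
             (cong (𝟙 (member? v) ℕ.* 𝟙 (orthogonal? v x) ℕ.*_) (sym (count≡sum (orthogonal? v) (K#.vectors n))))) ⟩
      ∑[ x ∈ K#.vectors n ] (𝟙 (member? v) ℕ.* 𝟙 (orthogonal? v x) ℕ.* #orthogonal v)
        ≡⟨ sumOver-*ʳ (K#.vectors n) (λ x → 𝟙 (member? v) ℕ.* 𝟙 (orthogonal? v x)) (#orthogonal v) ⟩
      (∑[ x ∈ K#.vectors n ] (𝟙 (member? v) ℕ.* 𝟙 (orthogonal? v x))) ℕ.* #orthogonal v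
        ≡⟨ cong (ℕ._* #orthogonal v) (trans (sumOver-*ˡ (K#.vectors n) (𝟙 (member? v)) (λ x → 𝟙 (orthogonal? v x)))
             (cong (𝟙 (member? v) ℕ.*_) (sym (count≡sum (orthogonal? v) (K#.vectors n))))) ⟩
      𝟙 (member? v) ℕ.* #orthogonal v ℕ.* #orthogonal v
        ≡⟨ ℕ.*-assoc (𝟙 (member? v)) _ _ ⟩
      𝟙 (member? v) ℕ.* (#orthogonal v ℕ.* #orthogonal v) ∎)

  secondMoment : Q ℕ.* Q ℕ.* codewordSum (λ v → #orthogonal v ℕ.* #orthogonal v)
    ≡ M ℕ.* (Q ℕ.* Q ℕ.+ #nonzero ℕ.* Q ℕ.+ #nonzero ℕ.* (q ℕ.* Q ℕ.+ (q ^ n ℕ.∸ q)) ℕ.+ ℕ.pred Q ℕ.* #bad)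
  secondMoment = begin
    Q ℕ.* Q ℕ.* codewordSum (λ v → #orthogonal v ℕ.* #orthogonal v)
      ≡⟨ cong (Q ℕ.* Q ℕ.*_) codewordSum-#orthogonal² ⟩
    Q ℕ.* Q ℕ.* (∑[ x ∈ K#.vectors n ] ∑[ y ∈ K#.vectors n ] size (kernel₂ x y))
      ≡⟨ double-*ˡ (Q ℕ.* Q) (λ x y → size (kernel₂ x y)) ⟩
    ∑[ x ∈ K#.vectors n ] ∑[ y ∈ K#.vectors n ] (Q ℕ.* Q ℕ.* size (kernel₂ x y))
      ≡⟨ sumOver-cong (K#.vectors n) (λ x → sumOver-cong (K#.vectors n) (size-kernel₂ x)) ⟩
    ∑[ x ∈ K#.vectors n ] ∑[ y ∈ K#.vectors n ] (M ℕ.* (weight x y ℕ.+ ℕ.pred Q ℕ.* 𝟙 (bad? x y)))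
      ≡⟨ double-*ˡ M (λ x y → weight x y ℕ.+ ℕ.pred Q ℕ.* 𝟙 (bad? x y)) ⟨
    M ℕ.* (∑[ x ∈ K#.vectors n ] ∑[ y ∈ K#.vectors n ] (weight x y ℕ.+ ℕ.pred Q ℕ.* 𝟙 (bad? x y)))
      ≡⟨ cong (M ℕ.*_) (trans
           (sumOver-cong (K#.vectors n) λ x → sumOver-+ (K#.vectors n) (weight x) (λ y → ℕ.pred Q ℕ.* 𝟙 (bad? x y)))
           (sumOver-+ (K#.vectors n) (λ x → sumOver (K#.vectors n) (weight x)) _)) ⟩
    M ℕ.* ((∑[ x ∈ K#.vectors n ] ∑[ y ∈ K#.vectors n ] weight x y)
           ℕ.+ (∑[ x ∈ K#.vectors n ] ∑[ y ∈ K#.vectors n ] (ℕ.pred Q ℕ.* 𝟙 (bad? x y))))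
      ≡⟨ cong (M ℕ.*_) (cong₂ ℕ._+_ ∑-weight (sym (double-*ˡ (ℕ.pred Q) (λ x y → 𝟙 (bad? x y))))) ⟩
    M ℕ.* (Q ℕ.* Q ℕ.+ #nonzero ℕ.* Q ℕ.+ #nonzero ℕ.* (q ℕ.* Q ℕ.+ (q ^ n ℕ.∸ q)) ℕ.+ ℕ.pred Q ℕ.* #bad) ∎
    where
    open ≡-Reasoning
    double-*ˡ : ∀ a (g : Vec K.Carrier n → Vec K.Carrier n → ℕ) →
      a ℕ.* (∑[ x ∈ K#.vectors n ] ∑[ y ∈ K#.vectors n ] g x y) ≡ ∑[ x ∈ K#.vectors n ] ∑[ y ∈ K#.vectors n ] (a ℕ.* g x y)
    double-*ˡ a g = sym (trans (sumOver-cong (K#.vectors n) λ x → sumOver-*ˡ (K#.vectors n) a (g x))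
                               (sumOver-*ˡ (K#.vectors n) a _))

  nonzeroCodewords-sum : ∀ g → sumOver (nonzeroCodewords C) g ℕ.+ g L#.0ᵥ ≡ codewordSum g
  nonzeroCodewords-sum g = begin
    sumOver (nonzeroCodewords C) g ℕ.+ g L#.0ᵥ
      ≡⟨ cong₂ ℕ._+_ (sumOver-filter (λ v → member? v ×-dec ¬? (v L#.≟ᵥ L#.0ᵥ)) (L#.vectors n) g) (sym atZero) ⟩
    (∑[ v ∈ L#.vectors n ] (𝟙 (member? v ×-dec ¬? (v L#.≟ᵥ L#.0ᵥ)) ℕ.* g v)) ℕ.+ (∑[ v ∈ L#.vectors n ] (𝟙 (v L#.≟ᵥ L#.0ᵥ) ℕ.* g v))
      ≡⟨ sumOver-+ (L#.vectors n) _ _ ⟨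
    ∑[ v ∈ L#.vectors n ] (𝟙 (member? v ×-dec ¬? (v L#.≟ᵥ L#.0ᵥ)) ℕ.* g v ℕ.+ 𝟙 (v L#.≟ᵥ L#.0ᵥ) ℕ.* g v)
      ≡⟨ sumOver-cong (L#.vectors n) (λ v → merge v (v L#.≟ᵥ L#.0ᵥ)) ⟩
    codewordSum g ∎
    where
    open ≡-Reasoning
    atZero : ∑[ v ∈ L#.vectors n ] (𝟙 (v L#.≟ᵥ L#.0ᵥ) ℕ.* g v) ≡ g L#.0ᵥ
    atZero = begin
      ∑[ v ∈ L#.vectors n ] (𝟙 (v L#.≟ᵥ L#.0ᵥ) ℕ.* g v)      ≡⟨ sumOver-cong (L#.vectors n) (λ v → concentrate v (v L#.≟ᵥ L#.0ᵥ)) ⟩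
      ∑[ v ∈ L#.vectors n ] (𝟙 (v L#.≟ᵥ L#.0ᵥ) ℕ.* g L#.0ᵥ)  ≡⟨ sumOver-*ʳ (L#.vectors n) (λ v → 𝟙 (v L#.≟ᵥ L#.0ᵥ)) (g L#.0ᵥ) ⟩
      (∑[ v ∈ L#.vectors n ] 𝟙 (v L#.≟ᵥ L#.0ᵥ)) ℕ.* g L#.0ᵥ  ≡⟨ cong (ℕ._* g L#.0ᵥ) (trans (sym (count≡sum (L#._≟ᵥ L#.0ᵥ) (L#.vectors n))) (L′.count-≡0 n)) ⟩
      1 ℕ.* g L#.0ᵥ                                          ≡⟨ ℕ.*-identityˡ _ ⟩
      g L#.0ᵥ                                                ∎
      where
      concentrate : ∀ v (v? : Dec (v ≡ L#.0ᵥ)) → 𝟙 v? ℕ.* g v ≡ 𝟙 v? ℕ.* g L#.0ᵥ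
      concentrate v (yes refl) = refl
      concentrate v (no _)     = refl
    merge : ∀ v (v? : Dec (v ≡ L#.0ᵥ)) → 𝟙 (member? v ×-dec ¬? v?) ℕ.* g v ℕ.+ 𝟙 v? ℕ.* g v ≡ 𝟙 (member? v) ℕ.* g v
    merge v (yes refl) = cong₂ (λ s t → s ℕ.* g v ℕ.+ t)
      (trans (𝟙-× (member? v) (¬? (yes (refl {x = L#.0ᵥ {n}})))) (ℕ.*-zeroʳ (𝟙 (member? v))))
      (cong (ℕ._* g v) (sym (𝟙-true (member? v) (L#.Subspace.0-closed C))))
    merge v (no v≢0) = trans (ℕ.+-identityʳ _)
      (cong (ℕ._* g v) (trans (𝟙-× (member? v) (¬? (no v≢0))) (ℕ.*-identityʳ (𝟙 (member? v)))))

  length-nonzeroCodewords : suc (length (nonzeroCodewords C)) ≡ M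
  length-nonzeroCodewords = begin
    suc (length (nonzeroCodewords C))               ≡⟨ ℕ.+-comm 1 _ ⟩
    length (nonzeroCodewords C) ℕ.+ 1               ≡⟨ cong (ℕ._+ 1) (trans (sumOver-const (nonzeroCodewords C) 1) (ℕ.*-identityʳ _)) ⟨
    sumOver (nonzeroCodewords C) (λ _ → 1) ℕ.+ 1    ≡⟨ nonzeroCodewords-sum (λ _ → 1) ⟩
    codewordSum (λ _ → 1)                           ≡⟨ sumOver-cong (L#.vectors n) (λ v → ℕ.*-identityʳ (𝟙 (member? v))) ⟩
    ∑[ v ∈ L#.vectors n ] 𝟙 (member? v)             ≡⟨ count≡sum member? (L#.vectors n) ⟨
    size C                                          ≡⟨ size-code ⟩
    M                                               ∎
    where open ≡-Reasoning

  -- Removing the zero word from the two moments therefore costs q^n and q^(2n), the negative terms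
  -- of the theorem.
  #orthogonal-0 : #orthogonal (L#.0ᵥ {n}) ≡ q ^ n
  #orthogonal-0 = trans (cong length (List.filter-all (orthogonal? L#.0ᵥ) (All.universal (λ x → L#.∙-zeroʳ (ιᵥ x)) (K#.vectors n))))
                        (K′.length-vectors n)

-- Bad pairs and dual words of rank at most two

minimumOr-≤ : ∀ a {x xs} → x ∈ xs → minimumOr a xs ℕ.≤ x
minimumOr-≤ a {xs = y List.∷ ys} (here refl) = min≤⊤ y ys
minimumOr-≤ a {xs = y List.∷ ys} (there x∈)  = All.lookup (min≤xs y ys) x∈

≤-minimumOr : ∀ {d a} xs → d ℕ.≤ a → (∀ {x} → x ∈ xs → d ℕ.≤ x) → d ℕ.≤ minimumOr a xs
≤-minimumOr List.[]       d≤a _   = d≤a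
≤-minimumOr (x List.∷ xs) _   d≤ = v≤min⁺ (d≤ (here refl)) (All.tabulate (d≤ ∘ there))

module RankTwo
  {q m : ℕ} {{primePower : PrimePower q}} {K : FiniteField q} {L : FiniteField (q ^ m)} {E : FieldExtension K L}
  (Γ : OrderedBasis E m) {n k : ℕ} (C : LinearAlgebra.Subspace L n)
  (dimension : LinearAlgebra.HasDimension L (LinearAlgebra.Subspace.Member C) k)
  (nondegenerate : RankMetric.RankNondegenerate Γ C)
  where

  private
    module K  = FiniteField K
    module L  = FiniteField L
    module K# = LinearAlgebra K
    module L# = LinearAlgebra L
    module K′ = FiniteLinearAlgebra K
    module L′ = FiniteLinearAlgebra L
  open FieldExtension E
  open ExtensionOfScalars E
  open RankMetric Γ
  open RankSupport Γ
  open Moments Γ C dimension nondegenerate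
  open L#.Subspace C using (Member; member?)
  open L′ using (Vanishes; _∩ker_)

  #bad≡0⇒¬bad : #bad ≡ 0 → ∀ x y → ¬ Bad x y
  #bad≡0⇒¬bad eq x y = 𝟙≡0⇒¬ (bad? x y) (sumOver≡0 {f = λ y → 𝟙 (bad? x y)} (K#.∈-vectors y)
    (sumOver≡0 {f = λ x → ∑[ y ∈ K#.vectors n ] 𝟙 (bad? x y)} (K#.∈-vectors x) eq))

  ¬bad⇒#bad≡0 : (∀ x y → ¬ Bad x y) → #bad ≡ 0
  ¬bad⇒#bad≡0 ¬bad = trans (sumOver-cong (K#.vectors n) λ x →
    trans (sumOver-cong (K#.vectors n) λ y → 𝟙-false (bad? x y) (¬bad x y)) zeros) zeros
    where
    zeros : ∑[ x ∈ K#.vectors n ] 0 ≡ 0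
    zeros = trans (sumOver-const (K#.vectors n) 0) (ℕ.*-zeroʳ (length (K#.vectors n)))

  -- #orthogonal turns an inclusion of orthogonal complements into a bound on the rank.
  rk≤ : ∀ {r} (v : Vec L.Carrier n) (bs : Vec (Vec K.Carrier n) r) → K#.LinearlyIndependent bs →
        (∀ x → Vec.map (K#._∙ x) bs ≡ K#.0ᵥ → ιᵥ x L#.∙ v ≡ L.0#) → rk v ℕ.≤ r
  rk≤ {r} v bs ind bs⊥⇒v⊥ = ℕ.≮⇒≥ λ r<rk → ℕ.<-irrefl refl (begin-strict
    q ^ n                          ≡⟨ K′.size-annihilator bs ind ⟨
    q ^ r ℕ.* A                    <⟨ ℕ.*-monoˡ-< A {{ℕ.≢-nonZero A≢0}} (ℕ.^-monoʳ-< q (1<primePower primePower) r<rk) ⟩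
    q ^ rk v ℕ.* A                 ≤⟨ ℕ.*-monoʳ-≤ (q ^ rk v) (count-mono (K#.Subspace.member? (K′.annihilator bs)) (orthogonal? v) (K#.vectors n)
                                        λ x x∈ → bs⊥⇒v⊥ x (K′.annihilator⁻ bs x∈)) ⟩
    q ^ rk v ℕ.* #orthogonal v     ≡⟨ #orthogonal-rk v ⟩
    q ^ n                          ∎)
    where
    open ℕ.≤-Reasoning
    A = K′.size (K′.annihilator bs)
    A≢0 : A ≢ 0
    A≢0 A≡0 = ℕ.≢-nonZero⁻¹ (q ^ n) {{ℕ.m^n≢0 q n {{primePower⇒nonZero primePower}}}}
      (trans (sym (K′.size-annihilator bs ind)) (trans (cong (q ^ r ℕ.*_) A≡0) (ℕ.*-zeroʳ (q ^ r))))

  nonzero-dual : ∀ {w} → w ∈ nonzeroCodewords (L#.dual C) → L#.Subspace.Member (L#.dual C) w × w ≢ L#.0ᵥ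
  nonzero-dual w∈ = proj₂ (∈-filter⁻ (λ v → L#.Subspace.member? (L#.dual C) v ×-dec ¬? (v L#.≟ᵥ L#.0ᵥ)) {xs = L#.vectors n} w∈)

  -- `separation` writes the functional of `y` on `C` as that of a multiple `z` of `ιᵥ x`, so the
  -- difference of `ιᵥ y` and `z` lies in the dual. Every vector over `K` orthogonal to `x` and `y`
  -- is orthogonal to this difference, and `rk≤` bounds its rank.
  bad⇒dual-word : ∀ {x y} → Bad x y → ∃ λ w → w ∈ nonzeroCodewords (L#.dual C) × rk w ℕ.≤ 2
  bad⇒dual-word {x} {y} (x≢0 , y∉ , y⊥) with L′.separation C (ιᵥ x ∷ []) (ιᵥ y)
    (λ v v∈ x⊥v → y⊥ v (v∈ , Vec.∷-injectiveˡ x⊥v))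
  ... | cs , y≡ = w , ∈-filter⁺ (λ v → L#.Subspace.member? (L#.dual C) v ×-dec ¬? (v L#.≟ᵥ L#.0ᵥ)) (L#.∈-vectors w) (w∈ , w≢0)
                , rk≤ w (y ∷ x ∷ []) (K#.extend-independent (K′.span-singleton x≢0) y∉) ⊥w
    where
    open ≡-Reasoning
    z = L#.lincomb cs (ιᵥ x ∷ [])
    w = (L.- L.1#) L#.· z L#.⊕ ιᵥ y
    ∙w : ∀ u → u L#.∙ w ≡ (L.- L.1#) L.* (u L#.∙ z) L.+ u L#.∙ ιᵥ y
    ∙w u = trans (L#.∙-distribˡ u _ (ιᵥ y)) (cong (L._+ u L#.∙ ιᵥ y) (L#.∙-·ʳ u _ z))
    ∙z : ∀ u → u L#.∙ ιᵥ x ≡ L.0# → u L#.∙ z ≡ L.0#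
    ∙z u ux≡0 = trans (L′.∙-comm u z) (trans (L′.lincomb-∙ cs (ιᵥ x ∷ []) u)
      (trans (cong (λ s → cs L#.∙ (s ∷ [])) (trans (L′.∙-comm (ιᵥ x) u) ux≡0)) (L#.∙-zeroʳ cs)))
    w∈ : L#.Subspace.Member (L#.dual C) w
    w∈ u u∈ = begin
      u L#.∙ w                                     ≡⟨ L′.∙-comm u w ⟩
      w L#.∙ u                                     ≡⟨ L′.∙-distribʳ ((L.- L.1#) L#.· z) (ιᵥ y) u ⟩
      ((L.- L.1#) L#.· z) L#.∙ u L.+ ιᵥ y L#.∙ u   ≡⟨ cong (((L.- L.1#) L#.· z) L#.∙ u L.+_) (y≡ u u∈) ⟩
      ((L.- L.1#) L#.· z) L#.∙ u L.+ z L#.∙ u      ≡⟨ L′.∙-distribʳ ((L.- L.1#) L#.· z) z u ⟨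
      ((L.- L.1#) L#.· z L#.⊕ z) L#.∙ u            ≡⟨ cong (L#._∙ u) (L#.⊕-inverse z) ⟩
      L#.0ᵥ L#.∙ u                                 ≡⟨ L′.∙-zeroˡ u ⟩
      L.0#                                         ∎
    ⊥w : ∀ t → Vec.map (K#._∙ t) (y ∷ x ∷ []) ≡ K#.0ᵥ → ιᵥ t L#.∙ w ≡ L.0#
    ⊥w t t⊥ = begin
      ιᵥ t L#.∙ w                                              ≡⟨ ∙w (ιᵥ t) ⟩
      (L.- L.1#) L.* (ιᵥ t L#.∙ z) L.+ ιᵥ t L#.∙ ιᵥ y          ≡⟨ cong₂ (λ a b → (L.- L.1#) L.* a L.+ b)
                                                                    (∙z (ιᵥ t) (ι⊥ x (Vec.∷-injectiveˡ (Vec.∷-injectiveʳ t⊥))))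
                                                                    (ι⊥ y (Vec.∷-injectiveˡ t⊥)) ⟩
      (L.- L.1#) L.* L.0# L.+ L.0#                             ≡⟨ trans (L.+-identityʳ _) (L.zeroʳ (L.- L.1#)) ⟩
      L.0#                                                     ∎
      where
      ι⊥ : ∀ s → s K#.∙ t ≡ K.0# → ιᵥ t L#.∙ ιᵥ s ≡ L.0#
      ι⊥ s st≡0 = trans (ιᵥ-∙ t s) (trans (cong ι (trans (K′.∙-comm t s) st≡0)) 0#-homo)
    w≢0 : w ≢ L#.0ᵥ
    -- The factor of `ιᵥ x` in `z` lies in `L`, so the descent to `K` goes through duality: if `w`
    -- is zero, every `t` over `K` orthogonal to `x` is orthogonal to `y`, and `⊥⊥⇒span` over `K`
    -- puts `y` into the span of `x`.
    w≢0 w≡0 = y∉ (K′.⊥⊥⇒span (x ∷ []) λ t xt → ι-kernel (begin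
      ι (y K#.∙ t)                                              ≡⟨ cong ι (K′.∙-comm y t) ⟩
      ι (t K#.∙ y)                                              ≡⟨ ιᵥ-∙ t y ⟨
      ιᵥ t L#.∙ ιᵥ y                                            ≡⟨ L.+-identityˡ _ ⟨
      L.0# L.+ ιᵥ t L#.∙ ιᵥ y                                   ≡⟨ cong (L._+ ιᵥ t L#.∙ ιᵥ y) (L.zeroʳ (L.- L.1#)) ⟨
      (L.- L.1#) L.* L.0# L.+ ιᵥ t L#.∙ ιᵥ y                    ≡⟨ cong (λ a → (L.- L.1#) L.* a L.+ ιᵥ t L#.∙ ιᵥ y)
                                                                     (∙z (ιᵥ t) (trans (ιᵥ-∙ t x) (trans (cong ι (trans (K′.∙-comm t x) (Vec.∷-injectiveˡ xt))) 0#-homo))) ⟨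
      (L.- L.1#) L.* (ιᵥ t L#.∙ z) L.+ ιᵥ t L#.∙ ιᵥ y           ≡⟨ ∙w (ιᵥ t) ⟨
      ιᵥ t L#.∙ w                                               ≡⟨ cong (ιᵥ t L#.∙_) w≡0 ⟩
      ιᵥ t L#.∙ L#.0ᵥ                                           ≡⟨ L#.∙-zeroʳ (ιᵥ t) ⟩
      L.0#                                                      ∎))

  -- Excludes dual words of rank one: for nonzero `a` the functional of `x` itself would vanish on
  -- `C`, which forces `x` to be zero.
  multiple-in-dual : ∀ a x → L#.Subspace.Member (L#.dual C) (a L#.· ιᵥ x) → a L#.· ιᵥ x ≡ L#.0ᵥ
  multiple-in-dual a x ax∈ with a L.≟ L.0#
  ... | yes refl = L#.0· (ιᵥ x)
  ... | no a≢0 = trans (cong (λ x → a L#.· ιᵥ x) (nondegenerate⇒faithful C nondegenerate x⊥))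
                       (trans (cong (a L#.·_) (ιᵥ-0 n)) (L#.·0 n a))
    where
    x⊥ : Vanishes C (ιᵥ x)
    x⊥ v v∈ = L′.*-zero-cancel a≢0 (trans (sym (L′.∙-·ˡ a (ιᵥ x) v)) (trans (L′.∙-comm _ v) (ax∈ v v∈)))

  -- Used with a basis of the rank support of `w`, so that `r` is its rank. A single basis vector is
  -- excluded by `multiple-in-dual`. For two, a zero first coefficient leads back to that case, and
  -- a nonzero one makes `ιᵥ y` vanish wherever `ιᵥ x` does on `C`, which is a bad pair.
  dual-word-length : ∀ {r w} (bs : Vec (Vec K.Carrier n) r) → K#.LinearlyIndependent bs → L#.Span (Vec.map ιᵥ bs) w →
                     L#.Subspace.Member (L#.dual C) w → w ≢ L#.0ᵥ → (∀ x y → ¬ Bad x y) → 3 ℕ.≤ r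
  dual-word-length [] _ ([] , 0≡w) _ w≢0 _ = contradiction (sym 0≡w) w≢0
  dual-word-length (x ∷ []) _ (a ∷ [] , refl) w∈ w≢0 _ =
    contradiction (trans w≡ (multiple-in-dual a x (subst (L#.Subspace.Member (L#.dual C)) w≡ w∈))) w≢0
    where
    w≡ : a L#.· ιᵥ x L#.⊕ L#.0ᵥ ≡ a L#.· ιᵥ x
    w≡ = trans (L#.⊕-comm _ L#.0ᵥ) (L#.⊕-identityˡ _)
  dual-word-length (y ∷ x ∷ []) ind (a ∷ b ∷ [] , refl) w∈ w≢0 ¬bad with a L.≟ L.0#
  ... | yes refl = contradiction (trans w≡ (multiple-in-dual b x (subst (L#.Subspace.Member (L#.dual C)) w≡ w∈))) w≢0
    where
    w≡ : L.0# L#.· ιᵥ y L#.⊕ (b L#.· ιᵥ x L#.⊕ L#.0ᵥ) ≡ b L#.· ιᵥ x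
    w≡ = trans (cong₂ L#._⊕_ (L#.0· (ιᵥ y)) (trans (L#.⊕-comm _ L#.0ᵥ) (L#.⊕-identityˡ _))) (L#.⊕-identityˡ _)
  ... | no a≢0 = contradiction (x≢0 , K′.independent-head ind , y⊥) (¬bad x y)
    where
    open ≡-Reasoning
    w = L#.lincomb (a ∷ b ∷ []) (ιᵥ y ∷ ιᵥ x ∷ [])
    x≢0 : x ≢ K#.0ᵥ
    x≢0 x≡0 = K′.independent-head (K′.independent-tail ind) ([] , sym x≡0)
    y⊥ : Vanishes (kernel₁ x) (ιᵥ y)
    y⊥ v (v∈ , xv≡0) = L′.*-zero-cancel a≢0 (begin
      a L.* (ιᵥ y L#.∙ v)                                                  ≡⟨ L.+-identityʳ _ ⟨
      a L.* (ιᵥ y L#.∙ v) L.+ L.0#                                         ≡⟨ cong (a L.* (ιᵥ y L#.∙ v) L.+_) (trans (L.+-identityʳ _) (L.zeroʳ b)) ⟨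
      (a ∷ b ∷ []) L#.∙ (ιᵥ y L#.∙ v ∷ L.0# ∷ [])                          ≡⟨ cong (λ s → (a ∷ b ∷ []) L#.∙ (ιᵥ y L#.∙ v ∷ s ∷ [])) xv≡0 ⟨
      (a ∷ b ∷ []) L#.∙ Vec.map (L#._∙ v) (ιᵥ y ∷ ιᵥ x ∷ [])               ≡⟨ L′.lincomb-∙ (a ∷ b ∷ []) (ιᵥ y ∷ ιᵥ x ∷ []) v ⟨
      w L#.∙ v                                                             ≡⟨ L′.∙-comm w v ⟩
      v L#.∙ w                                                             ≡⟨ w∈ v v∈ ⟩
      L.0#                                                                 ∎)
  dual-word-length (_ ∷ _ ∷ _ ∷ _) _ _ _ _ _ = s≤s (s≤s (s≤s z≤n))

  rank2⇔¬bad : 2 ℕ.≤ n → Rank2Nondegenerate C ⇔ (∀ x y → ¬ Bad x y)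
  rank2⇔¬bad 2≤n = mk⇔
    (λ 3≤d x y bad → let w , w∈ , rk≤2 = bad⇒dual-word bad in
      ℕ.<⇒≱ (s≤s rk≤2) (ℕ.≤-trans 3≤d (minimumOr-≤ (suc n) (∈-map⁺ rk w∈))))
    -- `s≤s 2≤n` covers the zero dual code, whose minimum distance is `suc n` by convention.
    (λ ¬bad → ≤-minimumOr _ (s≤s 2≤n) λ r∈ → 3≤rank ¬bad (∈-map⁻ rk r∈))
    where
    3≤rank : (∀ x y → ¬ Bad x y) → ∀ {r} → (∃ λ w → w ∈ nonzeroCodewords (L#.dual C) × r ≡ rk w) → 3 ℕ.≤ r
    3≤rank ¬bad (w , w∈ , refl)
      with w∈dual , w≢0 ← nonzero-dual w∈
      with r , bs , (⊆bs , _) , ind ← K#.span-hasDimension (columns w)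
      = dual-word-length bs ind (rankSupport⊆⇒span w bs ⊆bs) w∈dual w≢0 ¬bad

  rank2⇔#bad≡0 : 2 ℕ.≤ n → (#bad ≡ 0) ⇔ Rank2Nondegenerate C
  rank2⇔#bad≡0 2≤n = mk⇔ (λ eq → from (#bad≡0⇒¬bad eq)) (λ r2 → ¬bad⇒#bad≡0 (to r2))
    where open Equivalence (rank2⇔¬bad 2≤n)

open import Data.Integer.Base as ℤ using (+_; _⊖_)
import Data.Integer.Properties as ℤ
open import Data.Rational.Base
  using (ℚ; 0ℚ; 1ℚ; _/_; 1/_; toℚᵘ; _+_; _-_; _*_; -_; _÷_; _≤_)
import Data.Rational.Base as ℚ
import Data.Rational.Properties as ℚ
import Data.Rational.Unnormalised.Base as ℚᵘ
import Data.Rational.Unnormalised.Properties as ℚᵘ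
import Tactic.RingSolver as RingSolver
open import Tactic.RingSolver.Core.AlmostCommutativeRing using (AlmostCommutativeRing; fromCommutativeRing)

-- Rational arithmetic

ℚ-ring : AlmostCommutativeRing 0ℓ 0ℓ
ℚ-ring = fromCommutativeRing ℚ.+-*-commutativeRing λ p → dec⇒maybe (0ℚ ℚ.≟ p)

toℚᵘ-fromℕ : ∀ a → toℚᵘ (fromℕ a) ℚᵘ.≃ ℚᵘ.mkℚᵘ (+ a) 0
toℚᵘ-fromℕ a = ℚ.toℚᵘ-fromℚᵘ (ℚᵘ.mkℚᵘ (+ a) 0)

fromℕ-+ : ∀ a b → fromℕ (a ℕ.+ b) ≡ fromℕ a + fromℕ b
fromℕ-+ a b = ℚ.toℚᵘ-injective (begin
  toℚᵘ (fromℕ (a ℕ.+ b))                       ≈⟨ toℚᵘ-fromℕ (a ℕ.+ b) ⟩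
  ℚᵘ.mkℚᵘ (+ (a ℕ.+ b)) 0                      ≡⟨ cong (λ z → ℚᵘ.mkℚᵘ z 0) (sym (cong₂ ℤ._+_ (ℤ.*-identityʳ (+ a)) (ℤ.*-identityʳ (+ b)))) ⟩
  ℚᵘ.mkℚᵘ (+ a) 0 ℚᵘ.+ ℚᵘ.mkℚᵘ (+ b) 0         ≈⟨ ℚᵘ.+-cong (toℚᵘ-fromℕ a) (toℚᵘ-fromℕ b) ⟨
  toℚᵘ (fromℕ a) ℚᵘ.+ toℚᵘ (fromℕ b)           ≈⟨ ℚ.toℚᵘ-homo-+ (fromℕ a) (fromℕ b) ⟨
  toℚᵘ (fromℕ a + fromℕ b)                     ∎)
  where open ℚᵘ.≃-Reasoning

fromℕ-* : ∀ a b → fromℕ (a ℕ.* b) ≡ fromℕ a * fromℕ b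
fromℕ-* a b = ℚ.toℚᵘ-injective (begin
  toℚᵘ (fromℕ (a ℕ.* b))                       ≈⟨ toℚᵘ-fromℕ (a ℕ.* b) ⟩
  ℚᵘ.mkℚᵘ (+ (a ℕ.* b)) 0                      ≡⟨ cong (λ z → ℚᵘ.mkℚᵘ z 0) (ℤ.pos-* a b) ⟩
  ℚᵘ.mkℚᵘ (+ a) 0 ℚᵘ.* ℚᵘ.mkℚᵘ (+ b) 0         ≈⟨ ℚᵘ.*-cong (toℚᵘ-fromℕ a) (toℚᵘ-fromℕ b) ⟨
  toℚᵘ (fromℕ a) ℚᵘ.* toℚᵘ (fromℕ b)           ≈⟨ ℚ.toℚᵘ-homo-* (fromℕ a) (fromℕ b) ⟨
  toℚᵘ (fromℕ a * fromℕ b)                     ∎)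
  where open ℚᵘ.≃-Reasoning

fromℕ-injective : ∀ {a b} → fromℕ a ≡ fromℕ b → a ≡ b
fromℕ-injective {a} {b} eq with ℚ./-injective-≃ (ℚᵘ.mkℚᵘ (+ a) 0) (ℚᵘ.mkℚᵘ (+ b) 0) eq
... | ℚᵘ.*≡* e = ℤ.+-injective (ℤ.*-cancelʳ-≡ (+ a) (+ b) (+ 1) e)

unit-fraction : ∀ a .{{_ : ℕ.NonZero a}} → ((+ 1) / a) * fromℕ a ≡ 1ℚ
unit-fraction (suc a) = ℚ.toℚᵘ-injective (begin
  toℚᵘ (((+ 1) / suc a) * fromℕ (suc a))                ≈⟨ ℚ.toℚᵘ-homo-* ((+ 1) / suc a) (fromℕ (suc a)) ⟩
  toℚᵘ ((+ 1) / suc a) ℚᵘ.* toℚᵘ (fromℕ (suc a))        ≈⟨ ℚᵘ.*-cong (ℚ.toℚᵘ-fromℚᵘ (ℚᵘ.mkℚᵘ (+ 1) a)) (toℚᵘ-fromℕ (suc a)) ⟩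
  ℚᵘ.mkℚᵘ (+ 1) a ℚᵘ.* ℚᵘ.mkℚᵘ (+ suc a) 0              ≈⟨ ℚᵘ.*≡* (cong +_ (trans (ℕ.*-identityʳ (1 ℕ.* suc a)) (cong (1 ℕ.*_) (sym (ℕ.*-identityʳ (suc a)))))) ⟩
  ℚᵘ.1ℚᵘ                                                ∎)
  where open ℚᵘ.≃-Reasoning

*-cancelʳ-fromℕ : ∀ {x y} a .{{_ : ℕ.NonZero a}} → x * fromℕ a ≡ y * fromℕ a → x ≡ y
*-cancelʳ-fromℕ {x} {y} a eq = trans (sym (undo x)) (trans (cong (_* ((+ 1) / a)) eq) (undo y))
  where
  undo : ∀ z → z * fromℕ a * ((+ 1) / a) ≡ z
  undo z = trans (ℚ.*-assoc z (fromℕ a) ((+ 1) / a))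
    (trans (cong (z *_) (trans (ℚ.*-comm (fromℕ a) ((+ 1) / a)) (unit-fraction a))) (ℚ.*-identityʳ z))

-- Clears a possibly negative power, as it occurs in `f` for `k = 1` and `ν = 2`. Common factors `q`
-- are peeled off until one of the exponents is zero, where the power computes.
^ᶻ-⊖ : ∀ {q} {{_ : PrimePower q}} a b → q ^ᶻ (a ⊖ b) * fromℕ (q ^ b) ≡ fromℕ (q ^ a)
^ᶻ-⊖ zero    zero = refl
^ᶻ-⊖ {q} {{P}} zero    (suc b) = unit-fraction (q ^ suc b) {{ℕ.m^n≢0 q (suc b) {{primePower⇒nonZero P}}}}
^ᶻ-⊖ {q} (suc a) zero    = ℚ.*-identityʳ (fromℕ (q ^ suc a))
^ᶻ-⊖ {q} (suc a) (suc b) = begin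
  q ^ᶻ (suc a ⊖ suc b) * fromℕ (q ^ suc b)      ≡⟨ cong₂ (λ z x → q ^ᶻ z * x) (ℤ.[1+m]⊖[1+n]≡m⊖n a b) (fromℕ-* q (q ^ b)) ⟩
  q ^ᶻ (a ⊖ b) * (fromℕ q * fromℕ (q ^ b))      ≡⟨ shuffle (q ^ᶻ (a ⊖ b)) (fromℕ q) (fromℕ (q ^ b)) ⟩
  fromℕ q * (q ^ᶻ (a ⊖ b) * fromℕ (q ^ b))      ≡⟨ cong (fromℕ q *_) (^ᶻ-⊖ a b) ⟩
  fromℕ q * fromℕ (q ^ a)                       ≡⟨ fromℕ-* q (q ^ a) ⟨
  fromℕ (q ^ suc a)                             ∎
  where
  open ≡-Reasoning
  shuffle : ∀ x y z → x * (y * z) ≡ y * (x * z)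
  shuffle = RingSolver.solve-∀ ℚ-ring

^ᶻ-*-minus : ∀ {q} {{_ : PrimePower q}} m k ν → q ^ᶻ (+ m ℤ.* (+ k ℤ.- + ν)) * fromℕ (q ^ (m ℕ.* ν)) ≡ fromℕ (q ^ (m ℕ.* k))
^ᶻ-*-minus {q} m k ν = trans (cong (λ z → q ^ᶻ z * fromℕ (q ^ (m ℕ.* ν))) exponent) (^ᶻ-⊖ (m ℕ.* k) (m ℕ.* ν))
  where
  open ≡-Reasoning
  exponent : + m ℤ.* (+ k ℤ.- + ν) ≡ m ℕ.* k ⊖ m ℕ.* ν
  exponent = begin
    + m ℤ.* (+ k ℤ.- + ν)                 ≡⟨ ℤ.*-distribˡ-+ (+ m) (+ k) (ℤ.- + ν) ⟩
    + m ℤ.* + k ℤ.+ + m ℤ.* (ℤ.- + ν)     ≡⟨ cong (λ z → + m ℤ.* + k ℤ.+ z) (ℤ.neg-distribʳ-* (+ m) (+ ν)) ⟨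
    + m ℤ.* + k ℤ.- + m ℤ.* + ν           ≡⟨ cong₂ ℤ._-_ (ℤ.pos-* m k) (ℤ.pos-* m ν) ⟨
    + (m ℕ.* k) ℤ.- + (m ℕ.* ν)           ≡⟨ ℤ.m-n≡m⊖n (m ℕ.* k) (m ℕ.* ν) ⟩
    m ℕ.* k ⊖ m ℕ.* ν                     ∎

average-* : ∀ xs → average xs * fromℕ (length xs) ≡ ∑ xs
average-* List.[]         = refl
average-* (x List.∷ xs) = begin
  ∑ (x List.∷ xs) * ((+ 1) / suc (length xs)) * fromℕ (suc (length xs))     ≡⟨ ℚ.*-assoc (∑ (x List.∷ xs)) ((+ 1) / suc (length xs)) _ ⟩
  ∑ (x List.∷ xs) * (((+ 1) / suc (length xs)) * fromℕ (suc (length xs)))   ≡⟨ cong (∑ (x List.∷ xs) *_) (unit-fraction (suc (length xs))) ⟩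
  ∑ (x List.∷ xs) * 1ℚ                                                      ≡⟨ ℚ.*-identityʳ _ ⟩
  ∑ (x List.∷ xs)                                                           ∎
  where open ≡-Reasoning

∑-fromℕ : ∀ {A : Set} (xs : List A) {g : A → ℚ} {h : A → ℕ} → (∀ x → g x ≡ fromℕ (h x)) →
          ∑ (List.map g xs) ≡ fromℕ (sumOver xs h)
∑-fromℕ List.[]       _  = refl
∑-fromℕ (x List.∷ xs) {h = h} eq = trans (cong₂ _+_ (eq x) (∑-fromℕ xs eq)) (sym (fromℕ-+ (h x) _))

-- The centre `μ` is arbitrary because the mean of the list would change along the induction.
∑-square-deviation : ∀ {A : Set} (xs : List A) (g : A → ℚ) μ →
  ∑ (List.map (λ x → (g x - μ) * (g x - μ)) xs)
  ≡ ∑ (List.map (λ x → g x * g x) xs) - (μ + μ) * ∑ (List.map g xs) + fromℕ (length xs) * (μ * μ)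
∑-square-deviation List.[] g μ = base μ
  where
  base : ∀ μ → 0ℚ ≡ 0ℚ - (μ + μ) * 0ℚ + 0ℚ * (μ * μ)
  base = RingSolver.solve-∀ ℚ-ring
∑-square-deviation (x List.∷ xs) g μ = begin
  (g x - μ) * (g x - μ) + ∑ (List.map (λ x → (g x - μ) * (g x - μ)) xs)
    ≡⟨ cong (λ s → (g x - μ) * (g x - μ) + s) (∑-square-deviation xs g μ) ⟩
  (g x - μ) * (g x - μ) + (∑ (List.map (λ x → g x * g x) xs) - (μ + μ) * ∑ (List.map g xs) + fromℕ (length xs) * (μ * μ))
    ≡⟨ step (g x) μ (∑ (List.map (λ x → g x * g x) xs)) (∑ (List.map g xs)) (fromℕ (length xs)) ⟩
  g x * g x + ∑ (List.map (λ x → g x * g x) xs) - (μ + μ) * (g x + ∑ (List.map g xs)) + (1ℚ + fromℕ (length xs)) * (μ * μ)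
    ≡⟨ cong (λ l → g x * g x + ∑ (List.map (λ x → g x * g x) xs) - (μ + μ) * (g x + ∑ (List.map g xs)) + l * (μ * μ)) (fromℕ-+ 1 (length xs)) ⟨
  g x * g x + ∑ (List.map (λ x → g x * g x) xs) - (μ + μ) * (g x + ∑ (List.map g xs)) + fromℕ (suc (length xs)) * (μ * μ) ∎
  where
  open ≡-Reasoning
  step : ∀ a μ s t l → (a - μ) * (a - μ) + (s - (μ + μ) * t + l * (μ * μ))
                     ≡ a * a + s - (μ + μ) * (a + t) + (1ℚ + l) * (μ * μ)
  step = RingSolver.solve-∀ ℚ-ring

÷-unique : ∀ {x y d} .{{_ : ℚ.NonZero d}} → x * d ≡ y → x ≡ y ÷ d
÷-unique {x} {_} {d} refl = sym (trans (ℚ.*-assoc x d (1/ d)) (trans (cong (x *_) (ℚ.*-inverseʳ d)) (ℚ.*-identityʳ x)))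

÷-* : ∀ x d .{{_ : ℚ.NonZero d}} → (x ÷ d) * d ≡ x
÷-* x d = trans (ℚ.*-assoc x (1/ d) d) (trans (cong (x *_) (ℚ.*-inverseˡ d)) (ℚ.*-identityʳ x))

-- Reads an inequality and its equality case off one identity: after scaling by the positive `w`,
-- the gap between `x` and `y` is the natural number `e`.
excess : ∀ {x y} w .{{_ : ℕ.NonZero w}} e → x * fromℕ w ≡ y * fromℕ w + fromℕ e → y ≤ x × ((x ≡ y) ⇔ (e ≡ 0))
excess {x} {y} w e eq =
  ℚ.*-cancelʳ-≤-pos (fromℕ w) {{ℚ.normalize-pos w 1}} (begin
    y * fromℕ w              ≡⟨ ℚ.+-identityʳ _ ⟨
    y * fromℕ w + 0ℚ         ≤⟨ ℚ.+-monoʳ-≤ (y * fromℕ w) (ℚ.nonNegative⁻¹ (fromℕ e) {{ℚ.normalize-nonNeg e 1}}) ⟩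
    y * fromℕ w + fromℕ e    ≡⟨ eq ⟨
    x * fromℕ w              ∎) ,
  mk⇔ (λ { refl → fromℕ-injective (cancel (sym eq)) })
      (λ { refl → *-cancelʳ-fromℕ w (trans eq (ℚ.+-identityʳ _)) })
  where
  open ℚ.≤-Reasoning
  cancel : ∀ {a b} → a + b ≡ a → b ≡ 0ℚ
  cancel {a} {b} p = trans (shift a b) (trans (cong (_- a) p) (ℚ.+-inverseʳ a))
    where
    shift : ∀ a b → b ≡ a + b - a
    shift = RingSolver.solve-∀ ℚ-ring

-- Gaussian binomials in ℚ and the closed form of f

module GaussianBinomials {q} {{primePower : PrimePower q}} (K : FiniteField q) where

  open LinearAlgebra K using (gaussianBinomial)
  open IndependentTuples K

  private
    q̂ : ℚ
    q̂ = fromℕ q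

  independent-one : ∀ n → fromℕ (#independent n 1) ≡ fromℕ (q ^ n) - 1ℚ
  independent-one n = trans (shift (fromℕ (#independent n 1)))
    (cong (_- 1ℚ) (trans (sym (fromℕ-+ (#independent n 1) 1)) (cong fromℕ (#independent-one n))))
    where
    shift : ∀ a → a ≡ a + 1ℚ - 1ℚ
    shift = RingSolver.solve-∀ ℚ-ring

  independent-two : ∀ n → fromℕ (#independent n 2) ≡ (fromℕ (q ^ n) - 1ℚ) * (fromℕ (q ^ n) - q̂)
  independent-two n = begin
    fromℕ (#independent n 2)
      ≡⟨ shift (fromℕ (#independent n 2)) i₁ q̂ ⟩
    fromℕ (#independent n 2) + i₁ * q̂ - i₁ * q̂
      ≡⟨ cong (λ s → fromℕ (#independent n 2) + s - i₁ * q̂) (fromℕ-* (#independent n 1) q) ⟨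
    fromℕ (#independent n 2) + fromℕ (#independent n 1 ℕ.* q) - i₁ * q̂
      ≡⟨ cong (_- i₁ * q̂) (fromℕ-+ (#independent n 2) (#independent n 1 ℕ.* q)) ⟨
    fromℕ (#independent n 2 ℕ.+ #independent n 1 ℕ.* q) - i₁ * q̂
      ≡⟨ cong (λ s → fromℕ s - i₁ * q̂) (#independent-two n) ⟩
    fromℕ (#independent n 1 ℕ.* q ^ n) - i₁ * q̂
      ≡⟨ cong (_- i₁ * q̂) (fromℕ-* (#independent n 1) (q ^ n)) ⟩
    i₁ * fromℕ (q ^ n) - i₁ * q̂
      ≡⟨ factor i₁ (fromℕ (q ^ n)) q̂ ⟩
    i₁ * (fromℕ (q ^ n) - q̂)
      ≡⟨ cong (_* (fromℕ (q ^ n) - q̂)) (independent-one n) ⟩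
    (fromℕ (q ^ n) - 1ℚ) * (fromℕ (q ^ n) - q̂) ∎
    where
    open ≡-Reasoning
    i₁ = fromℕ (#independent n 1)
    shift : ∀ a b c → a ≡ a + b * c - b * c
    shift = RingSolver.solve-∀ ℚ-ring
    factor : ∀ a b c → a * b - a * c ≡ a * (b - c)
    factor = RingSolver.solve-∀ ℚ-ring

  gaussianBinomial-one : ∀ n → fromℕ (gaussianBinomial n 1) * (fromℕ (q ^ 1) - 1ℚ) ≡ fromℕ (q ^ n) - 1ℚ
  gaussianBinomial-one n = trans (cong (fromℕ (gaussianBinomial n 1) *_) (sym (independent-one 1)))
    (trans (sym (fromℕ-* (gaussianBinomial n 1) (#independent 1 1)))
           (trans (cong fromℕ (gaussianBinomial-independent n 1)) (independent-one n)))

  -- The factor on the left is, up to `q ^ 1 ≡ q`, the product that `fTerm` contains for `ν = 2`, so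
  -- the denominator of the binomial cancels there.
  gaussianBinomial-two : ∀ n → fromℕ (gaussianBinomial n 2) * ((fromℕ (q ^ 2) - 1ℚ) * (fromℕ (q ^ 2) - q̂))
                             ≡ (fromℕ (q ^ n) - 1ℚ) * (fromℕ (q ^ n) - q̂)
  gaussianBinomial-two n = trans (cong (fromℕ (gaussianBinomial n 2) *_) (sym (independent-two 2)))
    (trans (sym (fromℕ-* (gaussianBinomial n 2) (#independent 2 2)))
           (trans (cong fromℕ (gaussianBinomial-independent n 2)) (independent-two n)))

  fTerm-zero : ∀ n m k → fTerm K n m k 0 2 0 ≡ fromℕ (q ^ (m ℕ.* k))
  fTerm-zero n m k = begin
    A * fromℕ (gaussianBinomial n 0) * fromℕ (gaussianBinomial 2 0) * 1ℚ
      ≡⟨ cong₂ (λ a b → A * fromℕ a * fromℕ b * 1ℚ) (gaussianBinomial-zero n) (gaussianBinomial-zero 2) ⟩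
    A * 1ℚ * 1ℚ * 1ℚ
      ≡⟨ simplify A ⟩
    A * 1ℚ
      ≡⟨ cong (λ e → A * fromℕ (q ^ e)) (ℕ.*-zeroʳ m) ⟨
    A * fromℕ (q ^ (m ℕ.* 0))
      ≡⟨ ^ᶻ-*-minus m k 0 ⟩
    fromℕ (q ^ (m ℕ.* k)) ∎
    where
    open ≡-Reasoning
    A = q ^ᶻ (+ m ℤ.* (+ k ℤ.- + 0))
    simplify : ∀ a → a * 1ℚ * 1ℚ * 1ℚ ≡ a * 1ℚ
    simplify = RingSolver.solve-∀ ℚ-ring

  fTerm-one : ∀ n m k → fTerm K n m k 0 2 1 * fromℕ (q ^ (m ℕ.* 1))
                      ≡ fromℕ (q ^ (m ℕ.* k)) * (fromℕ (q ^ n) - 1ℚ) * (q̂ + 1ℚ)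
  fTerm-one n m k = begin
    A * g * fromℕ (gaussianBinomial 2 1) * ((fromℕ (q ^ 1) - 1ℚ) * 1ℚ) * Q
      ≡⟨ cong (λ b → A * g * b * ((fromℕ (q ^ 1) - 1ℚ) * 1ℚ) * Q)
           (trans (cong fromℕ (gaussianBinomial-two-one (1<primePower primePower))) (fromℕ-+ q 1)) ⟩
    A * g * (q̂ + 1ℚ) * ((fromℕ (q ^ 1) - 1ℚ) * 1ℚ) * Q
      ≡⟨ rearrange A g (q̂ + 1ℚ) (fromℕ (q ^ 1) - 1ℚ) Q ⟩
    (A * Q) * (g * (fromℕ (q ^ 1) - 1ℚ)) * (q̂ + 1ℚ)
      ≡⟨ cong₂ (λ a b → a * b * (q̂ + 1ℚ)) (^ᶻ-*-minus m k 1) (gaussianBinomial-one n) ⟩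
    fromℕ (q ^ (m ℕ.* k)) * (fromℕ (q ^ n) - 1ℚ) * (q̂ + 1ℚ) ∎
    where
    open ≡-Reasoning
    A = q ^ᶻ (+ m ℤ.* (+ k ℤ.- + 1))
    g = fromℕ (gaussianBinomial n 1)
    Q = fromℕ (q ^ (m ℕ.* 1))
    rearrange : ∀ a g h p Q → a * g * h * (p * 1ℚ) * Q ≡ (a * Q) * (g * p) * h
    rearrange = RingSolver.solve-∀ ℚ-ring

  fTerm-two : ∀ n m k → fTerm K n m k 0 2 2 * fromℕ (q ^ (m ℕ.* 2))
                      ≡ fromℕ (q ^ (m ℕ.* k)) * ((fromℕ (q ^ n) - 1ℚ) * (fromℕ (q ^ n) - q̂))
  fTerm-two n m k = begin
    A * g * fromℕ (gaussianBinomial 2 2) * ((fromℕ (q ^ 2) - 1ℚ) * ((fromℕ (q ^ 2) - fromℕ (q ^ 1)) * 1ℚ)) * Q²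
      ≡⟨ cong₂ (λ b e → A * g * fromℕ b * ((fromℕ (q ^ 2) - 1ℚ) * ((fromℕ (q ^ 2) - fromℕ e) * 1ℚ)) * Q²)
           (gaussianBinomial-self (1<primePower primePower) 2) (ℕ.*-identityʳ q) ⟩
    A * g * 1ℚ * ((fromℕ (q ^ 2) - 1ℚ) * ((fromℕ (q ^ 2) - q̂) * 1ℚ)) * Q²
      ≡⟨ rearrange A g (fromℕ (q ^ 2) - 1ℚ) (fromℕ (q ^ 2) - q̂) Q² ⟩
    (A * Q²) * (g * ((fromℕ (q ^ 2) - 1ℚ) * (fromℕ (q ^ 2) - q̂)))
      ≡⟨ cong₂ _*_ (^ᶻ-*-minus m k 2) (gaussianBinomial-two n) ⟩
    fromℕ (q ^ (m ℕ.* k)) * ((fromℕ (q ^ n) - 1ℚ) * (fromℕ (q ^ n) - q̂)) ∎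
    where
    open ≡-Reasoning
    A = q ^ᶻ (+ m ℤ.* (+ k ℤ.- + 2))
    g = fromℕ (gaussianBinomial n 2)
    Q² = fromℕ (q ^ (m ℕ.* 2))
    rearrange : ∀ a g p r Q → a * g * 1ℚ * (p * (r * 1ℚ)) * Q ≡ (a * Q) * (g * (p * r))
    rearrange = RingSolver.solve-∀ ℚ-ring

  -- The coefficients 1, (q^n - 1)(q + 1) and (q^n - 1)(q^n - q) are the numbers of ordered pairs in
  -- Kⁿ whose span has dimension 0, 1 and 2. The bracket is the total of `∑-weight`, sorted by
  -- powers of `Q`.
  f-0-2 : ∀ n m k → f K n m k 0 2 * (fromℕ (q ^ m) * fromℕ (q ^ m))
        ≡ fromℕ (q ^ (m ℕ.* k)) * (fromℕ (q ^ m) * fromℕ (q ^ m)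
            + (fromℕ (q ^ n) - 1ℚ) * (q̂ + 1ℚ) * fromℕ (q ^ m) + (fromℕ (q ^ n) - 1ℚ) * (fromℕ (q ^ n) - q̂))
  f-0-2 n m k = begin
    (fTerm K n m k 0 2 0 + (t₁ + (t₂ + 0ℚ))) * (Q * Q)
      ≡⟨ expand (fTerm K n m k 0 2 0) t₁ t₂ Q ⟩
    fTerm K n m k 0 2 0 * (Q * Q) + t₁ * Q * Q + t₂ * (Q * Q)
      ≡⟨ cong₂ _+_ (cong₂ _+_ (cong (_* (Q * Q)) (fTerm-zero n m k)) (cong (_* Q) t₁*Q)) t₂*Q² ⟩
    M * (Q * Q) + M * (N - 1ℚ) * (q̂ + 1ℚ) * Q + M * ((N - 1ℚ) * (N - q̂))
      ≡⟨ factor M Q (N - 1ℚ) (q̂ + 1ℚ) (N - q̂) ⟩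
    M * (Q * Q + (N - 1ℚ) * (q̂ + 1ℚ) * Q + (N - 1ℚ) * (N - q̂)) ∎
    where
    open ≡-Reasoning
    Q = fromℕ (q ^ m)
    M = fromℕ (q ^ (m ℕ.* k))
    N = fromℕ (q ^ n)
    t₁ = fTerm K n m k 0 2 1
    t₂ = fTerm K n m k 0 2 2
    t₁*Q : t₁ * Q ≡ M * (N - 1ℚ) * (q̂ + 1ℚ)
    t₁*Q = trans (cong (λ e → t₁ * fromℕ (q ^ e)) (sym (ℕ.*-identityʳ m))) (fTerm-one n m k)
    t₂*Q² : t₂ * (Q * Q) ≡ M * ((N - 1ℚ) * (N - q̂))
    t₂*Q² = trans (cong (t₂ *_) (trans (sym (fromℕ-* (q ^ m) (q ^ m))) (cong fromℕ square))) (fTerm-two n m k)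
      where
      square : q ^ m ℕ.* q ^ m ≡ q ^ (m ℕ.* 2)
      square = trans (cong (q ^ m ℕ.*_) (sym (ℕ.*-identityʳ (q ^ m)))) (ℕ.^-*-assoc q m 2)
    expand : ∀ s t u Q → (s + (t + (u + 0ℚ))) * (Q * Q) ≡ s * (Q * Q) + t * Q * Q + u * (Q * Q)
    expand = RingSolver.solve-∀ ℚ-ring
    factor : ∀ M Q a b c → M * (Q * Q) + M * a * b * Q + M * (a * c) ≡ M * (Q * Q + a * b * Q + a * c)
    factor = RingSolver.solve-∀ ℚ-ring

-- Mean and variance

module MeanAndVariance
  {q n m k : ℕ} {{primePower : PrimePower q}} {{_ : ℕ.NonZero n}} {{_ : ℕ.NonZero m}} {{_ : ℕ.NonZero k}}
  {K : FiniteField q} {L : FiniteField (q ^ m)} {E : FieldExtension K L} (Γ : OrderedBasis E m)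
  (C : LinearAlgebra.Subspace L n)
  (dimension : LinearAlgebra.HasDimension L (LinearAlgebra.Subspace.Member C) k)
  (nondegenerate : RankMetric.RankNondegenerate Γ C)
  where

  open RankMetric Γ
  open RankSupport Γ
  open Moments Γ C dimension nondegenerate
  open RankTwo Γ C dimension nondegenerate
  open GaussianBinomials K

  private
    instance
      denominator≢0 : ℚ.NonZero (q ^ᶻ (+ (m ℕ.* k)) - 1ℚ)
      denominator≢0 = q^mk-1≢0 q m k
      q≢0 : ℕ.NonZero q
      q≢0 = primePower⇒nonZero primePower
      Q≢0 : ℕ.NonZero Q
      Q≢0 = ℕ.m^n≢0 q m

    X : ℕ → ℚ
    X rank = q ^ᶻ (n ⊖ rank)

    codewords : List (Vec (FiniteField.Carrier L) n)
    codewords = nonzeroCodewords C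

    S₁ S₂ : ℕ
    S₁ = sumOver codewords #orthogonal
    S₂ = sumOver codewords (λ v → #orthogonal v ℕ.* #orthogonal v)

    μ D Q̂ M̂ N̂ q̂ F bound numerator : ℚ
    μ = 𝔼 C X
    D = q ^ᶻ (+ (m ℕ.* k)) - 1ℚ
    Q̂ = fromℕ Q
    M̂ = fromℕ M
    N̂ = fromℕ (q ^ n)
    q̂ = fromℕ q
    F = - (q ^ᶻ (+ (2 ℕ.* n))) + f K n m k 0 2
    bound = F ÷ D - μ * μ
    numerator = - (q ^ᶻ (+ n)) + q ^ᶻ (+ (m ℕ.* k)) + q ^ᶻ (+ m ℤ.* (+ k ℤ.- + 1)) * (q ^ᶻ (+ n) - 1ℚ)

  -- Both sides times `q ^ rk v` give `q ^ n`. This makes the values of the random variable natural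
  -- numbers, to which the counted moments apply.
  X-rk : ∀ (v : Vec (FiniteField.Carrier L) n) → X (rk v) ≡ fromℕ (#orthogonal v)
  X-rk v = *-cancelʳ-fromℕ (q ^ rk v) {{ℕ.m^n≢0 q (rk v)}} (begin
    X (rk v) * fromℕ (q ^ rk v)                   ≡⟨ ^ᶻ-⊖ n (rk v) ⟩
    fromℕ (q ^ n)                                 ≡⟨ cong fromℕ (#orthogonal-rk v) ⟨
    fromℕ (q ^ rk v ℕ.* #orthogonal v)            ≡⟨ cong fromℕ (ℕ.*-comm (q ^ rk v) (#orthogonal v)) ⟩
    fromℕ (#orthogonal v ℕ.* q ^ rk v)            ≡⟨ fromℕ-* (#orthogonal v) (q ^ rk v) ⟩
    fromℕ (#orthogonal v) * fromℕ (q ^ rk v)      ∎)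
    where open ≡-Reasoning

  D≡length : D ≡ fromℕ (length codewords)
  D≡length = trans (cong (λ l → fromℕ l - 1ℚ) (sym length-nonzeroCodewords))
    (trans (cong (_- 1ℚ) (fromℕ-+ 1 (length codewords))) (cancel (fromℕ (length codewords))))
    where
    cancel : ∀ l → 1ℚ + l - 1ℚ ≡ l
    cancel = RingSolver.solve-∀ ℚ-ring

  𝔼-* : ∀ (g : ℕ → ℚ) → 𝔼 C g * D ≡ ∑ (List.map (g ∘ rk) codewords)
  𝔼-* g = trans (cong (𝔼 C g *_) (trans D≡length (cong fromℕ (sym (List.length-map (g ∘ rk) codewords)))))
                (average-* (List.map (g ∘ rk) codewords))

  μ-* : μ * D ≡ fromℕ S₁
  μ-* = trans (𝔼-* X) (∑-fromℕ codewords X-rk)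

  Var-* : Var C X * D ≡ fromℕ S₂ - μ * μ * D
  Var-* = begin
    Var C X * D
      ≡⟨ 𝔼-* (λ r → (X r - μ) * (X r - μ)) ⟩
    ∑ (List.map (λ v → (X (rk v) - μ) * (X (rk v) - μ)) codewords)
      ≡⟨ ∑-square-deviation codewords (X ∘ rk) μ ⟩
    ∑ (List.map (λ v → X (rk v) * X (rk v)) codewords) - (μ + μ) * ∑ (List.map (X ∘ rk) codewords) + fromℕ (length codewords) * (μ * μ)
      ≡⟨ cong (λ s → s - (μ + μ) * ∑ (List.map (X ∘ rk) codewords) + fromℕ (length codewords) * (μ * μ))
           (∑-fromℕ codewords λ v → trans (cong₂ _*_ (X-rk v) (X-rk v)) (sym (fromℕ-* (#orthogonal v) (#orthogonal v)))) ⟩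
    fromℕ S₂ - (μ + μ) * ∑ (List.map (X ∘ rk) codewords) + fromℕ (length codewords) * (μ * μ)
      ≡⟨ cong₂ (λ s l → fromℕ S₂ - (μ + μ) * s + l * (μ * μ)) (𝔼-* X) D≡length ⟨
    fromℕ S₂ - (μ + μ) * (μ * D) + D * (μ * μ)
      ≡⟨ simplify (fromℕ S₂) μ D ⟩
    fromℕ S₂ - μ * μ * D ∎
    where
    open ≡-Reasoning
    simplify : ∀ s μ D → s - (μ + μ) * (μ * D) + D * (μ * μ) ≡ s - μ * μ * D
    simplify = RingSolver.solve-∀ ℚ-ring

  fromℕ-#nonzero : fromℕ #nonzero ≡ N̂ - 1ℚ
  fromℕ-#nonzero = trans (cancel (fromℕ #nonzero)) (cong (_- 1ℚ) (trans (sym (fromℕ-+ 1 #nonzero)) (cong fromℕ (FiniteLinearAlgebra.count-≢0 K n))))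
    where
    cancel : ∀ a → a ≡ 1ℚ + a - 1ℚ
    cancel = RingSolver.solve-∀ ℚ-ring

  S₁-* : fromℕ S₁ * Q̂ ≡ numerator * Q̂
  S₁-* = begin
    fromℕ S₁ * Q̂
      ≡⟨ shift (fromℕ S₁) N̂ Q̂ ⟩
    Q̂ * (fromℕ S₁ + N̂) - N̂ * Q̂
      ≡⟨ cong (λ s → Q̂ * s - N̂ * Q̂) (fromℕ-+ S₁ (q ^ n)) ⟨
    Q̂ * fromℕ (S₁ ℕ.+ q ^ n) - N̂ * Q̂
      ≡⟨ cong (_- N̂ * Q̂) (fromℕ-* Q (S₁ ℕ.+ q ^ n)) ⟨
    fromℕ (Q ℕ.* (S₁ ℕ.+ q ^ n)) - N̂ * Q̂
      ≡⟨ cong (λ s → fromℕ s - N̂ * Q̂) moment ⟩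
    fromℕ (Q ℕ.* M ℕ.+ #nonzero ℕ.* M) - N̂ * Q̂
      ≡⟨ cong (_- N̂ * Q̂) (trans (fromℕ-+ (Q ℕ.* M) (#nonzero ℕ.* M))
           (cong₂ _+_ (fromℕ-* Q M) (trans (fromℕ-* #nonzero M) (cong (_* M̂) fromℕ-#nonzero)))) ⟩
    Q̂ * M̂ + (N̂ - 1ℚ) * M̂ - N̂ * Q̂
      -- `A * Q̂ ≡ M̂` trades the size of the code for the power with exponent m(k - 1) in the
      -- stated mean.
      ≡⟨ cong (λ s → Q̂ * M̂ + (N̂ - 1ℚ) * s - N̂ * Q̂)
           (trans (cong (λ e → A * fromℕ (q ^ e)) (sym (ℕ.*-identityʳ m))) (^ᶻ-*-minus m k 1)) ⟨
    Q̂ * M̂ + (N̂ - 1ℚ) * (A * Q̂) - N̂ * Q̂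
      ≡⟨ factor Q̂ M̂ N̂ A ⟩
    (- N̂ + M̂ + A * (N̂ - 1ℚ)) * Q̂ ∎
    where
    open ≡-Reasoning
    A = q ^ᶻ (+ m ℤ.* (+ k ℤ.- + 1))
    moment : Q ℕ.* (S₁ ℕ.+ q ^ n) ≡ Q ℕ.* M ℕ.+ #nonzero ℕ.* M
    moment = trans (cong (Q ℕ.*_) (trans (cong (S₁ ℕ.+_) (sym #orthogonal-0)) (nonzeroCodewords-sum #orthogonal))) firstMoment
    shift : ∀ s N Q → s * Q ≡ Q * (s + N) - N * Q
    shift = RingSolver.solve-∀ ℚ-ring
    factor : ∀ Q M N A → Q * M + (N - 1ℚ) * (A * Q) - N * Q ≡ (- N + M + A * (N - 1ℚ)) * Q
    factor = RingSolver.solve-∀ ℚ-ring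

  mean : μ ≡ numerator ÷ D
  mean = ÷-unique {μ} {numerator} {D} (trans μ-* (*-cancelʳ-fromℕ {fromℕ S₁} {numerator} Q S₁-*))

  -- By `Var-bound` this is the gap between variance and bound, times the number of nonzero
  -- codewords and `Q ℕ.* Q`. Its being a natural number gives the inequality, its vanishing the
  -- equality case.
  error : ℕ
  error = M ℕ.* (ℕ.pred Q ℕ.* #bad)

  S₂-* : fromℕ S₂ * (Q̂ * Q̂) ≡ F * (Q̂ * Q̂) + fromℕ error
  S₂-* = begin
    fromℕ S₂ * (Q̂ * Q̂)
      ≡⟨ shift (fromℕ S₂) (N̂ * N̂) (Q̂ * Q̂) ⟩
    Q̂ * Q̂ * (fromℕ S₂ + N̂ * N̂) - N̂ * N̂ * (Q̂ * Q̂)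
      ≡⟨ cong (_- N̂ * N̂ * (Q̂ * Q̂)) moment ⟩
    M̂ * (Q̂ * Q̂ + (N̂ - 1ℚ) * Q̂ + (N̂ - 1ℚ) * (q̂ * Q̂ + (N̂ - q̂)) + e) - N̂ * N̂ * (Q̂ * Q̂)
      ≡⟨ split M̂ Q̂ N̂ q̂ e ⟩
    - (N̂ * N̂) * (Q̂ * Q̂) + M̂ * (Q̂ * Q̂ + (N̂ - 1ℚ) * (q̂ + 1ℚ) * Q̂ + (N̂ - 1ℚ) * (N̂ - q̂)) + M̂ * e
      ≡⟨ cong₂ (λ s t → - (N̂ * N̂) * (Q̂ * Q̂) + s + t) (f-0-2 n m k) (fromℕ-* M (ℕ.pred Q ℕ.* #bad)) ⟨
    - (N̂ * N̂) * (Q̂ * Q̂) + f K n m k 0 2 * (Q̂ * Q̂) + fromℕ error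
      ≡⟨ cong (_+ fromℕ error) (ℚ.*-distribʳ-+ (Q̂ * Q̂) (- (N̂ * N̂)) (f K n m k 0 2)) ⟨
    (- (N̂ * N̂) + f K n m k 0 2) * (Q̂ * Q̂) + fromℕ error
      ≡⟨ cong (λ s → (- s + f K n m k 0 2) * (Q̂ * Q̂) + fromℕ error) N̂² ⟩
    F * (Q̂ * Q̂) + fromℕ error ∎
    where
    open ≡-Reasoning
    e = fromℕ (ℕ.pred Q ℕ.* #bad)
    shift : ∀ s N Q → s * Q ≡ Q * (s + N) - N * Q
    shift = RingSolver.solve-∀ ℚ-ring
    split : ∀ M Q N q e →
      M * (Q * Q + (N - 1ℚ) * Q + (N - 1ℚ) * (q * Q + (N - q)) + e) - N * N * (Q * Q)
      ≡ - (N * N) * (Q * Q) + M * (Q * Q + (N - 1ℚ) * (q + 1ℚ) * Q + (N - 1ℚ) * (N - q)) + M * e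
    split = RingSolver.solve-∀ ℚ-ring
    N̂² : N̂ * N̂ ≡ fromℕ (q ^ (2 ℕ.* n))
    N̂² = trans (sym (fromℕ-* (q ^ n) (q ^ n)))
      (cong fromℕ (trans (sym (ℕ.^-distribˡ-+-* q n n)) (cong (λ s → q ^ (n ℕ.+ s)) (sym (ℕ.+-identityʳ n)))))
    -- Since `n` is positive, the truncated subtraction in `secondMoment` is a true difference.
    q≤q^n : q ℕ.≤ q ^ n
    q≤q^n = ℕ.≤-trans (ℕ.≤-reflexive (sym (ℕ.^-identityʳ q))) (ℕ.^-monoʳ-≤ q (ℕ.>-nonZero⁻¹ n))
    complement : fromℕ (q ^ n ℕ.∸ q) ≡ N̂ - q̂
    complement = trans (cancel (fromℕ (q ^ n ℕ.∸ q)) q̂)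
      (cong (_- q̂) (trans (sym (fromℕ-+ q (q ^ n ℕ.∸ q))) (cong fromℕ (ℕ.m+[n∸m]≡n q≤q^n))))
      where
      cancel : ∀ a q → a ≡ q + a - q
      cancel = RingSolver.solve-∀ ℚ-ring
    moment : Q̂ * Q̂ * (fromℕ S₂ + N̂ * N̂) ≡ M̂ * (Q̂ * Q̂ + (N̂ - 1ℚ) * Q̂ + (N̂ - 1ℚ) * (q̂ * Q̂ + (N̂ - q̂)) + e)
    moment = begin
      Q̂ * Q̂ * (fromℕ S₂ + N̂ * N̂)
        ≡⟨ cong₂ _*_ (fromℕ-* Q Q) (trans (fromℕ-+ S₂ (q ^ n ℕ.* q ^ n)) (cong (λ s → fromℕ S₂ + s) (fromℕ-* (q ^ n) (q ^ n)))) ⟨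
      fromℕ (Q ℕ.* Q) * fromℕ (S₂ ℕ.+ q ^ n ℕ.* q ^ n)
        ≡⟨ fromℕ-* (Q ℕ.* Q) (S₂ ℕ.+ q ^ n ℕ.* q ^ n) ⟨
      fromℕ (Q ℕ.* Q ℕ.* (S₂ ℕ.+ q ^ n ℕ.* q ^ n))
        ≡⟨ cong fromℕ (trans (cong (Q ℕ.* Q ℕ.*_) (trans (cong (S₂ ℕ.+_) (sym (cong₂ ℕ._*_ #orthogonal-0 #orthogonal-0)))
             (nonzeroCodewords-sum (λ v → #orthogonal v ℕ.* #orthogonal v)))) secondMoment) ⟩
      fromℕ (M ℕ.* (Q ℕ.* Q ℕ.+ #nonzero ℕ.* Q ℕ.+ #nonzero ℕ.* (q ℕ.* Q ℕ.+ (q ^ n ℕ.∸ q)) ℕ.+ ℕ.pred Q ℕ.* #bad))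
        ≡⟨ fromℕ-* M _ ⟩
      M̂ * fromℕ (Q ℕ.* Q ℕ.+ #nonzero ℕ.* Q ℕ.+ #nonzero ℕ.* (q ℕ.* Q ℕ.+ (q ^ n ℕ.∸ q)) ℕ.+ ℕ.pred Q ℕ.* #bad)
        ≡⟨ cong (M̂ *_) (trans (fromℕ-+ (Q ℕ.* Q ℕ.+ #nonzero ℕ.* Q ℕ.+ #nonzero ℕ.* (q ℕ.* Q ℕ.+ (q ^ n ℕ.∸ q))) (ℕ.pred Q ℕ.* #bad)) (cong (_+ e)
             (trans (fromℕ-+ (Q ℕ.* Q ℕ.+ #nonzero ℕ.* Q) (#nonzero ℕ.* (q ℕ.* Q ℕ.+ (q ^ n ℕ.∸ q)))) (cong₂ _+_
               (trans (fromℕ-+ (Q ℕ.* Q) (#nonzero ℕ.* Q)) (cong₂ _+_ (fromℕ-* Q Q) (fromℕ-* #nonzero Q)))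
               (trans (fromℕ-* #nonzero (q ℕ.* Q ℕ.+ (q ^ n ℕ.∸ q))) (cong (fromℕ #nonzero *_)
                 (trans (fromℕ-+ (q ℕ.* Q) (q ^ n ℕ.∸ q)) (cong₂ _+_ (fromℕ-* q Q) complement)))))))) ⟩
      M̂ * (Q̂ * Q̂ + fromℕ #nonzero * Q̂ + fromℕ #nonzero * (q̂ * Q̂ + (N̂ - q̂)) + e)
        ≡⟨ cong (λ z → M̂ * (Q̂ * Q̂ + z * Q̂ + z * (q̂ * Q̂ + (N̂ - q̂)) + e)) fromℕ-#nonzero ⟩
      M̂ * (Q̂ * Q̂ + (N̂ - 1ℚ) * Q̂ + (N̂ - 1ℚ) * (q̂ * Q̂ + (N̂ - q̂)) + e) ∎

  Var-bound : Var C X * fromℕ (length codewords ℕ.* (Q ℕ.* Q)) ≡ bound * fromℕ (length codewords ℕ.* (Q ℕ.* Q)) + fromℕ error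
  Var-bound = begin
    Var C X * fromℕ (length codewords ℕ.* (Q ℕ.* Q))     ≡⟨ cong (Var C X *_) scale ⟩
    Var C X * (D * (Q̂ * Q̂))                              ≡⟨ ℚ.*-assoc (Var C X) D (Q̂ * Q̂) ⟨
    Var C X * D * (Q̂ * Q̂)                                ≡⟨ cong (_* (Q̂ * Q̂)) Var-* ⟩
    (fromℕ S₂ - μ * μ * D) * (Q̂ * Q̂)                     ≡⟨ distrib (fromℕ S₂) (μ * μ * D) (Q̂ * Q̂) ⟩
    fromℕ S₂ * (Q̂ * Q̂) - μ * μ * D * (Q̂ * Q̂)             ≡⟨ cong (_- μ * μ * D * (Q̂ * Q̂)) S₂-* ⟩
    F * (Q̂ * Q̂) + fromℕ error - μ * μ * D * (Q̂ * Q̂)      ≡⟨ cong (λ s → s * (Q̂ * Q̂) + fromℕ error - μ * μ * D * (Q̂ * Q̂)) (÷-* F D) ⟨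
    (F ÷ D) * D * (Q̂ * Q̂) + fromℕ error - μ * μ * D * (Q̂ * Q̂)   ≡⟨ collect (F ÷ D) (μ * μ) D (Q̂ * Q̂) (fromℕ error) ⟩
    bound * (D * (Q̂ * Q̂)) + fromℕ error                  ≡⟨ cong (λ s → bound * s + fromℕ error) scale ⟨
    bound * fromℕ (length codewords ℕ.* (Q ℕ.* Q)) + fromℕ error ∎
    where
    open ≡-Reasoning
    scale : fromℕ (length codewords ℕ.* (Q ℕ.* Q)) ≡ D * (Q̂ * Q̂)
    scale = trans (fromℕ-* (length codewords) (Q ℕ.* Q)) (cong₂ _*_ (sym D≡length) (fromℕ-* Q Q))
    distrib : ∀ a b c → (a - b) * c ≡ a * c - b * c
    distrib = RingSolver.solve-∀ ℚ-ring
    collect : ∀ x y D Q e → x * D * Q + e - y * D * Q ≡ (x - y) * (D * Q) + e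
    collect = RingSolver.solve-∀ ℚ-ring

  length≢0 : ℕ.NonZero (length codewords)
  length≢0 = ℕ.≢-nonZero λ l≡0 → ℕ.NonZero.nonZero (subst ℚ.NonZero (trans D≡length (cong fromℕ l≡0)) denominator≢0)

  error≡0⇔#bad≡0 : (error ≡ 0) ⇔ (#bad ≡ 0)
  error≡0⇔#bad≡0 = mk⇔
    (λ eq → cancel (ℕ.pred Q) {{pred≢0}} (cancel M {{ℕ.m^n≢0 q (m ℕ.* k)}} eq))
    (λ eq → trans (cong (λ b → M ℕ.* (ℕ.pred Q ℕ.* b)) eq) (trans (cong (M ℕ.*_) (ℕ.*-zeroʳ (ℕ.pred Q))) (ℕ.*-zeroʳ M)))
    where
    cancel : ∀ a {b} .{{_ : ℕ.NonZero a}} → a ℕ.* b ≡ 0 → b ≡ 0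
    cancel a {b} eq = ℕ.*-cancelˡ-≡ b 0 a (trans eq (sym (ℕ.*-zeroʳ a)))
    -- `Q` exceeds 1 because `q` does and `m` is positive, so every bad pair leaves a trace in
    -- `error`.
    pred≢0 : ℕ.NonZero (ℕ.pred Q)
    pred≢0 = ℕ.>-nonZero (ℕ.<⇒≤pred (ℕ.<-≤-trans (1<primePower primePower)
      (ℕ.≤-trans (ℕ.≤-reflexive (sym (ℕ.^-identityʳ q))) (ℕ.^-monoʳ-≤ q (ℕ.>-nonZero⁻¹ m)))))

  variance : bound ≤ Var C X × (2 ℕ.≤ n → (Var C X ≡ bound) ⇔ Rank2Nondegenerate C)
  variance = proj₁ gap , λ 2≤n → rank2⇔#bad≡0 2≤n ⇔-∘ (error≡0⇔#bad≡0 ⇔-∘ proj₂ gap)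
    where
    gap : bound ≤ Var C X × ((Var C X ≡ bound) ⇔ (error ≡ 0))
    gap = excess {Var C X} {bound} (length codewords ℕ.* (Q ℕ.* Q))
      {{ℕ.m*n≢0 (length codewords) (Q ℕ.* Q) {{length≢0}} {{ℕ.m*n≢0 Q Q}}}} error Var-bound

corollary4p14 :
  ∀ {q n m k d : ℕ} {{_ : PrimePower q}} {{_ : NonZero n}} {{_ : NonZero m}} {{_ : NonZero k}}
  (K : FiniteField q) (L : FiniteField (q ^ m)) (E : FieldExtension K L) (Γ : OrderedBasis E m)
  (C : LinearAlgebra.Subspace L n) →
  let open RankMetric Γ
      instance
        denominator≢0 = q^mk-1≢0 q m k
      X : ℕ → ℚ
      X rank = q ^ᶻ (n ⊖ rank)
      bound : ℚ
      bound = (- (q ^ᶻ (+ (2 ℕ.* n))) + f K n m k 0 2) ÷ (q ^ᶻ (+ (m ℕ.* k)) - 1ℚ)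
              - 𝔼 C X * 𝔼 C X
  in
  IsCode C k d →
  RankNondegenerate C →
    𝔼 C X ≡ (- (q ^ᶻ (+ n)) + q ^ᶻ (+ (m ℕ.* k))
              + q ^ᶻ (+ m ℤ.* (+ k ℤ.- + 1)) * (q ^ᶻ (+ n) - 1ℚ))
             ÷ (q ^ᶻ (+ (m ℕ.* k)) - 1ℚ)
  × bound ≤ Var C X
  -- If n = 1 then k = 1 and the dual code is zero, of minimum distance n + 1 = 2
  -- by convention, although equality holds; so this part needs n ≥ 2.
  × (2 ℕ.≤ n → (Var C X ≡ bound) ⇔ Rank2Nondegenerate C)
corollary4p14 K L E Γ C (dimension , _) nondegenerate = mean , variance
  where open MeanAndVariance Γ C dimension nondegenerate
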